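{- Let $p$ be a rational prime and let $R$ be a complete discrete valuation ring with maximal ideal generated by $p$ and algebraically closed residue field $R/pR$. Let $G$ be an affine smooth group scheme over $R$. Assume there exists an open subset $G^0\subset G$ with $\widehat{G^0}\neq\emptyset$ such that the $p$-adic completion $\widehat{G^0}$ admits a Frobenius lift that is Lie invariant mod $p$. Then $G(R)$ contains no non-trivial unipotent elements of index $\leq p$.
   Context: The ring $R$ has a unique Frobenius lift $\phi:R\to R$, i.e. a ring endomorphism inducing the $p$-power Frobenius on $R/pR$. For a scheme $X$ over $R$, $\widehat{X}$ denotes its $p$-adic completion (a $p$-adic formal scheme). A Frobenius lift on a $p$-adic formal scheme $X$ over $R$ is an endomorphism $\phi:X\to X$ whose reduction mod $p$ is the $p$-power Frobenius on the reduction of $X$ mod $p$; it is always assumed compatible with the Frobenius lift on $R$. Differentials are $\Omega_{\widehat{X}/R}:=\varprojlim_n \Omega_{X_n/R_n}$, where $R_n=R/p^nR$, $X_n=X\otimes_R R_n$ (for $X$ affine; in general one glues). If $X$ is smooth over $R$ and $\phi$ is a Frobenius lift on $\widehat{X}$, then $\phi^*\omega$ is uniquely divisible by $p$ for every $1$-form $\omega$, giving an additive map $\frac{\phi^*}{p}:\Omega_{\widehat{X}/R}\to\Omega_{\widehat{X}/R}$, $\omega\mapsto \frac{\phi^*\omega}{p}$. Lie invariance: let $G$ be a smooth group scheme over $R$ of relative dimension $d$, let $G^0\subset G$ be a Zariski open set with non-empty reduction mod $p$, and let $\omega$ be a column vector of size $D\geq d$ whose entries generate the $R$-module of left invariant $1$-forms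 on $G$ (also viewed, by restriction, as forms on $\widehat{G^0}$). A Frobenius lift $\phi$ on $\widehat{G^0}$ is Lie invariant mod $p$ if there exists a $D\times D$ matrix $\lambda$ with coefficients in $R$ such that $\frac{\phi^*}{p}\omega\equiv\lambda\,\omega \bmod p$, where $\frac{\phi^*}{p}$ is applied entrywise. This condition does not depend on the choice of $\omega$. Unipotent elements and index: let $G$ be an affine group scheme of finite type over a ring $A$. "Embedding $G\subset GL_N$" means a closed embedding of group schemes over $A$; $\mathfrak{gl}_N(A)$ is the ring of $N\times N$ matrices over $A$. An element $u\in G(A)$ is unipotent if there is an embedding $G\subset GL_N$ (for some $N$) such that $u-1$ is nilpotent in $\mathfrak{gl}_N(A)$. The index of a unipotent $u\in G(A)$ is the minimum of all integers $n\geq 1$ for which there exists an embedding $G\subset GL_N$ (for some $N$) such that $(u-1)^n=0$ in $\mathfrak{gl}_N(A)$. -}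

module Defs where

open import Algebra.Bundles using (AbelianGroup; CommutativeRing; RawRing)
open import Algebra.Module.Bundles using (Module)
open import Algebra.Module.Structures.Biased using (IsModuleFromLeft)
open import Algebra.Morphism.Structures using (IsRingHomomorphism; IsRingIsomorphism)
import Algebra.Definitions.RawMonoid as RawMonoidOps
import Algebra.Definitions.RawSemiring as RawSemiringOps
import Algebra.Properties.AbelianGroup as AbelianGroupProperties
import Algebra.Properties.CommutativeSemigroup as CommutativeSemigroupProperties
import Algebra.Properties.Ring as RingProperties
import Algebra.Properties.Semiring.Mult as SemiringMult
import Algebra.Properties.Semiring.Sum as SemiringSum
open import Algebra.Structures using (IsAbelianGroup; IsGroup)
open import Data.Bool using (true; false; if_then_else_)
open import Data.Empty using (⊥)
open import Data.Fin using (Fin; zero; suc; fromℕ; toℕ; _≟_)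
open import Data.Nat using (ℕ; zero; suc; _≤_)
import Data.Nat as ℕ
open import Data.Product using (Σ; Σ-syntax; _×_; _,_; proj₁; proj₂)
open import Data.Sum using (_⊎_)
open import Data.Unit using (⊤; tt)
open import Function using (id; _∘_)
open import Level using (Level; Lift; _⊔_) renaming (suc to lsuc)
open import Relation.Binary.PropositionalEquality using (_≡_)
import Relation.Binary.Reasoning.Setoid as SetoidReasoning
open import Relation.Binary.Structures using (IsEquivalence)
open import Relation.Nullary using (¬_; does)

open CommutativeRing using (Carrier; rawRing)

private
  variable
    a b c ℓ x : Level

-- The library's RingHomomorphism, indexed by the bundles so that these can be inferred.
record Hom (R : CommutativeRing a a) (S : CommutativeRing b b) : Set (a ⊔ b) where
  field
    ⟦_⟧                : Carrier R → Carrier S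
    isRingHomomorphism : IsRingHomomorphism (rawRing R) (rawRing S) ⟦_⟧
  open IsRingHomomorphism isRingHomomorphism public

open Hom using (⟦_⟧) public

module _ (R : CommutativeRing a a) (S : CommutativeRing b b) where
  private
    module R = CommutativeRing R
    module S = CommutativeRing S

  mkHom : (f : R.Carrier → S.Carrier) →
          (∀ {r s} → r R.≈ s → f r S.≈ f s) →
          (∀ r s → f (r R.+ s) S.≈ f r S.+ f s) →
          (∀ r s → f (r R.* s) S.≈ f r S.* f s) →
          f R.1# S.≈ S.1# →
          Hom R S
  mkHom f f-cong f-+ f-* f-1 = record
    { ⟦_⟧ = f
    ; isRingHomomorphism = record
      { isSemiringHomomorphism = record
        { isNearSemiringHomomorphism = record
          { +-isMonoidHomomorphism = record
            { isMagmaHomomorphism = record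
              { isRelHomomorphism = record { cong = f-cong }
              ; homo = f-+
              }
            ; ε-homo = f-0
            }
          ; *-homo = f-*
          }
        ; 1#-homo = f-1
        }
      ; -‿homo = λ r → inverseˡ-unique _ _
          (S.trans (S.sym (f-+ (R.- r) r)) (S.trans (f-cong (R.-‿inverseˡ r)) f-0))
      }
    }
    where
    open AbelianGroupProperties S.+-abelianGroup using (identityˡ-unique; inverseˡ-unique)
    f-0 : f R.0# S.≈ S.0#
    f-0 = identityˡ-unique _ (f R.0#)
      (S.trans (S.sym (f-+ R.0# R.0#)) (f-cong (R.+-identityˡ R.0#)))

idHom : (R : CommutativeRing a a) → Hom R R
idHom R = mkHom R R id id (λ _ _ → refl) (λ _ _ → refl) refl
  where open CommutativeRing R

infixr 9 _∘ₕ_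
_∘ₕ_ : {R : CommutativeRing a a} {S : CommutativeRing b b} {T : CommutativeRing c c} →
       Hom S T → Hom R S → Hom R T
_∘ₕ_ {R = R} {T = T} g f = mkHom R T (⟦ g ⟧ ∘ ⟦ f ⟧) (g.⟦⟧-cong ∘ f.⟦⟧-cong)
  (λ r s → trans (g.⟦⟧-cong (f.+-homo r s)) (g.+-homo _ _))
  (λ r s → trans (g.⟦⟧-cong (f.*-homo r s)) (g.*-homo _ _))
  (trans (g.⟦⟧-cong f.1#-homo) g.1#-homo)
  where
  module f = Hom f
  module g = Hom g
  open CommutativeRing T using (trans)

record Algebra (K : CommutativeRing a a) (b : Level) : Set (a ⊔ lsuc b) where
  field
    ring : CommutativeRing b b
    ι    : Hom K ring
  open CommutativeRing ring public hiding (ring)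

open Algebra using (ring; ι) public

-- Ring homomorphisms A → B lying over a map of base rings κ : K → K′.
record AlgHomOver {K K′ : CommutativeRing ℓ ℓ} (κ : Carrier K → Carrier K′)
                  (A : Algebra K ℓ) (B : Algebra K′ ℓ) : Set ℓ where
  private
    module B = Algebra B
  field
    hom   : Hom (ring A) (ring B)
    ι-hom : ∀ k → ⟦ hom ⟧ (⟦ ι A ⟧ k) B.≈ ⟦ ι B ⟧ (κ k)
  open Hom hom public using (⟦⟧-cong; +-homo; *-homo; 0#-homo; 1#-homo; -‿homo)

open AlgHomOver using (hom)

infixr 8 _$ₐ_
_$ₐ_ : {K K′ : CommutativeRing ℓ ℓ} {κ : Carrier K → Carrier K′}
       {A : Algebra K ℓ} {B : Algebra K′ ℓ} →
       AlgHomOver {K = K} {K′ = K′} κ A B → Algebra.Carrier A → Algebra.Carrier B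
h $ₐ r = ⟦ hom h ⟧ r

AlgHom : {K : CommutativeRing ℓ ℓ} → Algebra K ℓ → Algebra K ℓ → Set ℓ
AlgHom {K = K} = AlgHomOver {K = K} {K′ = K} id

module _ {K : CommutativeRing ℓ ℓ} where

  infix 4 _≈ₐ_
  _≈ₐ_ : {A B : Algebra K ℓ} → AlgHom A B → AlgHom A B → Set ℓ
  _≈ₐ_ {B = B} g h = ∀ r → (g $ₐ r) ≈ (h $ₐ r)
    where open Algebra B using (_≈_)

  infixr 9 _∘ₐ_
  _∘ₐ_ : {A B C : Algebra K ℓ} → AlgHom B C → AlgHom A B → AlgHom A C
  _∘ₐ_ {C = C} g h = record
    { hom   = hom g ∘ₕ hom h
    ; ι-hom = λ k → trans (g.⟦⟧-cong (h.ι-hom k)) (g.ι-hom k)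
    }
    where
    module g = AlgHomOver g
    module h = AlgHomOver h
    open Algebra C using (trans)

self : (K : CommutativeRing ℓ ℓ) → Algebra K ℓ
self K .ring = K
self K .ι    = idHom K

restrictScalars : {K : CommutativeRing ℓ ℓ} (S : Algebra K ℓ) → Algebra (ring S) ℓ → Algebra K ℓ
restrictScalars S B .ring = ring B
restrictScalars S B .ι    = ι B ∘ₕ ι S

data Term (C : Set c) (X : Set x) : Set (c ⊔ x) where
  const   : C → Term C X
  var     : X → Term C X
  _⊞_ _⊠_ : Term C X → Term C X → Term C X
  ⊟_      : Term C X → Term C X

module Presentation (K : CommutativeRing ℓ ℓ) (X : Set x)
                    (Rel : Term (Carrier K) X → Term (Carrier K) X → Set ℓ) where
  private
    module K = CommutativeRing K
    T = Term K.Carrier X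

  infix 4 _≋_
  data _≋_ : T → T → Set (ℓ ⊔ x) where
    rel         : ∀ {s t} → Rel s t → s ≋ t
    ≋-refl      : ∀ {s} → s ≋ s
    ≋-sym       : ∀ {s t} → s ≋ t → t ≋ s
    ≋-trans     : ∀ {s t u} → s ≋ t → t ≋ u → s ≋ u
    ⊞-cong      : ∀ {s s′ t t′} → s ≋ s′ → t ≋ t′ → (s ⊞ t) ≋ (s′ ⊞ t′)
    ⊠-cong      : ∀ {s s′ t t′} → s ≋ s′ → t ≋ t′ → (s ⊠ t) ≋ (s′ ⊠ t′)
    ⊟-cong      : ∀ {s t} → s ≋ t → (⊟ s) ≋ (⊟ t)
    const-cong  : ∀ {k l} → k K.≈ l → const k ≋ const l
    const-+     : ∀ k l → const (k K.+ l) ≋ (const k ⊞ const l)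
    const-*     : ∀ k l → const (k K.* l) ≋ (const k ⊠ const l)
    const-neg   : ∀ k → const (K.- k) ≋ (⊟ const k)
    ⊞-assoc     : ∀ s t u → ((s ⊞ t) ⊞ u) ≋ (s ⊞ (t ⊞ u))
    ⊞-comm      : ∀ s t → (s ⊞ t) ≋ (t ⊞ s)
    ⊞-identityˡ : ∀ s → (const K.0# ⊞ s) ≋ s
    ⊞-inverseˡ  : ∀ s → ((⊟ s) ⊞ s) ≋ const K.0#
    ⊠-assoc     : ∀ s t u → ((s ⊠ t) ⊠ u) ≋ (s ⊠ (t ⊠ u))
    ⊠-comm      : ∀ s t → (s ⊠ t) ≋ (t ⊠ s)
    ⊠-identityˡ : ∀ s → (const K.1# ⊠ s) ≋ s
    ⊠-distribˡ  : ∀ s t u → (s ⊠ (t ⊞ u)) ≋ ((s ⊠ t) ⊞ (s ⊠ u))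

  presentedRing : CommutativeRing (ℓ ⊔ x) (ℓ ⊔ x)
  presentedRing .CommutativeRing.Carrier = T
  presentedRing .CommutativeRing._≈_     = _≋_
  presentedRing .CommutativeRing._+_     = _⊞_
  presentedRing .CommutativeRing._*_     = _⊠_
  presentedRing .CommutativeRing.-_      = ⊟_
  presentedRing .CommutativeRing.0#      = const K.0#
  presentedRing .CommutativeRing.1#      = const K.1#
  presentedRing .CommutativeRing.isCommutativeRing = record
      { isRing = record
        { +-isAbelianGroup = record
          { isGroup = record
            { isMonoid = record
              { isSemigroup = record
                { isMagma = record
                  { isEquivalence = record { refl = ≋-refl ; sym = ≋-sym ; trans = ≋-trans }
                  ; ∙-cong = ⊞-cong
                  }
                ; assoc = ⊞-assoc
                }
              ; identity = ⊞-identityˡ , λ s → ≋-trans (⊞-comm _ _) (⊞-identityˡ s)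
              }
            ; inverse = ⊞-inverseˡ , λ s → ≋-trans (⊞-comm _ _) (⊞-inverseˡ s)
            ; ⁻¹-cong = ⊟-cong
            }
          ; comm = ⊞-comm
          }
        ; *-cong = ⊠-cong
        ; *-assoc = ⊠-assoc
        ; *-identity = ⊠-identityˡ , λ s → ≋-trans (⊠-comm _ _) (⊠-identityˡ s)
        ; distrib = ⊠-distribˡ , λ s t u →
            ≋-trans (⊠-comm _ _) (≋-trans (⊠-distribˡ s t u) (⊞-cong (⊠-comm _ _) (⊠-comm _ _)))
        }
      ; *-comm = ⊠-comm
      }

  presented : Algebra K (ℓ ⊔ x)
  presented .ring = presentedRing
  presented .ι    = mkHom K presentedRing const const-cong const-+ const-* ≋-refl

  module _ (S : CommutativeRing c c) (h : Hom K S) (v : X → Carrier S) where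
    private
      module S = CommutativeRing S
      module h = Hom h

    eval : T → S.Carrier
    eval (const k) = ⟦ h ⟧ k
    eval (var i)   = v i
    eval (s ⊞ t)   = eval s S.+ eval t
    eval (s ⊠ t)   = eval s S.* eval t
    eval (⊟ s)     = S.- eval s

    module _ (respects : ∀ {s t} → Rel s t → eval s S.≈ eval t) where

      eval-cong : ∀ {s t} → s ≋ t → eval s S.≈ eval t
      eval-cong (rel r)           = respects r
      eval-cong ≋-refl            = S.refl
      eval-cong (≋-sym e)         = S.sym (eval-cong e)
      eval-cong (≋-trans e f)     = S.trans (eval-cong e) (eval-cong f)
      eval-cong (⊞-cong e f)      = S.+-cong (eval-cong e) (eval-cong f)
      eval-cong (⊠-cong e f)      = S.*-cong (eval-cong e) (eval-cong f)
      eval-cong (⊟-cong e)        = S.-‿cong (eval-cong e)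
      eval-cong (const-cong e)    = h.⟦⟧-cong e
      eval-cong (const-+ k l)     = h.+-homo k l
      eval-cong (const-* k l)     = h.*-homo k l
      eval-cong (const-neg k)     = h.-‿homo k
      eval-cong (⊞-assoc s t u)   = S.+-assoc _ _ _
      eval-cong (⊞-comm s t)      = S.+-comm _ _
      eval-cong (⊞-identityˡ s)   = S.trans (S.+-congʳ h.0#-homo) (S.+-identityˡ _)
      eval-cong (⊞-inverseˡ s)    = S.trans (S.-‿inverseˡ _) (S.sym h.0#-homo)
      eval-cong (⊠-assoc s t u)   = S.*-assoc _ _ _
      eval-cong (⊠-comm s t)      = S.*-comm _ _
      eval-cong (⊠-identityˡ s)   = S.trans (S.*-congʳ h.1#-homo) (S.*-identityˡ _)
      eval-cong (⊠-distribˡ s t u) = S.distribˡ _ _ _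

      evalHom : Hom presentedRing S
      evalHom = mkHom presentedRing S eval eval-cong
        (λ _ _ → S.refl) (λ _ _ → S.refl) h.1#-homo

open Presentation using (presented)

-- A[1/f] = A[x]/(f x − 1).
data InverseOf {C : Set c} (f 1# : C) : Term C ⊤ → Term C ⊤ → Set c where
  inverse : InverseOf f 1# (const f ⊠ var tt) (const 1#)

localization : (A : CommutativeRing ℓ ℓ) → Carrier A → Algebra A ℓ
localization A f = presented A ⊤ (InverseOf f 1#)
  where open CommutativeRing A using (1#)

-- The base change S ⊗_K A, as the S-algebra generated by the elements of A
-- subject to the relations making A → S ⊗_K A a homomorphism of K-algebras.
module _ {K : CommutativeRing ℓ ℓ} (S A : Algebra K ℓ) where
  private
    module A = Algebra A
    module S = Algebra S

  data TensorRel : Term S.Carrier A.Carrier → Term S.Carrier A.Carrier → Set ℓ where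
    ⊗-cong : ∀ {r s} → r A.≈ s → TensorRel (var r) (var s)
    ⊗-+    : ∀ r s → TensorRel (var (r A.+ s)) (var r ⊞ var s)
    ⊗-*    : ∀ r s → TensorRel (var (r A.* s)) (var r ⊠ var s)
    ⊗-ι    : ∀ k → TensorRel (var (⟦ ι A ⟧ k)) (const (⟦ ι S ⟧ k))

  infixr 7 _⊗_
  _⊗_ : Algebra (ring S) ℓ
  _⊗_ = presented (ring S) A.Carrier TensorRel

module _ {K : CommutativeRing ℓ ℓ} (S A : Algebra K ℓ) where
  private
    module K = CommutativeRing K
    module A = Algebra A
    module P = Presentation (ring S) (Algebra.Carrier A) (TensorRel S A)
    S⊗A = restrictScalars S (S ⊗ A)
    module S⊗A = Algebra S⊗A

  includeˡ : AlgHom S S⊗A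
  includeˡ = record { hom = ι (S ⊗ A) ; ι-hom = λ _ → S⊗A.refl }

  includeʳ : AlgHom A S⊗A
  includeʳ = record
    { hom = mkHom A.ring S⊗A.ring var (λ e → P.rel (⊗-cong e))
        (λ r s → P.rel (⊗-+ r s)) (λ r s → P.rel (⊗-* r s))
        (S⊗A.trans (P.rel (⊗-cong (A.sym (Hom.1#-homo (ι A)))))
          (S⊗A.trans (P.rel (⊗-ι K.1#)) (Hom.1#-homo (ι S⊗A))))
    ; ι-hom = λ k → P.rel (⊗-ι k)
    }

module MatrixOps (R : RawRing a b) where
  open RawRing R renaming (Carrier to Scalar)
  open RawMonoidOps +-rawMonoid using (sum)

  Matrix : ℕ → Set a
  Matrix N = Fin N → Fin N → Scalar

  infixl 7 _*ₘ_
  _*ₘ_ : ∀ {N} → Matrix N → Matrix N → Matrix N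
  (A *ₘ B) i j = sum (λ k → A i k * B k j)

  1ₘ : ∀ {N} → Matrix N
  1ₘ i j = if does (i ≟ j) then 1# else 0#

  infixl 6 _-ₘ_
  _-ₘ_ : ∀ {N} → Matrix N → Matrix N → Matrix N
  (A -ₘ B) i j = A i j + - B i j

  infixr 8 _^ₘ_
  _^ₘ_ : ∀ {N} → Matrix N → ℕ → Matrix N
  A ^ₘ zero  = 1ₘ
  A ^ₘ suc n = A *ₘ A ^ₘ n

  infix 4 _≈ₘ_
  _≈ₘ_ : ∀ {N} → Matrix N → Matrix N → Set b
  A ≈ₘ B = ∀ i j → A i j ≈ B i j

  IsZeroₘ : ∀ {N} → Matrix N → Set b
  IsZeroₘ A = ∀ i j → A i j ≈ 0#

module MatrixProperties (R : CommutativeRing a a) where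
  open CommutativeRing R hiding (zero; rawRing) renaming (Carrier to Scalar)
  open MatrixOps (rawRing R)
  open SemiringSum semiring
  open SetoidReasoning setoid

  *ₘ-cong : ∀ {N} {A A′ B B′ : Matrix N} → A ≈ₘ A′ → B ≈ₘ B′ → A *ₘ B ≈ₘ A′ *ₘ B′
  *ₘ-cong e f i j = sum-cong-≋ (λ k → *-cong (e i k) (f k j))

  *ₘ-assoc : ∀ {N} (A B C : Matrix N) → (A *ₘ B) *ₘ C ≈ₘ A *ₘ (B *ₘ C)
  *ₘ-assoc A B C i j = begin
    sum (λ l → sum (λ k → A i k * B k l) * C l j)
      ≈⟨ sum-cong-≋ (λ l → *-distribʳ-sum (C l j) (λ k → A i k * B k l)) ⟩
    sum (λ l → sum (λ k → A i k * B k l * C l j))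
      ≈⟨ ∑-comm (λ l k → A i k * B k l * C l j) ⟩
    sum (λ k → sum (λ l → A i k * B k l * C l j))
      ≈⟨ sum-cong-≋ (λ k → sum-cong-≋ (λ l → *-assoc (A i k) (B k l) (C l j))) ⟩
    sum (λ k → sum (λ l → A i k * (B k l * C l j)))
      ≈⟨ sum-cong-≋ (λ k → sym (*-distribˡ-sum (A i k) (λ l → B k l * C l j))) ⟩
    sum (λ k → A i k * sum (λ l → B k l * C l j))
      ∎

  private
    sum-0 : ∀ {n} (t : Fin n → Scalar) → (∀ i → t i ≈ 0#) → sum t ≈ 0#
    sum-0 {zero}  t e = refl
    sum-0 {suc n} t e = trans (+-cong (e zero) (sum-0 (t ∘ suc) (e ∘ suc))) (+-identityˡ 0#)

    sum-1ˡ : ∀ {n} (i : Fin n) (t : Fin n → Scalar) → sum (λ k → 1ₘ i k * t k) ≈ t i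
    sum-1ˡ zero    t = trans (+-cong (*-identityˡ _) (sum-0 (λ k → 0# * t (suc k)) (λ _ → zeroˡ _))) (+-identityʳ _)
    sum-1ˡ (suc i) t = trans (+-cong (zeroˡ _) (sum-1ˡ i (t ∘ suc))) (+-identityˡ _)

    sum-1ʳ : ∀ {n} (j : Fin n) (t : Fin n → Scalar) → sum (λ k → t k * 1ₘ k j) ≈ t j
    sum-1ʳ zero    t = trans (+-cong (*-identityʳ _) (sum-0 (λ k → t (suc k) * 0#) (λ _ → zeroʳ _))) (+-identityʳ _)
    sum-1ʳ (suc j) t = trans (+-cong (zeroʳ _) (sum-1ʳ j (t ∘ suc))) (+-identityˡ _)

  *ₘ-identityˡ : ∀ {N} (A : Matrix N) → 1ₘ *ₘ A ≈ₘ A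
  *ₘ-identityˡ A i j = sum-1ˡ i (λ k → A k j)

  *ₘ-identityʳ : ∀ {N} (A : Matrix N) → A *ₘ 1ₘ ≈ₘ A
  *ₘ-identityʳ A i j = sum-1ʳ j (A i)

  *ₘ-inverse : ∀ {N} {A A′ B B′ : Matrix N} → A *ₘ A′ ≈ₘ 1ₘ → B *ₘ B′ ≈ₘ 1ₘ →
               (A *ₘ B) *ₘ (B′ *ₘ A′) ≈ₘ 1ₘ
  *ₘ-inverse {A = A} {A′} {B} {B′} e f i j = begin
    ((A *ₘ B) *ₘ (B′ *ₘ A′)) i j ≈⟨ *ₘ-assoc A B (B′ *ₘ A′) i j ⟩
    (A *ₘ (B *ₘ (B′ *ₘ A′))) i j
      ≈⟨ *ₘ-cong {A = A} (λ _ _ → refl) (λ k l → sym (*ₘ-assoc B B′ A′ k l)) i j ⟩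
    (A *ₘ ((B *ₘ B′) *ₘ A′)) i j
      ≈⟨ *ₘ-cong {A = A} (λ _ _ → refl) (*ₘ-cong {B = A′} f (λ _ _ → refl)) i j ⟩
    (A *ₘ (1ₘ *ₘ A′)) i j        ≈⟨ *ₘ-cong {A = A} (λ _ _ → refl) (*ₘ-identityˡ A′) i j ⟩
    (A *ₘ A′) i j                ≈⟨ e i j ⟩
    1ₘ i j                       ∎

module _ {R : CommutativeRing a a} {S : CommutativeRing b b} (h : Hom R S) where
  private
    module R = CommutativeRing R
    module S = CommutativeRing S
    module h = Hom h
    module MR = MatrixOps R.rawRing
    module MS = MatrixOps S.rawRing

  hom-sum : ∀ {n} (t : Fin n → R.Carrier) →
            ⟦ h ⟧ (RawMonoidOps.sum R.+-rawMonoid t) S.≈ RawMonoidOps.sum S.+-rawMonoid (⟦ h ⟧ ∘ t)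
  hom-sum {zero}  t = h.0#-homo
  hom-sum {suc n} t = S.trans (h.+-homo _ _) (S.+-congˡ (hom-sum (t ∘ suc)))

  hom-*ₘ : ∀ {N} (A B : MR.Matrix N) i j →
           ⟦ h ⟧ ((A MR.*ₘ B) i j) S.≈ ((λ k l → ⟦ h ⟧ (A k l)) MS.*ₘ (λ k l → ⟦ h ⟧ (B k l))) i j
  hom-*ₘ A B i j = S.trans (hom-sum (λ k → A i k R.* B k j))
    (SemiringSum.sum-cong-≋ S.semiring (λ k → h.*-homo (A i k) (B k j)))

  hom-1ₘ : ∀ {N} (i j : Fin N) → ⟦ h ⟧ (MR.1ₘ i j) S.≈ MS.1ₘ i j
  hom-1ₘ i j with does (i ≟ j)
  ... | true  = h.1#-homo
  ... | false = h.0#-homo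

-- A representable group-valued functor S ↦ G(S) = Hom_R(O, S) on R-algebras.
record AffineGroupScheme (R : CommutativeRing ℓ ℓ) : Set (lsuc ℓ) where
  infixl 7 _∙_
  infix 8 _⁻¹
  field
    O         : Algebra R ℓ
    _∙_       : {S : Algebra R ℓ} → AlgHom O S → AlgHom O S → AlgHom O S
    ε         : {S : Algebra R ℓ} → AlgHom O S
    _⁻¹       : {S : Algebra R ℓ} → AlgHom O S → AlgHom O S
    isGroup   : (S : Algebra R ℓ) → IsGroup (_≈ₐ_ {A = O} {B = S}) _∙_ ε _⁻¹
    ∙-natural : {S T : Algebra R ℓ} (h : AlgHom S T) (g g′ : AlgHom O S) →
                (h ∘ₐ (g ∙ g′)) ≈ₐ ((h ∘ₐ g) ∙ (h ∘ₐ g′))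

  Point : Algebra R ℓ → Set ℓ
  Point S = AlgHom O S

  coordinateRing : CommutativeRing ℓ ℓ
  coordinateRing = ring O

open AffineGroupScheme using (O; Point; coordinateRing)

record GroupSchemeHom {R : CommutativeRing ℓ ℓ} (G H : AffineGroupScheme R) : Set (lsuc ℓ) where
  private
    module G = AffineGroupScheme G
    module H = AffineGroupScheme H
  field
    comorphism : AlgHom H.O G.O

  onPoints : {S : Algebra R ℓ} → Point G S → Point H S
  onPoints g = g ∘ₐ comorphism

  field
    homomorphic : {S : Algebra R ℓ} (g g′ : Point G S) →
                  onPoints (g G.∙ g′) ≈ₐ (onPoints g H.∙ onPoints g′)

record ClosedEmbedding {R : CommutativeRing ℓ ℓ} (G H : AffineGroupScheme R) : Set (lsuc ℓ) where
  field
    groupSchemeHom : GroupSchemeHom G H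
  open GroupSchemeHom groupSchemeHom public
  private
    module O-G = Algebra (O G)
    module O-H = Algebra (O H)
  field
    surjective : ∀ (r : O-G.Carrier) → Σ[ s ∈ O-H.Carrier ] (comorphism $ₐ s) O-G.≈ r

-- GL_N is represented by R[xᵢⱼ, yᵢⱼ] / (X Y = 1, Y X = 1), whose S-points are
-- the invertible N × N matrices over S together with their inverses.
data Entry (N : ℕ) : Set where
  mat inv : Fin N → Fin N → Entry N

module GeneralLinear (R : CommutativeRing ℓ ℓ) (N : ℕ) where
  private
    module R = CommutativeRing R
    T = Term R.Carrier (Entry N)

    termRawRing : RawRing ℓ ℓ
    termRawRing = record
      { Carrier = T ; _≈_ = _≡_ ; _+_ = _⊞_ ; _*_ = _⊠_ ; -_ = ⊟_
      ; 0# = const R.0# ; 1# = const R.1# }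

    open MatrixOps termRawRing using (Matrix; _*ₘ_; 1ₘ)

    X Y : Matrix N
    X i j = var (mat i j)
    Y i j = var (inv i j)

  data InverseRel : T → T → Set ℓ where
    XY≈1 : ∀ i j → InverseRel ((X *ₘ Y) i j) (1ₘ i j)
    YX≈1 : ∀ i j → InverseRel ((Y *ₘ X) i j) (1ₘ i j)

  private
    module P = Presentation R (Entry N) InverseRel

  OGL : Algebra R ℓ
  OGL = P.presented

  module _ {S : Algebra R ℓ} where
    private
      module S = Algebra S
      module M = MatrixOps S.rawRing
      open MatrixProperties S.ring

    matrix inverseMatrix : AlgHom OGL S → M.Matrix N
    matrix        g i j = g $ₐ var (mat i j)
    inverseMatrix g i j = g $ₐ var (inv i j)

    module _ (A B : M.Matrix N) (AB : A M.*ₘ B M.≈ₘ M.1ₘ) (BA : B M.*ₘ A M.≈ₘ M.1ₘ) where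
      private
        entries : Entry N → S.Carrier
        entries (mat i j) = A i j
        entries (inv i j) = B i j

        ev = P.eval S.ring (ι S) entries

        free : Hom (ring (presented R (Entry N) (λ _ _ → Lift ℓ ⊥))) S.ring
        free = Presentation.evalHom R (Entry N) (λ _ _ → Lift ℓ ⊥) S.ring (ι S) entries (λ ())

        ev-free : ∀ t → ev t S.≈ ⟦ free ⟧ t
        ev-free (const k) = S.refl
        ev-free (var i)   = S.refl
        ev-free (s ⊞ t)   = S.+-cong (ev-free s) (ev-free t)
        ev-free (s ⊠ t)   = S.*-cong (ev-free s) (ev-free t)
        ev-free (⊟ t)     = S.-‿cong (ev-free t)

        respects : ∀ {s t} → InverseRel s t → ev s S.≈ ev t
        respects (XY≈1 i j) = S.trans (ev-free ((X *ₘ Y) i j)) (S.trans (hom-*ₘ free X Y i j)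
          (S.trans (AB i j) (S.sym (S.trans (ev-free (1ₘ i j)) (hom-1ₘ free i j)))))
        respects (YX≈1 i j) = S.trans (ev-free ((Y *ₘ X) i j)) (S.trans (hom-*ₘ free Y X i j)
          (S.trans (BA i j) (S.sym (S.trans (ev-free (1ₘ i j)) (hom-1ₘ free i j)))))

      fromMatrices : AlgHom OGL S
      fromMatrices = record
        { hom   = P.evalHom S.ring (ι S) entries respects
        ; ι-hom = λ _ → S.refl
        }

    module _ (g : AlgHom OGL S) where
      private
        module g = AlgHomOver g

      matrix-inverseʳ : matrix g M.*ₘ inverseMatrix g M.≈ₘ M.1ₘ
      matrix-inverseʳ i j = S.trans (S.sym (hom-*ₘ g.hom X Y i j))
        (S.trans (g.⟦⟧-cong (P.rel (XY≈1 i j))) (hom-1ₘ g.hom i j))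

      matrix-inverseˡ : inverseMatrix g M.*ₘ matrix g M.≈ₘ M.1ₘ
      matrix-inverseˡ i j = S.trans (S.sym (hom-*ₘ g.hom Y X i j))
        (S.trans (g.⟦⟧-cong (P.rel (YX≈1 i j))) (hom-1ₘ g.hom i j))

    point-ext : (g h : AlgHom OGL S) → matrix g M.≈ₘ matrix h →
                inverseMatrix g M.≈ₘ inverseMatrix h → g ≈ₐ h
    point-ext g h e f = go
      where
      module g = AlgHomOver g
      module h = AlgHomOver h
      go : g ≈ₐ h
      go (const k)       = S.trans (g.ι-hom k) (S.sym (h.ι-hom k))
      go (var (mat i j)) = e i j
      go (var (inv i j)) = f i j
      go (s ⊞ t) = S.trans (g.+-homo s t) (S.trans (S.+-cong (go s) (go t)) (S.sym (h.+-homo s t)))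
      go (s ⊠ t) = S.trans (g.*-homo s t) (S.trans (S.*-cong (go s) (go t)) (S.sym (h.*-homo s t)))
      go (⊟ t)   = S.trans (g.-‿homo t) (S.trans (S.-‿cong (go t)) (S.sym (h.-‿homo t)))

    infixl 7 _∙_
    _∙_ : AlgHom OGL S → AlgHom OGL S → AlgHom OGL S
    g ∙ h = fromMatrices (matrix g M.*ₘ matrix h) (inverseMatrix h M.*ₘ inverseMatrix g)
      (*ₘ-inverse (matrix-inverseʳ g) (matrix-inverseʳ h))
      (*ₘ-inverse (matrix-inverseˡ h) (matrix-inverseˡ g))

    ε : AlgHom OGL S
    ε = fromMatrices M.1ₘ M.1ₘ (*ₘ-identityˡ M.1ₘ) (*ₘ-identityˡ M.1ₘ)

    infix 8 _⁻¹
    _⁻¹ : AlgHom OGL S → AlgHom OGL S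
    g ⁻¹ = fromMatrices (inverseMatrix g) (matrix g) (matrix-inverseˡ g) (matrix-inverseʳ g)

    GL-isGroup : IsGroup (_≈ₐ_ {A = OGL} {B = S}) _∙_ ε _⁻¹
    GL-isGroup = record
      { isMonoid = record
        { isSemigroup = record
          { isMagma = record
            { isEquivalence = record
              { refl = λ _ → S.refl ; sym = λ e r → S.sym (e r) ; trans = λ e f r → S.trans (e r) (f r) }
            ; ∙-cong = λ {g} {g′} {h} {h′} e f → point-ext (g ∙ h) (g′ ∙ h′)
                (*ₘ-cong (λ i j → e (var (mat i j))) (λ i j → f (var (mat i j))))
                (*ₘ-cong (λ i j → f (var (inv i j))) (λ i j → e (var (inv i j))))
            }
          ; assoc = λ g h k → point-ext ((g ∙ h) ∙ k) (g ∙ (h ∙ k))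
              (*ₘ-assoc (matrix g) (matrix h) (matrix k))
              (λ i j → S.sym (*ₘ-assoc (inverseMatrix k) (inverseMatrix h) (inverseMatrix g) i j))
          }
        ; identity =
            (λ g → point-ext (ε ∙ g) g (*ₘ-identityˡ (matrix g)) (*ₘ-identityʳ (inverseMatrix g))) ,
            (λ g → point-ext (g ∙ ε) g (*ₘ-identityʳ (matrix g)) (*ₘ-identityˡ (inverseMatrix g)))
        }
      ; inverse =
          (λ g → point-ext (g ⁻¹ ∙ g) ε (matrix-inverseˡ g) (matrix-inverseˡ g)) ,
          (λ g → point-ext (g ∙ g ⁻¹) ε (matrix-inverseʳ g) (matrix-inverseʳ g))
      ; ⁻¹-cong = λ {g} {h} e → point-ext (g ⁻¹) (h ⁻¹)
          (λ i j → e (var (inv i j))) (λ i j → e (var (mat i j)))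
      }

  GL : AffineGroupScheme R
  GL = record
    { O = OGL ; _∙_ = _∙_ ; ε = ε ; _⁻¹ = _⁻¹ ; isGroup = λ S → GL-isGroup {S = S}
    ; ∙-natural = λ h g g′ → point-ext (h ∘ₐ (g ∙ g′)) ((h ∘ₐ g) ∙ (h ∘ₐ g′))
        (hom-*ₘ (hom h) (matrix g) (matrix g′))
        (hom-*ₘ (hom h) (inverseMatrix g′) (inverseMatrix g))
    }

open GeneralLinear using (GL; matrix)

module _ {R : CommutativeRing ℓ ℓ} (G : AffineGroupScheme R) where
  open MatrixOps (rawRing R)

  module _ {N : ℕ} (e : ClosedEmbedding G (GL R N)) where

    pointMatrix : Point G (self R) → Matrix N
    pointMatrix u = matrix R N (ClosedEmbedding.onPoints e u)

  Annihilates : ℕ → Point G (self R) → Set (lsuc ℓ)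
  Annihilates n u = Σ[ N ∈ ℕ ] Σ[ e ∈ ClosedEmbedding G (GL R N) ]
                    IsZeroₘ ((pointMatrix e u -ₘ 1ₘ) ^ₘ n)

  IsUnipotent : Point G (self R) → Set (lsuc ℓ)
  IsUnipotent u = Σ[ N ∈ ℕ ] Σ[ e ∈ ClosedEmbedding G (GL R N) ]
                  Σ[ n ∈ ℕ ] IsZeroₘ ((pointMatrix e u -ₘ 1ₘ) ^ₘ n)

  record IsIndexOf (u : Point G (self R)) (n : ℕ) : Set (lsuc ℓ) where
    field
      positive    : 1 ≤ n
      annihilates : Annihilates n u
      minimal     : ∀ m → 1 ≤ m → Annihilates m u → n ≤ m

module _ (R : CommutativeRing a a) where
  open CommutativeRing R hiding (rawRing; ring) renaming (Carrier to Elt)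
  open RawSemiringOps (RawRing.rawSemiring (rawRing R)) using () renaming (_×_ to _·_)

  nat : ℕ → Elt
  nat m = m · 1#

  IsUnit : Elt → Set a
  IsUnit r = Σ[ s ∈ Elt ] r * s ≈ 1#

  module _ (q : Elt) where
    private
      infix 4 _≡q_
      _≡q_ : Elt → Elt → Set a
      r ≡q s = Σ[ t ∈ Elt ] r ≈ s + q * t

      open SetoidReasoning setoid
      open CommutativeSemigroupProperties +-commutativeSemigroup using (interchange)

      ≈⇒≡q : ∀ {r s} → r ≈ s → r ≡q s
      ≈⇒≡q e = 0# , trans e (sym (trans (+-congˡ (zeroʳ q)) (+-identityʳ _)))

      ≡q-sym : ∀ {r s} → r ≡q s → s ≡q r
      ≡q-sym {r} {s} (t , e) = - t , sym (begin
        r + q * - t             ≈⟨ +-congʳ e ⟩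
        s + q * t + q * - t     ≈⟨ +-assoc _ _ _ ⟩
        s + (q * t + q * - t)   ≈⟨ +-congˡ (sym (distribˡ q t (- t))) ⟩
        s + q * (t - t)         ≈⟨ +-congˡ (*-congˡ (-‿inverseʳ t)) ⟩
        s + q * 0#              ≈⟨ +-congˡ (zeroʳ q) ⟩
        s + 0#                  ≈⟨ +-identityʳ s ⟩
        s                       ∎)

      ≡q-trans : ∀ {r s t} → r ≡q s → s ≡q t → r ≡q t
      ≡q-trans {r} {s} {t} (u , e) (v , f) = v + u , (begin
        r                     ≈⟨ e ⟩
        s + q * u             ≈⟨ +-congʳ f ⟩
        t + q * v + q * u     ≈⟨ +-assoc _ _ _ ⟩
        t + (q * v + q * u)   ≈⟨ +-congˡ (sym (distribˡ q v u)) ⟩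
        t + q * (v + u)       ∎)

      ≡q-+ : ∀ {r r′ s s′} → r ≡q r′ → s ≡q s′ → r + s ≡q r′ + s′
      ≡q-+ {r} {r′} {s} {s′} (u , e) (v , f) = u + v , (begin
        r + s                       ≈⟨ +-cong e f ⟩
        r′ + q * u + (s′ + q * v)   ≈⟨ interchange _ _ _ _ ⟩
        r′ + s′ + (q * u + q * v)   ≈⟨ +-congˡ (sym (distribˡ q u v)) ⟩
        r′ + s′ + q * (u + v)       ∎)

      ≡q-neg : ∀ {r s} → r ≡q s → - r ≡q - s
      ≡q-neg {r} {s} (t , e) = - t , (begin
        - r               ≈⟨ -‿cong e ⟩
        - (s + q * t)     ≈⟨ sym (RingProperties.-‿+-comm (CommutativeRing.ring R) s (q * t)) ⟩
        - s + - (q * t)   ≈⟨ +-congˡ (RingProperties.-‿distribʳ-* (CommutativeRing.ring R) q t) ⟩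
        - s + q * - t     ∎)

      ≡q-*ʳ : ∀ {r r′} s → r ≡q r′ → r * s ≡q r′ * s
      ≡q-*ʳ {r} {r′} s (u , e) = u * s , (begin
        r * s               ≈⟨ *-congʳ e ⟩
        (r′ + q * u) * s    ≈⟨ distribʳ s r′ (q * u) ⟩
        r′ * s + q * u * s  ≈⟨ +-congˡ (*-assoc q u s) ⟩
        r′ * s + q * (u * s) ∎)

      ≡q-* : ∀ {r r′ s s′} → r ≡q r′ → s ≡q s′ → r * s ≡q r′ * s′
      ≡q-* {r} {r′} {s} {s′} e f = ≡q-trans (≡q-*ʳ s e)
        (≡q-trans (≈⇒≡q (*-comm r′ s)) (≡q-trans (≡q-*ʳ r′ f) (≈⇒≡q (*-comm s′ r′))))

    quotient : CommutativeRing a a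
    quotient .CommutativeRing.Carrier = Elt
    quotient .CommutativeRing._≈_     = _≡q_
    quotient .CommutativeRing._+_     = _+_
    quotient .CommutativeRing._*_     = _*_
    quotient .CommutativeRing.-_      = -_
    quotient .CommutativeRing.0#      = 0#
    quotient .CommutativeRing.1#      = 1#
    quotient .CommutativeRing.isCommutativeRing = record
        { isRing = record
          { +-isAbelianGroup = record
            { isGroup = record
              { isMonoid = record
                { isSemigroup = record
                  { isMagma = record
                    { isEquivalence = record
                      { refl = ≈⇒≡q refl ; sym = ≡q-sym ; trans = ≡q-trans }
                    ; ∙-cong = ≡q-+
                    }
                  ; assoc = λ r s t → ≈⇒≡q (+-assoc r s t)
                  }
                ; identity = (λ r → ≈⇒≡q (+-identityˡ r)) , (λ r → ≈⇒≡q (+-identityʳ r))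
                }
              ; inverse = (λ r → ≈⇒≡q (-‿inverseˡ r)) , (λ r → ≈⇒≡q (-‿inverseʳ r))
              ; ⁻¹-cong = ≡q-neg
              }
            ; comm = λ r s → ≈⇒≡q (+-comm r s)
            }
          ; *-cong = ≡q-*
          ; *-assoc = λ r s t → ≈⇒≡q (*-assoc r s t)
          ; *-identity = (λ r → ≈⇒≡q (*-identityˡ r)) , (λ r → ≈⇒≡q (*-identityʳ r))
          ; distrib = (λ r s t → ≈⇒≡q (distribˡ r s t)) , (λ r s t → ≈⇒≡q (distribʳ r s t))
          }
        ; *-comm = λ r s → ≈⇒≡q (*-comm r s)
        }

    toQuotient : Hom R quotient
    toQuotient = mkHom R quotient id ≈⇒≡q
      (λ _ _ → ≈⇒≡q refl) (λ _ _ → ≈⇒≡q refl) (≈⇒≡q refl)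

infixl 9 _/[_]
_/[_] : CommutativeRing a a → ℕ → CommutativeRing a a
R /[ m ] = quotient R (nat R m)

module _ {R : CommutativeRing a a} {S : CommutativeRing b b} (h : Hom R S) where
  private
    module R = CommutativeRing R
    module S = CommutativeRing S
    module h = Hom h

  hom-nat : ∀ m → ⟦ h ⟧ (nat R m) S.≈ nat S m
  hom-nat zero    = h.0#-homo
  hom-nat (suc m) = S.trans (h.+-homo _ _) (S.+-cong h.1#-homo (hom-nat m))

  factor : ∀ m → nat S m S.≈ S.0# → Hom (R /[ m ]) S
  factor m m≈0 = mkHom (R /[ m ]) S ⟦ h ⟧ h-cong h.+-homo h.*-homo h.1#-homo
    where
    open SetoidReasoning S.setoid
    h-cong : ∀ {r s} → Σ[ t ∈ R.Carrier ] r R.≈ s R.+ nat R m R.* t → ⟦ h ⟧ r S.≈ ⟦ h ⟧ s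
    h-cong {r} {s} (t , e) = begin
      ⟦ h ⟧ r                                ≈⟨ h.⟦⟧-cong e ⟩
      ⟦ h ⟧ (s R.+ nat R m R.* t)            ≈⟨ h.+-homo _ _ ⟩
      ⟦ h ⟧ s S.+ ⟦ h ⟧ (nat R m R.* t)      ≈⟨ S.+-congˡ (h.*-homo _ _) ⟩
      ⟦ h ⟧ s S.+ ⟦ h ⟧ (nat R m) S.* ⟦ h ⟧ t ≈⟨ S.+-congˡ (S.*-congʳ (hom-nat m)) ⟩
      ⟦ h ⟧ s S.+ nat S m S.* ⟦ h ⟧ t        ≈⟨ S.+-congˡ (S.*-congʳ m≈0) ⟩
      ⟦ h ⟧ s S.+ S.0# S.* ⟦ h ⟧ t           ≈⟨ S.+-congˡ (S.zeroˡ _) ⟩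
      ⟦ h ⟧ s S.+ S.0#                       ≈⟨ S.+-identityʳ _ ⟩
      ⟦ h ⟧ s                                ∎

module _ (R : CommutativeRing a a) where
  private
    module R = CommutativeRing R

  reduceMod : ∀ m → Hom R (R /[ m ])
  reduceMod m = toQuotient R (nat R m)

  nat-vanishes : ∀ m → CommutativeRing._≈_ (R /[ m ]) (nat (R /[ m ]) m) R.0#
  nat-vanishes m = Q.trans (Q.sym (hom-nat (reduceMod m) m))
    (R.1# , R.sym (R.trans (R.+-identityˡ _) (R.*-identityʳ _)))
    where module Q = CommutativeRing (R /[ m ])

  nat-vanishes-* : ∀ k m → CommutativeRing._≈_ (R /[ m ]) (nat (R /[ m ]) (k ℕ.* m)) R.0#
  nat-vanishes-* k m = Q.trans (SemiringMult.×1-homo-* Q.semiring k m)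
    (Q.trans (Q.*-congˡ (nat-vanishes m)) (Q.zeroʳ _))
    where module Q = CommutativeRing (R /[ m ])

module Completion (p : ℕ) (R : CommutativeRing a a) where
  private
    module R = CommutativeRing R
    module Q (n : ℕ) = CommutativeRing (R /[ p ℕ.^ n ])

  infix 4 _≈[_]_
  _≈[_]_ : R.Carrier → ℕ → R.Carrier → Set a
  r ≈[ n ] s = Q._≈_ n r s

  -- An element of lim R/pⁿR, by representatives.
  record Adic : Set a where
    constructor adic
    field
      at       : ℕ → R.Carrier
      coherent : ∀ n → at (suc n) ≈[ n ] at n
  open Adic public

  completion : CommutativeRing a a
  completion .CommutativeRing.Carrier = Adic
  completion .CommutativeRing._≈_ r s = ∀ n → at r n ≈[ n ] at s n
  completion .CommutativeRing._+_ r s =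
    adic (λ n → at r n R.+ at s n) (λ n → Q.+-cong n (coherent r n) (coherent s n))
  completion .CommutativeRing._*_ r s =
    adic (λ n → at r n R.* at s n) (λ n → Q.*-cong n (coherent r n) (coherent s n))
  completion .CommutativeRing.-_ r =
    adic (λ n → R.- at r n) (λ n → Q.-‿cong n (coherent r n))
  completion .CommutativeRing.0# = adic (λ _ → R.0#) (λ n → Q.refl n)
  completion .CommutativeRing.1# = adic (λ _ → R.1#) (λ n → Q.refl n)
  completion .CommutativeRing.isCommutativeRing = record
      { isRing = record
        { +-isAbelianGroup = record
          { isGroup = record
            { isMonoid = record
              { isSemigroup = record
                { isMagma = record
                  { isEquivalence = record
                    { refl = λ n → Q.refl n
                    ; sym = λ e n → Q.sym n (e n)
                    ; trans = λ e f n → Q.trans n (e n) (f n)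
                    }
                  ; ∙-cong = λ e f n → Q.+-cong n (e n) (f n)
                  }
                ; assoc = λ r s t n → Q.+-assoc n _ _ _
                }
              ; identity = (λ r n → Q.+-identityˡ n _) , (λ r n → Q.+-identityʳ n _)
              }
            ; inverse = (λ r n → Q.-‿inverseˡ n _) , (λ r n → Q.-‿inverseʳ n _)
            ; ⁻¹-cong = λ e n → Q.-‿cong n (e n)
            }
          ; comm = λ r s n → Q.+-comm n _ _
          }
        ; *-cong = λ e f n → Q.*-cong n (e n) (f n)
        ; *-assoc = λ r s t n → Q.*-assoc n _ _ _
        ; *-identity = (λ r n → Q.*-identityˡ n _) , (λ r n → Q.*-identityʳ n _)
        ; distrib = (λ r s t n → Q.distribˡ n _ _ _) , (λ r s t n → Q.distribʳ n _ _ _)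
        }
      ; *-comm = λ r s n → Q.*-comm n _ _
      }

  toCompletion : Hom R completion
  toCompletion = mkHom R completion (λ r → adic (λ _ → r) (λ n → Q.refl n))
    (λ e n → Hom.⟦⟧-cong (reduceMod R (p ℕ.^ n)) e)
    (λ _ _ n → Q.refl n) (λ _ _ n → Q.refl n) (λ n → Q.refl n)

  project : ∀ n → Hom completion (R /[ p ℕ.^ n ])
  project n = mkHom completion (R /[ p ℕ.^ n ]) (λ r → at r n) (λ e → e n)
    (λ _ _ → Q.refl n) (λ _ _ → Q.refl n) (Q.refl n)

open Completion using (Adic; at; completion; toCompletion; project)

module _ {R : CommutativeRing a a} {S : CommutativeRing b b} where

  mapMod : Hom R S → ∀ m → Hom (R /[ m ]) (S /[ m ])
  mapMod h m = factor (reduceMod S m ∘ₕ h) m (nat-vanishes S m)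

  mapCompletion : (p : ℕ) → Hom R S → Hom (completion p R) (completion p S)
  mapCompletion p h = mkHom (completion p R) (completion p S)
    (λ r → Completion.adic (λ n → ⟦ h ⟧ (at r n))
                           (λ n → Hom.⟦⟧-cong (mapMod h (p ℕ.^ n)) (Completion.coherent r n)))
    (λ e n → Hom.⟦⟧-cong (mapMod h (p ℕ.^ n)) (e n))
    (λ _ _ n → Hom.+-homo (mapMod h (p ℕ.^ n)) _ _)
    (λ _ _ n → Hom.*-homo (mapMod h (p ℕ.^ n)) _ _)
    (λ n → Hom.1#-homo (mapMod h (p ℕ.^ n)))

lowerMod : (p : ℕ) (R : CommutativeRing a a) → ∀ n → Hom (R /[ p ℕ.^ suc n ]) (R /[ p ℕ.^ n ])
lowerMod p R n = factor (reduceMod R (p ℕ.^ n)) (p ℕ.^ suc n) (nat-vanishes-* R p (p ℕ.^ n))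

IsComplete : ℕ → CommutativeRing a a → Set a
IsComplete p R = IsRingIsomorphism (rawRing R) (rawRing (completion p R)) ⟦ toCompletion p R ⟧

module _ {K : CommutativeRing ℓ ℓ} (B : Algebra K ℓ) where

  infixl 9 _mod_
  _mod_ : (m : ℕ) → Algebra (K /[ m ]) ℓ
  _mod_ m .ring = ring B /[ m ]
  _mod_ m .ι    = mapMod (ι B) m

  completed : ℕ → Algebra K ℓ
  completed p .ring = completion p (ring B)
  completed p .ι    = toCompletion p (ring B) ∘ₕ ι B

module _ (R : CommutativeRing ℓ ℓ) where
  private
    module R = CommutativeRing R

  mkModule : {M : Set a} {_≈_ : M → M → Set b} {_+_ : M → M → M} {0# : M} { -_ : M → M } →
             (_*_ : R.Carrier → M → M) →
             IsAbelianGroup _≈_ _+_ 0# -_ →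
             (∀ {r s m n} → r R.≈ s → m ≈ n → (r * m) ≈ (s * n)) →
             (∀ r m n → (r * (m + n)) ≈ ((r * m) + (r * n))) →
             (∀ m r s → ((r R.+ s) * m) ≈ ((r * m) + (s * m))) →
             (∀ r s m → ((r R.* s) * m) ≈ (r * (s * m))) →
             (∀ m → (R.1# * m) ≈ m) →
             Module R a b
  mkModule {M = M} {_≈_} {_+_} {0#} { -_ } _*_ isAb *-cong distribˡ distribʳ *-assoc *-identity = record
    { isModule = IsModuleFromLeft.isModule {commutativeRing = R} (record
      { isLeftModule = record
        { isLeftSemimodule = record
          { +ᴹ-isCommutativeMonoid = Ab.isCommutativeMonoid
          ; isPreleftSemimodule = record
            { *ₗ-cong = *-cong
            ; *ₗ-zeroˡ = λ m → identityˡ-unique _ (R.0# * m)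
                (Ab.trans (Ab.sym (distribʳ m R.0# R.0#)) (*-cong (R.+-identityˡ R.0#) Ab.refl))
            ; *ₗ-distribʳ = distribʳ
            ; *ₗ-identityˡ = *-identity
            ; *ₗ-assoc = *-assoc
            ; *ₗ-zeroʳ = λ r → identityˡ-unique _ (r * 0#)
                (Ab.trans (Ab.sym (distribˡ r 0# 0#)) (*-cong R.refl (Ab.identityˡ 0#)))
            ; *ₗ-distribˡ = distribˡ
            }
          }
        ; -ᴹ‿cong = Ab.⁻¹-cong
        ; -ᴹ‿inverse = Ab.inverse
        }
      })
    }
    where
    module Ab = IsAbelianGroup isAb
    abelianGroup : AbelianGroup _ _
    abelianGroup = record { isAbelianGroup = isAb }
    open AbelianGroupProperties abelianGroup using (identityˡ-unique)

  -- The submodule of a product of modules cut out by a predicate.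
  module _ {i : Level} (I : Set i) (M : I → Module R ℓ ℓ)
           (P : (∀ j → Module.Carrierᴹ (M j)) → Set (i ⊔ ℓ)) where
    private
      module M (j : I) = Module (M j)

    submoduleOfProduct :
      (∀ {m n} → P m → P n → P (λ j → M._+ᴹ_ j (m j) (n j))) →
      P (λ j → M.0ᴹ j) →
      (∀ {m} → P m → P (λ j → M.-ᴹ_ j (m j))) →
      (∀ r {m} → P m → P (λ j → M._*ₗ_ j r (m j))) →
      Module R (i ⊔ ℓ) (i ⊔ ℓ)
    submoduleOfProduct P-+ P-0 P-neg P-* = mkModule
      {M = Σ (∀ j → M.Carrierᴹ j) P}
      {_≈_ = λ m n → ∀ j → M._≈ᴹ_ j (proj₁ m j) (proj₁ n j)}
      {_+_ = λ m n → _ , P-+ (proj₂ m) (proj₂ n)}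
      {0# = _ , P-0}
      { -_ = λ m → _ , P-neg (proj₂ m) }
      (λ r m → _ , P-* r (proj₂ m))
      (record
        { isGroup = record
          { isMonoid = record
            { isSemigroup = record
              { isMagma = record
                { isEquivalence = record
                  { refl = λ j → M.≈ᴹ-refl j
                  ; sym = λ e j → M.≈ᴹ-sym j (e j)
                  ; trans = λ e f j → M.≈ᴹ-trans j (e j) (f j)
                  }
                ; ∙-cong = λ e f j → M.+ᴹ-cong j (e j) (f j)
                }
              ; assoc = λ l m n j → M.+ᴹ-assoc j _ _ _
              }
            ; identity = (λ m j → M.+ᴹ-identityˡ j _) , (λ m j → M.+ᴹ-identityʳ j _)
            }
          ; inverse = (λ m j → M.-ᴹ‿inverseˡ j _) , (λ m j → M.-ᴹ‿inverseʳ j _)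
          ; ⁻¹-cong = λ e j → M.-ᴹ‿cong j (e j)
          }
        ; comm = λ m n j → M.+ᴹ-comm j _ _
        })
      (λ e f j → M.*ₗ-cong j e (f j))
      (λ r m n j → M.*ₗ-distribˡ j r _ _)
      (λ m r s j → M.*ₗ-distribʳ j _ r s)
      (λ r s m j → M.*ₗ-assoc j r s _)
      (λ m j → M.*ₗ-identityˡ j _)

  module _ {S : CommutativeRing ℓ ℓ} (h : Hom R S) (M : Module S ℓ ℓ) where
    private
      module h = Hom h
      module M = Module M

    restrictModule : Module R ℓ ℓ
    restrictModule = mkModule (λ r m → ⟦ h ⟧ r M.*ₗ m) M.+ᴹ-isAbelianGroup
      (λ e f → M.*ₗ-cong (h.⟦⟧-cong e) f)
      (λ r m n → M.*ₗ-distribˡ _ m n)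
      (λ m r s → M.≈ᴹ-trans (M.*ₗ-cong (h.+-homo r s) M.≈ᴹ-refl) (M.*ₗ-distribʳ m _ _))
      (λ r s m → M.≈ᴹ-trans (M.*ₗ-cong (h.*-homo r s) M.≈ᴹ-refl) (M.*ₗ-assoc _ _ m))
      (λ m → M.≈ᴹ-trans (M.*ₗ-cong h.1#-homo M.≈ᴹ-refl) (M.*ₗ-identityˡ m))

module ModuleOps {R : CommutativeRing ℓ ℓ} (M : Module R a b) where
  open Module M

  combination : ∀ {D} → (Fin D → Carrier R) → (Fin D → Carrierᴹ) → Carrierᴹ
  combination r m = RawMonoidOps.sum +ᴹ-rawMonoid (λ i → r i *ₗ m i)

  CongruentMod : ℕ → Carrierᴹ → Carrierᴹ → Set (a ⊔ b)
  CongruentMod p m n = Σ[ l ∈ Carrierᴹ ] m ≈ᴹ n +ᴹ nat R p *ₗ l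

data Form (C : Set c) : Set c where
  d   : C → Form C
  _⊕_ : Form C → Form C → Form C
  0ᶠ  : Form C
  ⊝_  : Form C → Form C
  _⊙_ : C → Form C → Form C

mapForm : {C : Set a} {D : Set b} → (C → D) → Form C → Form D
mapForm f (d r)   = d (f r)
mapForm f (ω ⊕ η) = mapForm f ω ⊕ mapForm f η
mapForm f 0ᶠ      = 0ᶠ
mapForm f (⊝ ω)   = ⊝ mapForm f ω
mapForm f (r ⊙ ω) = f r ⊙ mapForm f ω

module _ {K : CommutativeRing ℓ ℓ} (A : Algebra K ℓ) where
  private
    module A = Algebra A

  data FormEq : Form A.Carrier → Form A.Carrier → Set ℓ where
    Ω-refl      : ∀ {ω} → FormEq ω ω
    Ω-sym       : ∀ {ω η} → FormEq ω η → FormEq η ω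
    Ω-trans     : ∀ {ω η θ} → FormEq ω η → FormEq η θ → FormEq ω θ
    ⊕-cong      : ∀ {ω ω′ η η′} → FormEq ω ω′ → FormEq η η′ → FormEq (ω ⊕ η) (ω′ ⊕ η′)
    ⊝-cong      : ∀ {ω η} → FormEq ω η → FormEq (⊝ ω) (⊝ η)
    ⊙-cong      : ∀ {r s ω η} → r A.≈ s → FormEq ω η → FormEq (r ⊙ ω) (s ⊙ η)
    ⊕-assoc     : ∀ ω η θ → FormEq ((ω ⊕ η) ⊕ θ) (ω ⊕ (η ⊕ θ))
    ⊕-comm      : ∀ ω η → FormEq (ω ⊕ η) (η ⊕ ω)
    ⊕-identityˡ : ∀ ω → FormEq (0ᶠ ⊕ ω) ω
    ⊕-inverseˡ  : ∀ ω → FormEq ((⊝ ω) ⊕ ω) 0ᶠ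
    ⊙-distribˡ  : ∀ r ω η → FormEq (r ⊙ (ω ⊕ η)) ((r ⊙ ω) ⊕ (r ⊙ η))
    ⊙-distribʳ  : ∀ ω r s → FormEq ((r A.+ s) ⊙ ω) ((r ⊙ ω) ⊕ (s ⊙ ω))
    ⊙-assoc     : ∀ r s ω → FormEq ((r A.* s) ⊙ ω) (r ⊙ (s ⊙ ω))
    ⊙-identity  : ∀ ω → FormEq (A.1# ⊙ ω) ω
    d-cong      : ∀ {r s} → r A.≈ s → FormEq (d r) (d s)
    d-+         : ∀ r s → FormEq (d (r A.+ s)) (d r ⊕ d s)
    d-*         : ∀ r s → FormEq (d (r A.* s)) ((r ⊙ d s) ⊕ (s ⊙ d r))
    d-ι         : ∀ k → FormEq (d (⟦ ι A ⟧ k)) 0ᶠ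

  Ω : Module A.ring ℓ ℓ
  Ω = mkModule A.ring {_≈_ = FormEq} {_+_ = _⊕_} {0# = 0ᶠ} { -_ = ⊝_ } _⊙_
    (record
      { isGroup = record
        { isMonoid = record
          { isSemigroup = record
            { isMagma = record
              { isEquivalence = record { refl = Ω-refl ; sym = Ω-sym ; trans = Ω-trans }
              ; ∙-cong = ⊕-cong
              }
            ; assoc = ⊕-assoc
            }
          ; identity = ⊕-identityˡ , λ ω → Ω-trans (⊕-comm _ _) (⊕-identityˡ ω)
          }
        ; inverse = ⊕-inverseˡ , λ ω → Ω-trans (⊕-comm _ _) (⊕-inverseˡ ω)
        ; ⁻¹-cong = ⊝-cong
        }
      ; comm = ⊕-comm
      })
    ⊙-cong ⊙-distribˡ ⊙-distribʳ ⊙-assoc ⊙-identity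

module _ {K K′ : CommutativeRing ℓ ℓ} {κ : Carrier K → Carrier K′}
         {A : Algebra K ℓ} {B : Algebra K′ ℓ} (h : AlgHomOver {K = K} {K′ = K′} κ A B) where
  private
    module h = AlgHomOver h

  pullback : Form (Algebra.Carrier A) → Form (Algebra.Carrier B)
  pullback = mapForm (h $ₐ_)

  pullback-cong : ∀ {ω η} → FormEq A ω η → FormEq B (pullback ω) (pullback η)
  pullback-cong Ω-refl             = Ω-refl
  pullback-cong (Ω-sym e)          = Ω-sym (pullback-cong e)
  pullback-cong (Ω-trans e f)      = Ω-trans (pullback-cong e) (pullback-cong f)
  pullback-cong (⊕-cong e f)       = ⊕-cong (pullback-cong e) (pullback-cong f)
  pullback-cong (⊝-cong e)         = ⊝-cong (pullback-cong e)
  pullback-cong (⊙-cong e f)       = ⊙-cong (h.⟦⟧-cong e) (pullback-cong f)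
  pullback-cong (⊕-assoc _ _ _)    = ⊕-assoc _ _ _
  pullback-cong (⊕-comm _ _)       = ⊕-comm _ _
  pullback-cong (⊕-identityˡ _)    = ⊕-identityˡ _
  pullback-cong (⊕-inverseˡ _)     = ⊕-inverseˡ _
  pullback-cong (⊙-distribˡ _ _ _) = ⊙-distribˡ _ _ _
  pullback-cong (⊙-distribʳ ω r s) = Ω-trans (⊙-cong (h.+-homo r s) Ω-refl) (⊙-distribʳ _ _ _)
  pullback-cong (⊙-assoc r s ω)    = Ω-trans (⊙-cong (h.*-homo r s) Ω-refl) (⊙-assoc _ _ _)
  pullback-cong (⊙-identity ω)     = Ω-trans (⊙-cong h.1#-homo Ω-refl) (⊙-identity _)
  pullback-cong (d-cong e)         = d-cong (h.⟦⟧-cong e)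
  pullback-cong (d-+ r s)          = Ω-trans (d-cong (h.+-homo r s)) (d-+ _ _)
  pullback-cong (d-* r s)          = Ω-trans (d-cong (h.*-homo r s)) (d-* _ _)
  pullback-cong (d-ι k)            = Ω-trans (d-cong (h.ι-hom k)) (d-ι _)

module _ {K : CommutativeRing ℓ ℓ} (A : Algebra K ℓ) where
  private
    module A = Algebra A

  mapForm-square : {C : Set a} {B : Set b} {B′ : Set c}
                   (f : C → B) (g : B → A.Carrier) (f′ : C → B′) (g′ : B′ → A.Carrier) →
                   (∀ r → g (f r) A.≈ g′ (f′ r)) →
                   ∀ ω → FormEq A (mapForm g (mapForm f ω)) (mapForm g′ (mapForm f′ ω))
  mapForm-square f g f′ g′ e (d r)   = d-cong (e r)
  mapForm-square f g f′ g′ e (ω ⊕ η) =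
    ⊕-cong (mapForm-square f g f′ g′ e ω) (mapForm-square f g f′ g′ e η)
  mapForm-square f g f′ g′ e 0ᶠ      = Ω-refl
  mapForm-square f g f′ g′ e (⊝ ω)   = ⊝-cong (mapForm-square f g f′ g′ e ω)
  mapForm-square f g f′ g′ e (r ⊙ ω) = ⊙-cong (e r) (mapForm-square f g f′ g′ e ω)

  mapForm-triangle : {C : Set a} {B : Set b}
                     (f : C → B) (g : B → A.Carrier) (h : C → A.Carrier) →
                     (∀ r → g (f r) A.≈ h r) →
                     ∀ ω → FormEq A (mapForm g (mapForm f ω)) (mapForm h ω)
  mapForm-triangle f g h e (d r)   = d-cong (e r)
  mapForm-triangle f g h e (ω ⊕ η) =
    ⊕-cong (mapForm-triangle f g h e ω) (mapForm-triangle f g h e η)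
  mapForm-triangle f g h e 0ᶠ      = Ω-refl
  mapForm-triangle f g h e (⊝ ω)   = ⊝-cong (mapForm-triangle f g h e ω)
  mapForm-triangle f g h e (r ⊙ ω) = ⊙-cong (e r) (mapForm-triangle f g h e ω)

module _ (p : ℕ) {K : CommutativeRing ℓ ℓ} where

  module _ (B : Algebra K ℓ) where
    private
      Bₙ : (n : ℕ) → Algebra (K /[ p ℕ.^ n ]) ℓ
      Bₙ n = B mod (p ℕ.^ n)

    lower : ∀ n → AlgHomOver {K = K /[ p ℕ.^ suc n ]} {K′ = K /[ p ℕ.^ n ]} id (Bₙ (suc n)) (Bₙ n)
    lower n = record { hom = lowerMod p (ring B) n ; ι-hom = λ _ → Algebra.refl (Bₙ n) }

    -- lim Ω over n of B/pⁿ relative to K/pⁿ.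
    Ω̂ : Module K ℓ ℓ
    Ω̂ = submoduleOfProduct K ℕ
      (λ n → restrictModule K (ι (Bₙ n) ∘ₕ reduceMod K (p ℕ.^ n)) (Ω (Bₙ n)))
      (λ ω → ∀ n → FormEq (Bₙ n) (pullback (lower n) (ω (suc n))) (ω n))
      (λ e f n → ⊕-cong (e n) (f n)) (λ n → Ω-refl) (λ e n → ⊝-cong (e n))
      (λ r e n → ⊙-cong (Algebra.refl (Bₙ n)) (e n))

  open Module using (Carrierᴹ)

  module _ {K′ : CommutativeRing ℓ ℓ} {κ : Carrier K → Carrier K′}
           {A : Algebra K ℓ} {B : Algebra K′ ℓ} where

    toMod : AlgHomOver {K = K} {K′ = K′} κ A B → ∀ m →
            AlgHomOver {K = K} {K′ = K′ /[ m ]} κ A (B mod m)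
    toMod h m = record
      { hom   = reduceMod (ring B) m ∘ₕ hom h
      ; ι-hom = λ k → Hom.⟦⟧-cong (reduceMod (ring B) m) (AlgHomOver.ι-hom h k)
      }

    modulo : AlgHomOver {K = K} {K′ = K′} κ A B → ∀ m →
             AlgHomOver {K = K /[ m ]} {K′ = K′ /[ m ]} κ (A mod m) (B mod m)
    modulo h m = record
      { hom   = mapMod (hom h) m
      ; ι-hom = λ k → Hom.⟦⟧-cong (reduceMod (ring B) m) (AlgHomOver.ι-hom h k)
      }

  -- A homomorphism between completions, read modulo pⁿ.
  atLevel : {K′ : CommutativeRing ℓ ℓ} {κ : Carrier K → Carrier K′}
            (A : Algebra K ℓ) (B : Algebra K′ ℓ) →
            AlgHomOver {K = K} {K′ = K′} κ (completed A p) (completed B p) → ∀ n →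
            AlgHomOver {K = K /[ p ℕ.^ n ]} {K′ = K′ /[ p ℕ.^ n ]} κ
                       (A mod (p ℕ.^ n)) (B mod (p ℕ.^ n))
  atLevel A B h n = record
    { hom   = factor (project p (ring B) n ∘ₕ hom h ∘ₕ toCompletion p (ring A)) (p ℕ.^ n)
                     (nat-vanishes (ring B) (p ℕ.^ n))
    ; ι-hom = λ k → AlgHomOver.ι-hom h k n
    }

  pullbackΩ̂ : {κ : Carrier K → Carrier K} (B : Algebra K ℓ) →
              AlgHomOver {K = K} {K′ = K} κ (completed B p) (completed B p) →
              Carrierᴹ (Ω̂ B) → Carrierᴹ (Ω̂ B)
  pullbackΩ̂ B h (ω , coh) =
    (λ n → pullback (atLevel B B h n) (ω n)) ,
    λ n → Ω-trans
      (mapForm-square (B mod (p ℕ.^ n)) (atLevel B B h (suc n) $ₐ_) (lower B n $ₐ_)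
        (lower B n $ₐ_) (atLevel B B h n $ₐ_)
        (λ r → Completion.coherent (h $ₐ ⟦ toCompletion p (ring B) ⟧ r) n) (ω (suc n)))
      (pullback-cong (atLevel B B h n) (coh n))

  mapΩ̂ : (A B : Algebra K ℓ) → AlgHom A B → Carrierᴹ (Ω̂ A) → Carrierᴹ (Ω̂ B)
  mapΩ̂ A B h (ω , coh) =
    (λ n → pullback (modulo h (p ℕ.^ n)) (ω n)) ,
    λ n → Ω-trans
      (mapForm-square (B mod (p ℕ.^ n)) (h $ₐ_) id id (h $ₐ_)
        (λ _ → Algebra.refl (B mod (p ℕ.^ n))) (ω (suc n)))
      (pullback-cong (modulo h (p ℕ.^ n)) (coh n))

  completeForm : (A B : Algebra K ℓ) → AlgHom A B → Form (Algebra.Carrier A) → Carrierᴹ (Ω̂ B)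
  completeForm A B h ω =
    (λ n → pullback (toMod h (p ℕ.^ n)) ω) ,
    λ n → mapForm-triangle (B mod (p ℕ.^ n)) (h $ₐ_) id (h $ₐ_)
      (λ _ → Algebra.refl (B mod (p ℕ.^ n))) ω

-- An open subset U of Spec A is given by the radical ideal of its complement:
-- D(f) ⊂ U if and only if f belongs to that ideal.
record OpenSubset (A : CommutativeRing ℓ ℓ) : Set (lsuc ℓ) where
  open CommutativeRing A using (_≈_; _+_; _*_; 0#) renaming (Carrier to Elt)
  open RawSemiringOps (RawRing.rawSemiring (rawRing A)) using (_^_)
  field
    D⊂     : Elt → Set ℓ
    resp   : ∀ {f g} → f ≈ g → D⊂ f → D⊂ g
    D⊂-0   : D⊂ 0#
    D⊂-+   : ∀ {f g} → D⊂ f → D⊂ g → D⊂ (f + g)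
    D⊂-*   : ∀ r {f} → D⊂ f → D⊂ (r * f)
    D⊂-rad : ∀ {f} n → D⊂ (f ^ n) → D⊂ f

open OpenSubset using (D⊂)

IsFrobeniusLift : ℕ → (B : CommutativeRing ℓ ℓ) → (Carrier B → Carrier B) → Set ℓ
IsFrobeniusLift p B φ = ∀ r → CommutativeRing._≈_ (B /[ p ]) (φ r) (r ^ p)
  where open RawSemiringOps (RawRing.rawSemiring (rawRing B)) using (_^_)

record FrobeniusLift (p : ℕ) (R : CommutativeRing ℓ ℓ) : Set ℓ where
  field
    φ         : Hom R R
    frobenius : IsFrobeniusLift p R ⟦ φ ⟧

module _ {R : CommutativeRing ℓ ℓ} (A : Algebra R ℓ) where
  private
    module A = Algebra A

  away : A.Carrier → Algebra R ℓ
  away f = restrictScalars A (localization A.ring f)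

  toAway : ∀ f → AlgHom A (away f)
  toAway f = record
    { hom = ι (localization A.ring f) ; ι-hom = λ _ → Algebra.refl (away f) }

  -- An A-algebra homomorphism A[1/f] → A[1/g]; it exists, and is then unique,
  -- exactly when D(g) ⊂ D(f).
  Restriction : A.Carrier → A.Carrier → Set ℓ
  Restriction f g = AlgHom (localization A.ring f) (localization A.ring g)

  restrictionOverBase : ∀ f g → Restriction f g → AlgHom (away f) (away g)
  restrictionOverBase f g ρ = record
    { hom = hom ρ ; ι-hom = λ k → AlgHomOver.ι-hom ρ (⟦ ι A ⟧ k) }

  completedRestriction : ∀ p f g → Restriction f g →
                         Hom (completion p (ring (away f))) (completion p (ring (away g)))
  completedRestriction p f g ρ = mapCompletion p (hom (restrictionOverBase f g ρ))

  -- The completion of U has the same underlying space as U mod p.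
  HasNonemptyCompletion : ℕ → OpenSubset A.ring → Set ℓ
  HasNonemptyCompletion p U = Σ[ f ∈ A.Carrier ] D⊂ U f ×
    ¬ CommutativeRing._≈_ (ring (away f) /[ p ]) (Algebra.1# (away f)) (Algebra.0# (away f))

module _ (p : ℕ) {R : CommutativeRing ℓ ℓ} (φR : FrobeniusLift p R)
         (A : Algebra R ℓ) (U : OpenSubset (ring A)) where
  private
    module A = Algebra A

    A[1/_] : A.Carrier → Algebra R ℓ
    A[1/ f ] = away A f

  -- The completion of U and its reduction mod p have the same underlying space,
  -- on which the p-power Frobenius is the identity; so a Frobenius lift is a lift
  -- of the p-power map to an endomorphism of the structure sheaf, given here on
  -- the base of opens D(f) ⊂ U, whose sections are the completions of A[1/f].
  LocalEndomorphisms : Set ℓ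
  LocalEndomorphisms = ∀ f → D⊂ U f →
    AlgHomOver {K = R} {K′ = R} ⟦ FrobeniusLift.φ φR ⟧ (completed A[1/ f ] p) (completed A[1/ f ] p)

  LiftFrobenius : LocalEndomorphisms → Set ℓ
  LiftFrobenius φ = ∀ f (f∈ : D⊂ U f) →
    IsFrobeniusLift p (completion p (ring A[1/ f ])) (φ f f∈ $ₐ_)

  CommuteWithRestriction : LocalEndomorphisms → Set ℓ
  CommuteWithRestriction φ = ∀ f g (f∈ : D⊂ U f) (g∈ : D⊂ U g) (ρ : Restriction A f g) r →
    CommutativeRing._≈_ (completion p (ring A[1/ g ]))
      (⟦ completedRestriction A p f g ρ ⟧ (φ f f∈ $ₐ r))
      (φ g g∈ $ₐ ⟦ completedRestriction A p f g ρ ⟧ r)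

  FrobeniusLiftOn : Set ℓ
  FrobeniusLiftOn = Σ[ φ ∈ LocalEndomorphisms ] LiftFrobenius φ × CommuteWithRestriction φ

  BasicOpen : Set ℓ
  BasicOpen = Σ[ f ∈ A.Carrier ] D⊂ U f

  private
    Ω̂D : BasicOpen → Module R ℓ ℓ
    Ω̂D (f , _) = Ω̂ p A[1/ f ]

  Compatible : (∀ D → Module.Carrierᴹ (Ω̂D D)) → Set ℓ
  Compatible ω = ∀ (D E : BasicOpen) (ρ : Restriction A (proj₁ D) (proj₁ E)) →
    Module._≈ᴹ_ (Ω̂D E)
      (mapΩ̂ p A[1/ proj₁ D ] A[1/ proj₁ E ] (restrictionOverBase A (proj₁ D) (proj₁ E) ρ) (ω D))
      (ω E)

  -- Sections of Ω̂ over U, as compatible families on the base of opens D(f) ⊂ U.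
  Ω̂-on : Module R ℓ ℓ
  Ω̂-on = submoduleOfProduct R BasicOpen Ω̂D Compatible
    (λ e f D E ρ n → ⊕-cong (e D E ρ n) (f D E ρ n))
    (λ D E ρ n → Ω-refl)
    (λ e D E ρ n → ⊝-cong (e D E ρ n))
    (λ r e D E ρ n → ⊙-cong
      (AlgHomOver.ι-hom (modulo p (restrictionOverBase A (proj₁ D) (proj₁ E) ρ) (p ℕ.^ n)) r) (e D E ρ n))

  restrictToCompletion : Form A.Carrier → Module.Carrierᴹ Ω̂-on
  restrictToCompletion ω =
    (λ (f , _) → completeForm p A A[1/ f ] (toAway A f) ω) ,
    λ (f , _) (g , _) ρ n → mapForm-triangle (A[1/ g ] mod (p ℕ.^ n))
      (toAway A f $ₐ_) (ρ $ₐ_) (toAway A g $ₐ_)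
      (λ r → Hom.⟦⟧-cong (reduceMod (ring A[1/ g ]) (p ℕ.^ n)) (AlgHomOver.ι-hom ρ r)) ω

  module _ (Φ : FrobeniusLiftOn) where
    private
      φ       = proj₁ Φ
      commute = proj₂ (proj₂ Φ)

    φ* : Module.Carrierᴹ Ω̂-on → Module.Carrierᴹ Ω̂-on
    φ* (ω , compat) =
      (λ D@(f , f∈) → pullbackΩ̂ p A[1/ f ] (φ f f∈) (ω D)) ,
      λ D@(f , f∈) E@(g , g∈) ρ n → Ω-trans
        (mapForm-square (A[1/ g ] mod (p ℕ.^ n))
          (atLevel p A[1/ f ] A[1/ f ] (φ f f∈) n $ₐ_) (ρ $ₐ_)
          (ρ $ₐ_) (atLevel p A[1/ g ] A[1/ g ] (φ g g∈) n $ₐ_)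
          (λ r → CommutativeRing.trans (ring A[1/ g ] /[ p ℕ.^ n ])
            (commute f g f∈ g∈ ρ (⟦ toCompletion p (ring A[1/ f ]) ⟧ r) n)
            (AlgHomOver.⟦⟧-cong (φ g g∈)
              (λ m → CommutativeRing.refl (ring A[1/ g ] /[ p ℕ.^ m ])) n))
          (proj₁ (ω D) n))
        (pullback-cong (atLevel p A[1/ g ] A[1/ g ] (φ g g∈) n) (compat D E ρ n))

    IsDividedPullback : (ω ψ : Module.Carrierᴹ Ω̂-on) → Set ℓ
    IsDividedPullback ω ψ = nat R p *ₗ ψ ≈ᴹ φ* ω
      where open Module Ω̂-on using (_*ₗ_; _≈ᴹ_)

module _ {R : CommutativeRing ℓ ℓ} (G : AffineGroupScheme R) where
  private
    module G = AffineGroupScheme G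
    module O-G = Algebra G.O
    module ΩG = Module (restrictModule R (ι G.O) (Ω G.O))

  -- The comorphism of x ↦ g x on the base change of G to S.
  leftTranslation : (S : Algebra R ℓ) → Point G S → AlgHom G.O (restrictScalars S (S ⊗ G.O))
  leftTranslation S g = (includeˡ S G.O ∘ₐ g) G.∙ includeʳ S G.O

  IsLeftInvariant : Form O-G.Carrier → Set (lsuc ℓ)
  IsLeftInvariant ω = ∀ (S : Algebra R ℓ) (g : Point G S) →
    FormEq (S ⊗ G.O) (mapForm (leftTranslation S g $ₐ_) ω) (mapForm (includeʳ S G.O $ₐ_) ω)

  -- A generating family has at least d members, where d is the relative
  -- dimension, since the left invariant forms are a free module of rank d.
  record GeneratesLeftInvariantForms {D : ℕ} (ω : Fin D → Form O-G.Carrier) : Set (lsuc ℓ) where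
    open ModuleOps (restrictModule R (ι G.O) (Ω G.O)) using (combination)
    field
      invariant : ∀ i → IsLeftInvariant (ω i)
      generates : ∀ η → IsLeftInvariant η → Σ[ r ∈ (Fin D → Carrier R) ] η ΩG.≈ᴹ combination r ω

  -- ψ i is (φ*/p) (ω i): for G smooth, φ* (ω i) is uniquely divisible by p.
  record IsLieInvariantModp (p : ℕ) (φR : FrobeniusLift p R) (U : OpenSubset (coordinateRing G))
                            (Φ : FrobeniusLiftOn p φR G.O U) : Set (lsuc ℓ) where
    open Module (Ω̂-on p φR G.O U) using (Carrierᴹ)
    open ModuleOps (Ω̂-on p φR G.O U) using (combination; CongruentMod)
    field
      D          : ℕ
      ω          : Fin D → Form O-G.Carrier
      generating : GeneratesLeftInvariantForms ω
      λ-matrix   : Fin D → Fin D → Carrier R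
      ψ          : Fin D → Carrierᴹ
      ψ-divided  : ∀ i → IsDividedPullback p φR G.O U Φ (restrictToCompletion p φR G.O U (ω i)) (ψ i)
      congruence : ∀ i → CongruentMod p (ψ i)
                     (combination (λ-matrix i) (restrictToCompletion p φR G.O U ∘ ω))

record IsSquareZeroExtension {R : CommutativeRing ℓ ℓ} {B C : Algebra R ℓ}
                             (q : AlgHom B C) : Set ℓ where
  private
    module B = Algebra B
    module C = Algebra C
  field
    surjective : ∀ s → Σ[ r ∈ B.Carrier ] (q $ₐ r) C.≈ s
    squareZero : ∀ r s → (q $ₐ r) C.≈ C.0# → (q $ₐ s) C.≈ C.0# → r B.* s B.≈ B.0#

data Relations {C : Set c} {n m : ℕ} (0# : C) (r : Fin m → Term C (Fin n)) :
               Term C (Fin n) → Term C (Fin n) → Set c where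
  relation : ∀ i → Relations 0# r (r i) (const 0#)

module _ {R : CommutativeRing ℓ ℓ} (A : Algebra R ℓ) where

  record IsFinitelyPresented : Set ℓ where
    open CommutativeRing R using (0#)
    field
      generators    : ℕ
      relations     : ℕ
      relationTerms : Fin relations → Term (Carrier R) (Fin generators)

    presentation : Algebra R ℓ
    presentation = presented R (Fin generators) (Relations 0# relationTerms)

    field
      iso           : AlgHom presentation A
      isIsomorphism : IsRingIsomorphism (rawRing (ring presentation)) (rawRing (ring A)) (iso $ₐ_)

  IsFormallySmooth : Set (lsuc ℓ)
  IsFormallySmooth = (B C : Algebra R ℓ) (q : AlgHom B C) → IsSquareZeroExtension q →
                     (h : AlgHom A C) → Σ[ h̃ ∈ AlgHom A B ] (q ∘ₐ h̃) ≈ₐ h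

  record IsSmooth : Set (lsuc ℓ) where
    field
      finitelyPresented : IsFinitelyPresented
      formallySmooth    : IsFormallySmooth

module _ (R : CommutativeRing ℓ ℓ) where
  open CommutativeRing R hiding (rawRing) renaming (Carrier to Elt)
  open RawSemiringOps (RawRing.rawSemiring (rawRing R)) using (_^_; sum)

  -- π generates the maximal ideal.
  record IsDVRWithUniformizer (π : Elt) : Set ℓ where
    field
      noZeroDivisors : ∀ r s → r * s ≈ 0# → r ≈ 0# ⊎ s ≈ 0#
      π≉0            : ¬ π ≈ 0#
      π-nonunit      : ¬ IsUnit R π
      factorization  : ∀ r → ¬ r ≈ 0# → Σ[ u ∈ Elt ] Σ[ n ∈ ℕ ] IsUnit R u × r ≈ u * π ^ n

  record IsAlgebraicallyClosedField : Set ℓ where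
    field
      1≉0       : ¬ 1# ≈ 0#
      zero⊎unit : ∀ r → r ≈ 0# ⊎ IsUnit R r
      root      : ∀ n (c : Fin (2 ℕ.+ n) → Elt) → ¬ c (fromℕ (suc n)) ≈ 0# →
                  Σ[ r ∈ Elt ] sum (λ i → c i * r ^ toℕ i) ≈ 0#

{-# OPTIONS --safe #-}

-- Write u = 1 + qM with q a power of p and M non-zero modulo p. Since Mᵖ = 0, the matrix
-- E(t) = (1 + qM)^(t/q) is a polynomial in t over R. It lies in G for t = mq, hence identically, because
-- R is p-adically separated. So E is a one-parameter group in G whose velocity D at the identity is
-- non-zero modulo p.
--
-- Let g be the tautological point of D(f) modulo p². Along the curve g E(t), with power series as
-- coordinates, every left invariant form ω is the constant multiple ⟨ω, D⟩ dt of dt. The coefficient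
-- of t^(p-1) dt in the pullback of (φ*/p) ω is ⟨ω, D⟩ᵖ modulo p: this is the computation of the Cartier
-- operator. If (φ*/p) ω is congruent to a left invariant form, that coefficient vanishes, so ⟨ω, D⟩ is
-- divisible by p. As the left invariant forms span the cotangent space at the identity, D is divisible
-- by p, a contradiction.
--
-- Instead of cancelling p in Ω it suffices that p ≠ 0 in O(G)[1/f]/p², which holds because
-- O(G) → O(G)[1/f]/p lifts to the Witt vectors of length 2.

module Submission where

open import Algebra.Bundles using (CommutativeRing; Group; Ring)
open import Algebra.Module.Bundles using (Module)
import Algebra.Module.Construct.Idealization as Idealization
import Algebra.Module.Construct.TensorUnit as TensorUnit
open import Algebra.Morphism.Structures using (IsRingIsomorphism)
import Algebra.Properties.AbelianGroup as AbelianGroupProperties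
import Algebra.Properties.CommutativeSemigroup as CommutativeSemigroupProperties
import Algebra.Properties.CommutativeSemiring.Exp as Exp
import Algebra.Properties.Group as GroupProperties
import Algebra.Properties.Ring as RingProperties
import Algebra.Properties.Semiring.Exp as SemiringExp
import Algebra.Properties.Semiring.Mult as SemiringMult
import Algebra.Properties.Semiring.Sum as SemiringSum
import Algebra.Solver.Ring.NaturalCoefficients.Default as NatCoefficients
open import Data.Empty using (⊥; ⊥-elim)
open import Data.Fin using (Fin; zero; suc; combine; remQuot)
open import Data.Fin.Properties using (remQuot-combine; combine-remQuot)
open import Data.Nat using (ℕ; zero; suc; _≤_; _<_; z≤n; s≤s)
import Data.Nat as ℕ
open import Data.Nat.Coprimality using (coprime-Bézout; prime⇒coprime)
open import Data.Nat.GCD using (module Bézout)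
open import Data.Nat.Primality using (Prime; prime⇒nonTrivial)
import Data.Nat.Properties as ℕ
open import Data.Product using (Σ-syntax; _×_; _,_; proj₁; proj₂)
open import Data.Sum using (_⊎_; inj₁; inj₂)
open import Data.Unit using (⊤; tt)
open import Function using (_∘_)
open import Level using (Level; Lift; lift) renaming (suc to lsuc)
open import Relation.Binary.PropositionalEquality as ≡ using (_≡_)
import Relation.Binary.Reasoning.Setoid as SetoidReasoning
open import Relation.Nullary using (¬_; Dec; yes; no)
open import Relation.Nullary.Decidable using (¬¬-excluded-middle)
open import Defs
open Completion using (toCompletion; project)

-- The bound on the index keeps denominators away: since Mᵖ = 0, every series in M may be cut off
-- below degree p, and k! is a unit of R for k < p. One truncated series serves two purposes. With w
-- = -q it gives E(t). With w = 0 the coefficient of degree p in a product of two of its values is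
-- ((s + t)ᵖ - sᵖ - tᵖ)/p!, which makes the Witt carry available in rings where p = 0. Power series
-- are the coordinates on the curve because of the localization at f: along g E(t) the constant term
-- of f is invertible, and this makes f a unit among power series. Modulo p² the product of two
-- multiples of p vanishes, so the p-th power becomes additive once it is multiplied by p; this is
-- how the Cartier operator is computed without a division. Splitting u as 1 + qM requires knowing
-- which entries of u - 1 vanish, and equality in R is not assumed to be decidable. The theorem is a
-- negation, so the splitting is only established up to double negation.

private
  variable
    a b ℓ ℓ′ : Level

-- Power series

module PowerSeries (C : CommutativeRing a a) where
  open CommutativeRing C renaming (Carrier to Scalar)
  open RingProperties (CommutativeRing.ring C) using (-‿distribʳ-*)
  open SetoidReasoning setoid
  private
    module Solver = NatCoefficients commutativeSemiring
  open Solver using (solve; _:=_; _:+_; _:*_)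

  Seq : Set a
  Seq = ℕ → Scalar

  infix 4 _≗_
  _≗_ : Seq → Seq → Set a
  f ≗ g = ∀ n → f n ≈ g n

  tail : Seq → Seq
  tail f n = f (suc n)

  infixl 7 _⊛_
  -- The Cauchy product in the form f g = f₀ g + T (tail f) g, so that proofs go by recursion on the
  -- degree.
  _⊛_ : Seq → Seq → Seq
  (f ⊛ g) zero    = f 0 * g 0
  (f ⊛ g) (suc n) = f 0 * g (suc n) + (tail f ⊛ g) n

  _⊹_ : Seq → Seq → Seq
  (f ⊹ g) n = f n + g n

  scale : Scalar → Seq → Seq
  scale c f n = c * f n

  constˢ : Scalar → Seq
  constˢ c zero    = c
  constˢ c (suc n) = 0#

  -- A coefficient of a product depends only on the coefficients up to its degree. Identities that
  -- hold only below degree p are multiplied through this lemma.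
  ⊛-cong≤ : ∀ n {f f′ g g′} → (∀ k → k ≤ n → f k ≈ f′ k) → (∀ k → k ≤ n → g k ≈ g′ k) →
            (f ⊛ g) n ≈ (f′ ⊛ g′) n
  ⊛-cong≤ zero    e e′ = *-cong (e 0 z≤n) (e′ 0 z≤n)
  ⊛-cong≤ (suc n) e e′ = +-cong (*-cong (e 0 z≤n) (e′ (suc n) ℕ.≤-refl))
    (⊛-cong≤ n (λ k k≤n → e (suc k) (s≤s k≤n)) (λ k k≤n → e′ k (ℕ.m≤n⇒m≤1+n k≤n)))

  ⊛-cong : ∀ {f f′ g g′} → f ≗ f′ → g ≗ g′ → f ⊛ g ≗ f′ ⊛ g′
  ⊛-cong e e′ n = ⊛-cong≤ n (λ k _ → e k) (λ k _ → e′ k)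

  ⊛-distribʳ : ∀ f g h → (f ⊹ g) ⊛ h ≗ (f ⊛ h) ⊹ (g ⊛ h)
  ⊛-distribʳ f g h zero    = distribʳ _ _ _
  ⊛-distribʳ f g h (suc n) = begin
    (f 0 + g 0) * h (suc n) + (tail (f ⊹ g) ⊛ h) n
      ≈⟨ +-congˡ (⊛-distribʳ (tail f) (tail g) h n) ⟩
    (f 0 + g 0) * h (suc n) + ((tail f ⊛ h) n + (tail g ⊛ h) n)
      ≈⟨ solve 5 (λ x y z u v → (x :+ y) :* z :+ (u :+ v) := (x :* z :+ u) :+ (y :* z :+ v))
           refl _ _ _ _ _ ⟩
    (f 0 * h (suc n) + (tail f ⊛ h) n) + (g 0 * h (suc n) + (tail g ⊛ h) n)
      ∎

  scale-⊛ : ∀ c f g → scale c f ⊛ g ≗ scale c (f ⊛ g)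
  scale-⊛ c f g zero    = *-assoc _ _ _
  scale-⊛ c f g (suc n) =
    trans (+-cong (*-assoc _ _ _) (scale-⊛ c (tail f) g n)) (sym (distribˡ _ _ _))

  ⊛-sucʳ : ∀ f g n → (f ⊛ g) (suc n) ≈ f (suc n) * g 0 + (f ⊛ tail g) n
  ⊛-sucʳ f g zero    = +-comm _ _
  ⊛-sucʳ f g (suc n) = begin
    f 0 * g (suc (suc n)) + (tail f ⊛ g) (suc n)
      ≈⟨ +-congˡ (⊛-sucʳ (tail f) g n) ⟩
    f 0 * g (suc (suc n)) + (f (suc (suc n)) * g 0 + (tail f ⊛ tail g) n)
      ≈⟨ solve 3 (λ x y z → x :+ (y :+ z) := y :+ (x :+ z)) refl _ _ _ ⟩
    f (suc (suc n)) * g 0 + (f ⊛ tail g) (suc n)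
      ∎

  ⊛-comm : ∀ f g → f ⊛ g ≗ g ⊛ f
  ⊛-comm f g zero    = *-comm _ _
  ⊛-comm f g (suc n) =
    trans (+-cong (*-comm _ _) (⊛-comm (tail f) g n)) (sym (⊛-sucʳ g f n))

  ⊛-assoc : ∀ f g h → (f ⊛ g) ⊛ h ≗ f ⊛ (g ⊛ h)
  ⊛-assoc f g h zero    = *-assoc _ _ _
  ⊛-assoc f g h (suc n) = begin
    f 0 * g 0 * h (suc n) + ((scale (f 0) (tail g) ⊹ (tail f ⊛ g)) ⊛ h) n
      ≈⟨ +-congˡ (⊛-distribʳ (scale (f 0) (tail g)) (tail f ⊛ g) h n) ⟩
    f 0 * g 0 * h (suc n) + ((scale (f 0) (tail g) ⊛ h) n + ((tail f ⊛ g) ⊛ h) n)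
      ≈⟨ +-congˡ (+-cong (scale-⊛ (f 0) (tail g) h n) (⊛-assoc (tail f) g h n)) ⟩
    f 0 * g 0 * h (suc n) + (f 0 * (tail g ⊛ h) n + (tail f ⊛ (g ⊛ h)) n)
      ≈⟨ solve 5 (λ x y z u v → x :* y :* z :+ (x :* u :+ v) := x :* (y :* z :+ u) :+ v)
           refl _ _ _ _ _ ⟩
    f 0 * (g 0 * h (suc n) + (tail g ⊛ h) n) + (tail f ⊛ (g ⊛ h)) n
      ∎

  ⊛-zeroˡ : ∀ f g → (∀ n → f n ≈ 0#) → ∀ n → (f ⊛ g) n ≈ 0#
  ⊛-zeroˡ f g f≈0 zero    = trans (*-congʳ (f≈0 0)) (zeroˡ _)
  ⊛-zeroˡ f g f≈0 (suc n) =
    trans (+-cong (trans (*-congʳ (f≈0 0)) (zeroˡ _)) (⊛-zeroˡ (tail f) g (f≈0 ∘ suc) n))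
          (+-identityˡ _)

  constˢ-⊛ : ∀ c f → constˢ c ⊛ f ≗ scale c f
  constˢ-⊛ c f zero    = refl
  constˢ-⊛ c f (suc n) =
    trans (+-congˡ (⊛-zeroˡ (tail (constˢ c)) f (λ _ → refl) n)) (+-identityʳ _)

  ⊛-identityˡ : ∀ f → constˢ 1# ⊛ f ≗ f
  ⊛-identityˡ f n = trans (constˢ-⊛ 1# f n) (*-identityˡ _)

  ⊛-distribˡ : ∀ f g h → f ⊛ (g ⊹ h) ≗ (f ⊛ g) ⊹ (f ⊛ h)
  ⊛-distribˡ f g h n = trans (⊛-comm f (g ⊹ h) n)
    (trans (⊛-distribʳ g h f n) (+-cong (⊛-comm g f n) (⊛-comm h f n)))

  series : CommutativeRing a a
  series .CommutativeRing.Carrier = Seq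
  series .CommutativeRing._≈_     = _≗_
  series .CommutativeRing._+_     = _⊹_
  series .CommutativeRing._*_     = _⊛_
  series .CommutativeRing.-_      = λ f n → - f n
  series .CommutativeRing.0#      = λ _ → 0#
  series .CommutativeRing.1#      = constˢ 1#
  series .CommutativeRing.isCommutativeRing = record
    { isRing = record
      { +-isAbelianGroup = record
        { isGroup = record
          { isMonoid = record
            { isSemigroup = record
              { isMagma = record
                { isEquivalence = record
                  { refl = λ _ → refl ; sym = λ e n → sym (e n) ; trans = λ e f n → trans (e n) (f n) }
                ; ∙-cong = λ e f n → +-cong (e n) (f n)
                }
              ; assoc = λ _ _ _ _ → +-assoc _ _ _
              }
            ; identity = (λ _ _ → +-identityˡ _) , (λ _ _ → +-identityʳ _)
            }
          ; inverse = (λ _ _ → -‿inverseˡ _) , (λ _ _ → -‿inverseʳ _)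
          ; ⁻¹-cong = λ e n → -‿cong (e n)
          }
        ; comm = λ _ _ _ → +-comm _ _
        }
      ; *-cong = ⊛-cong
      ; *-assoc = ⊛-assoc
      ; *-identity = ⊛-identityˡ , λ f n → trans (⊛-comm f (constˢ 1#) n) (⊛-identityˡ f n)
      ; distrib = ⊛-distribˡ , λ f g h → ⊛-distribʳ g h f
      }
    ; *-comm = ⊛-comm
    }

  constant : Hom C series
  constant = mkHom C series constˢ
    (λ { e zero → e ; e (suc n) → refl })
    (λ { _ _ zero → refl ; _ _ (suc n) → sym (+-identityˡ _) })
    (λ { c e zero    → refl
       ; c e (suc n) → sym (trans (constˢ-⊛ c (constˢ e) (suc n)) (zeroʳ _)) })
    (λ _ → refl)

  leading : Hom series C
  leading = mkHom series C (λ f → f 0) (λ e → e 0) (λ _ _ → refl) (λ _ _ → refl) refl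

  X : Seq
  X zero          = 0#
  X (suc zero)    = 1#
  X (suc (suc n)) = 0#

  X⊛-zero : ∀ f → (X ⊛ f) 0 ≈ 0#
  X⊛-zero f = zeroˡ _

  X⊛-suc : ∀ f n → (X ⊛ f) (suc n) ≈ f n
  X⊛-suc f n = trans (+-cong (zeroˡ _) (trans (⊛-cong tail-X (λ _ → refl) n) (⊛-identityˡ f n)))
                     (+-identityˡ _)
    where
    tail-X : tail X ≗ constˢ 1#
    tail-X zero    = refl
    tail-X (suc n) = refl

  expand : ∀ f → f ≗ constˢ (f 0) ⊹ (X ⊛ tail f)
  expand f zero    = sym (trans (+-congˡ (X⊛-zero (tail f))) (+-identityʳ _))
  expand f (suc n) = sym (trans (+-identityˡ _) (X⊛-suc (tail f) n))

  -- The two products differ only in the term with the last coefficient of the first factor. This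
  -- isolates the degree in which a truncated series ceases to satisfy its differential equation.
  ⊛-last : ∀ n f f′ g → (∀ k → k < n → f k ≈ f′ k) →
           (f ⊛ g) n + f′ n * g 0 ≈ (f′ ⊛ g) n + f n * g 0
  ⊛-last zero    f f′ g e = +-comm _ _
  ⊛-last (suc n) f f′ g e = begin
    f 0 * g (suc n) + (tail f ⊛ g) n + f′ (suc n) * g 0
      ≈⟨ +-assoc _ _ _ ⟩
    f 0 * g (suc n) + ((tail f ⊛ g) n + f′ (suc n) * g 0)
      ≈⟨ +-cong (*-congʳ (e 0 (s≤s z≤n)))
                (⊛-last n (tail f) (tail f′) g (λ k k<n → e (suc k) (s≤s k<n))) ⟩
    f′ 0 * g (suc n) + ((tail f′ ⊛ g) n + f (suc n) * g 0)
      ≈⟨ +-assoc _ _ _ ⟨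
    f′ 0 * g (suc n) + (tail f′ ⊛ g) n + f (suc n) * g 0
      ∎

  -- The operator T d/dT. It preserves degrees, so its product rule follows the recursion of `_⊛_`;
  -- the rule for d/dT is a shift of it.
  euler : Seq → Seq
  euler f n = nat C n * f n

  derivative : Seq → Seq
  derivative f = tail (euler f)

  private
    euler-suc : ∀ f → tail (euler f) ≗ tail f ⊹ euler (tail f)
    euler-suc f n = trans (distribʳ _ _ _) (+-congʳ (*-identityˡ _))

  euler-⊛ : ∀ f g → euler (f ⊛ g) ≗ (euler f ⊛ g) ⊹ (f ⊛ euler g)
  euler-⊛ f g zero = trans (zeroˡ _)
    (sym (trans (+-cong (trans (*-congʳ (zeroˡ _)) (zeroˡ _)) (trans (*-congˡ (zeroˡ _)) (zeroʳ _)))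
                (+-identityˡ _)))
  euler-⊛ f g (suc n) = begin
    (1# + ν) * (f 0 * g (suc n) + (tail f ⊛ g) n)
      ≈⟨ solve 4 (λ o ν x y → (o :+ ν) :* (x :+ y) := ((o :+ ν) :* x :+ o :* y) :+ ν :* y) refl _ _ _ _ ⟩
    (1# + ν) * (f 0 * g (suc n)) + 1# * (tail f ⊛ g) n + ν * (tail f ⊛ g) n
      ≈⟨ +-cong (+-congˡ (*-identityˡ _)) (euler-⊛ (tail f) g n) ⟩
    (1# + ν) * (f 0 * g (suc n)) + (tail f ⊛ g) n + ((euler (tail f) ⊛ g) n + (tail f ⊛ euler g) n)
      ≈⟨ solve 6 (λ m x y u v w → m :* (x :* y) :+ u :+ (v :+ w) := (u :+ v) :+ (x :* (m :* y) :+ w))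
           refl _ _ _ _ _ _ ⟩
    ((tail f ⊛ g) n + (euler (tail f) ⊛ g) n) + (f 0 * ((1# + ν) * g (suc n)) + (tail f ⊛ euler g) n)
      ≈⟨ +-congʳ (trans (sym (⊛-distribʳ (tail f) (euler (tail f)) g n))
                        (⊛-cong (λ k → sym (euler-suc f k)) (λ _ → refl) n)) ⟩
    (tail (euler f) ⊛ g) n + (f ⊛ euler g) (suc n)
      ≈⟨ +-congʳ (sym (trans (+-congʳ (trans (*-congʳ (zeroˡ _)) (zeroˡ _))) (+-identityˡ _))) ⟩
    (euler f ⊛ g) (suc n) + (f ⊛ euler g) (suc n)
      ∎
    where ν = nat C n

  derivative-⊛ : ∀ f g → derivative (f ⊛ g) ≗ (derivative f ⊛ g) ⊹ (f ⊛ derivative g)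
  derivative-⊛ f g n = trans (euler-⊛ f g (suc n)) (+-cong
    (trans (+-congʳ (trans (*-congʳ (zeroˡ _)) (zeroˡ _))) (+-identityˡ _))
    (trans (⊛-sucʳ f (euler g) n)
      (trans (+-congʳ (trans (*-congˡ (zeroˡ _)) (zeroʳ _))) (+-identityˡ _))))

  derivative-constˢ : ∀ c n → derivative (constˢ c) n ≈ 0#
  derivative-constˢ c n = zeroʳ _

  private
    step : Seq → Scalar → Seq → Seq
    step f s g zero    = s
    step f s g (suc n) = - (s * (tail f ⊛ g) n)

    -- The inverse satisfies g(n+1) = -s (tail f · g)(n), a course-of-values recursion. The k-th
    -- approximant runs it with fuel k and is correct in the degrees below k.
    approximant : Seq → Scalar → ℕ → Seq
    approximant f s zero    = λ _ → 0#
    approximant f s (suc k) = step f s (approximant f s k)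

    approximants-agree : ∀ f s n j k → n < j → n < k → approximant f s j n ≈ approximant f s k n
    approximants-agree f s zero    (suc j) (suc k) _         _         = refl
    approximants-agree f s (suc n) (suc j) (suc k) (s≤s n<j) (s≤s n<k) =
      -‿cong (*-congˡ (⊛-cong≤ n (λ _ _ → refl) (λ i i≤n →
        approximants-agree f s i j k (ℕ.≤-<-trans i≤n n<j) (ℕ.≤-<-trans i≤n n<k))))

  leading-unit⇒unit : ∀ f → IsUnit C (f 0) → IsUnit series f
  leading-unit⇒unit f (s , f₀s≈1) = g , f⊛g≈1
    where
    g : Seq
    g n = approximant f s (suc n) n

    g-suc : ∀ n → g (suc n) ≈ - (s * (tail f ⊛ g) n)
    g-suc n = -‿cong (*-congˡ (⊛-cong≤ n (λ _ _ → refl) (λ i i≤n →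
      approximants-agree f s i (suc n) (suc i) (s≤s i≤n) ℕ.≤-refl)))

    f⊛g≈1 : f ⊛ g ≗ constˢ 1#
    f⊛g≈1 zero    = f₀s≈1
    f⊛g≈1 (suc n) = begin
      f 0 * g (suc n) + y        ≈⟨ +-congʳ (*-congˡ (g-suc n)) ⟩
      f 0 * - (s * y) + y        ≈⟨ +-congʳ (sym (-‿distribʳ-* _ _)) ⟩
      - (f 0 * (s * y)) + y      ≈⟨ +-congʳ (-‿cong (sym (*-assoc _ _ _))) ⟩
      - (f 0 * s * y) + y        ≈⟨ +-congʳ (-‿cong (trans (*-congʳ f₀s≈1) (*-identityˡ _))) ⟩
      - y + y                    ≈⟨ -‿inverseˡ _ ⟩
      0#                         ∎
      where y = (tail f ⊛ g) n

module _ {C : CommutativeRing a a} {D : CommutativeRing b b} (h : Hom C D) where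
  private
    module C = CommutativeRing C
    module D = CommutativeRing D
    module h = Hom h
    module SC = PowerSeries C
    module SD = PowerSeries D

  hom-⊛ : ∀ f g n → ⟦ h ⟧ ((f SC.⊛ g) n) D.≈ ((⟦ h ⟧ ∘ f) SD.⊛ (⟦ h ⟧ ∘ g)) n
  hom-⊛ f g zero    = h.*-homo _ _
  hom-⊛ f g (suc n) = D.trans (h.+-homo _ _) (D.+-cong (h.*-homo _ _) (hom-⊛ (SC.tail f) g n))

  hom-constˢ : ∀ c n → ⟦ h ⟧ (SC.constˢ c n) D.≈ SD.constˢ (⟦ h ⟧ c) n
  hom-constˢ c zero    = D.refl
  hom-constˢ c (suc n) = h.0#-homo

  mapSeries : Hom SC.series SD.series
  mapSeries = mkHom SC.series SD.series (⟦ h ⟧ ∘_)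
    (λ e n → h.⟦⟧-cong (e n))
    (λ _ _ _ → h.+-homo _ _)
    hom-⊛
    (λ n → D.trans (hom-constˢ C.1# n) (Hom.⟦⟧-cong SD.constant h.1#-homo n))

-- Truncated exponential series

-- recip k is the inverse of k + 1, cut off at p.
record TruncatedReciprocals (p : ℕ) (C : CommutativeRing a a) : Set a where
  open CommutativeRing C
  field
    recip     : ℕ → Carrier
    recip-inv : ∀ k → suc k < p → nat C (suc k) * recip k ≈ 1#
    recip-top : ∀ k → p ≤ suc k → recip k ≈ 0#

mapReciprocals : ∀ {p} {C : CommutativeRing a a} {D : CommutativeRing b b} → Hom C D →
                 TruncatedReciprocals p C → TruncatedReciprocals p D
mapReciprocals {D = D} h i = record
  { recip     = ⟦ h ⟧ ∘ recip
  ; recip-inv = λ k k<p → trans (*-congʳ (sym (hom-nat h (suc k))))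
      (trans (sym (h.*-homo _ _)) (trans (h.⟦⟧-cong (recip-inv k k<p)) h.1#-homo))
  ; recip-top = λ k p≤k → trans (h.⟦⟧-cong (recip-top k p≤k)) h.0#-homo
  }
  where
  module h = Hom h
  open TruncatedReciprocals i
  open CommutativeRing D

-- The expansion of (1 - wT)^(-s/w), respectively exp(sT) if w = 0, below degree p:
-- the k-th coefficient is s(s + w)...(s + (k-1)w)/k!.
module Exponential (C : CommutativeRing a a) (p : ℕ) (i : TruncatedReciprocals p C)
                   (w : CommutativeRing.Carrier C) where
  open CommutativeRing C renaming (Carrier to Scalar)
  open TruncatedReciprocals i
  open PowerSeries C
  open SetoidReasoning setoid
  private
    module Solver = NatCoefficients commutativeSemiring
  open Solver using (solve; _:=_; _:+_; _:*_)

  expo : Scalar → Seq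
  expo s zero    = 1#
  expo s (suc k) = recip k * ((s + nat C k * w) * expo s k)

  expo-cong : ∀ {s t} → s ≈ t → expo s ≗ expo t
  expo-cong e zero    = refl
  expo-cong e (suc k) = *-congˡ (*-cong (+-congʳ e) (expo-cong e k))

  expo-top : ∀ s k → p ≤ suc k → expo s (suc k) ≈ 0#
  expo-top s k p≤k = trans (*-congʳ (recip-top k p≤k)) (zeroˡ _)

  private
    -- The operator s + w T d/dT: the equation (1 - wT) y′ = s y of `expo s` reads y′ = D s y.
    D : Scalar → Seq → Seq
    D s f = scale s f ⊹ scale w (euler f)

    D-at : ∀ s f k → D s f k ≈ (s + nat C k * w) * f k
    D-at s f k = solve 4 (λ s w n x → s :* x :+ w :* (n :* x) := (s :+ n :* w) :* x) refl _ _ _ _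

  derivative-expo : ∀ s k → suc k < p → derivative (expo s) k ≈ D s (expo s) k
  derivative-expo s k k<p = begin
    nat C (suc k) * (recip k * y)   ≈⟨ sym (*-assoc _ _ _) ⟩
    nat C (suc k) * recip k * y     ≈⟨ *-congʳ (recip-inv k k<p) ⟩
    1# * y                        ≈⟨ *-identityˡ _ ⟩
    y                             ≈⟨ sym (D-at s (expo s) k) ⟩
    D s (expo s) k                ∎
    where y = (s + nat C k * w) * expo s k

  derivative-expo-top : ∀ s k → p ≤ suc k → derivative (expo s) k ≈ 0#
  derivative-expo-top s k p≤k = trans (*-congˡ (expo-top s k p≤k)) (zeroʳ _)

  private
    -- Since w T d/dT is a derivation, the sum on the left is D (s + t) applied to the product.
    D-⊛ : ∀ s t f g k →
          (D s f ⊛ g) k + (f ⊛ D t g) k ≈ (s + t + nat C k * w) * (f ⊛ g) k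
    D-⊛ s t f g k = begin
      (D s f ⊛ g) k + (f ⊛ D t g) k
        ≈⟨ +-cong (⊛-distribʳ (scale s f) (scale w (euler f)) g k)
                  (⊛-distribˡ f (scale t g) (scale w (euler g)) k) ⟩
      ((scale s f ⊛ g) k + (scale w (euler f) ⊛ g) k) + ((f ⊛ scale t g) k + (f ⊛ scale w (euler g)) k)
        ≈⟨ +-cong (+-cong (scale-⊛ s f g k) (scale-⊛ w (euler f) g k))
                  (+-cong (⊛-scale t f g k) (⊛-scale w f (euler g) k)) ⟩
      (s * (f ⊛ g) k + w * (euler f ⊛ g) k) + (t * (f ⊛ g) k + w * (f ⊛ euler g) k)
        ≈⟨ solve 6 (λ s t w h x y → (s :* h :+ w :* x) :+ (t :* h :+ w :* y) :=
                                     (s :+ t) :* h :+ w :* (x :+ y)) refl _ _ _ _ _ _ ⟩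
      (s + t) * (f ⊛ g) k + w * ((euler f ⊛ g) k + (f ⊛ euler g) k)
        ≈⟨ +-congˡ (*-congˡ (sym (euler-⊛ f g k))) ⟩
      (s + t) * (f ⊛ g) k + w * (nat C k * (f ⊛ g) k)
        ≈⟨ D-at (s + t) (f ⊛ g) k ⟩
      (s + t + nat C k * w) * (f ⊛ g) k
        ∎
      where
      ⊛-scale : ∀ c f g n → (f ⊛ scale c g) n ≈ c * (f ⊛ g) n
      ⊛-scale c f g n =
        trans (⊛-comm f (scale c g) n) (trans (scale-⊛ c g f n) (*-congˡ (⊛-comm g f n)))

  -- Both sides satisfy the differential equation (1 - wT) y′ = (s + t) y.
  expo-+ : ∀ s t k → k < p → (expo s ⊛ expo t) k ≈ expo (s + t) k
  expo-+ s t zero    _   = *-identityˡ _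
  expo-+ s t (suc k) k<p = begin
    h (suc k)                                 ≈⟨ *-identityˡ _ ⟨
    1# * h (suc k)                            ≈⟨ *-congʳ (trans (sym (recip-inv k k<p)) (*-comm _ _)) ⟩
    recip k * nat C (suc k) * h (suc k)         ≈⟨ *-assoc _ _ _ ⟩
    recip k * derivative h k                    ≈⟨ *-congˡ (derivative-⊛ (expo s) (expo t) k) ⟩
    recip k * ((derivative (expo s) ⊛ expo t) k + (expo s ⊛ derivative (expo t)) k)
      ≈⟨ *-congˡ (+-cong
           (⊛-cong≤ k (λ j j≤k → derivative-expo s j (ℕ.≤-<-trans (s≤s j≤k) k<p)) (λ _ _ → refl))
           (⊛-cong≤ k (λ _ _ → refl) (λ j j≤k → derivative-expo t j (ℕ.≤-<-trans (s≤s j≤k) k<p)))) ⟩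
    recip k * ((D s (expo s) ⊛ expo t) k + (expo s ⊛ D t (expo t)) k)
      ≈⟨ *-congˡ (D-⊛ s t (expo s) (expo t) k) ⟩
    recip k * ((s + t + nat C k * w) * h k)
      ≈⟨ *-congˡ (*-congˡ (expo-+ s t k (ℕ.<-trans (ℕ.n<1+n k) k<p))) ⟩
    expo (s + t) (suc k)                      ∎
    where h = expo s ⊛ expo t

  -- In degree p - 1 the derivative of a truncated series is 0 instead of the value prescribed by
  -- the differential equation. The two extra summands on the left restore the missing values, each
  -- multiplied by the constant term 1 of the other factor.
  expo-+-top : ∀ s t k → suc k ≡ p →
    nat C p * (expo s ⊛ expo t) p + ((s + nat C k * w) * expo s k + (t + nat C k * w) * expo t k)
      ≈ (s + t + nat C k * w) * expo (s + t) k
  expo-+-top s t k ≡.refl = begin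
    derivative h k + (x + y)
      ≈⟨ +-congʳ (derivative-⊛ (expo s) (expo t) k) ⟩
    ((derivative (expo s) ⊛ expo t) k + (expo s ⊛ derivative (expo t)) k) + (x + y)
      ≈⟨ solve 4 (λ u v x y → (u :+ v) :+ (x :+ y) := (u :+ x) :+ (v :+ y)) refl _ _ _ _ ⟩
    ((derivative (expo s) ⊛ expo t) k + x) + ((expo s ⊛ derivative (expo t)) k + y)
      ≈⟨ +-cong (last s t) (trans (+-congʳ (⊛-comm (expo s) (derivative (expo t)) k))
           (trans (last t s) (⊛-comm (D t (expo t)) (expo s) k))) ⟩
    (D s (expo s) ⊛ expo t) k + (expo s ⊛ D t (expo t)) k
      ≈⟨ D-⊛ s t (expo s) (expo t) k ⟩
    (s + t + nat C k * w) * h k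
      ≈⟨ *-congˡ (expo-+ s t k (ℕ.n<1+n k)) ⟩
    (s + t + nat C k * w) * expo (s + t) k
      ∎
    where
    h = expo s ⊛ expo t
    x = (s + nat C k * w) * expo s k
    y = (t + nat C k * w) * expo t k

    last : ∀ s t → (derivative (expo s) ⊛ expo t) k + (s + nat C k * w) * expo s k ≈
                   (D s (expo s) ⊛ expo t) k
    last s t = begin
      (derivative (expo s) ⊛ expo t) k + (s + nat C k * w) * expo s k
        ≈⟨ +-congˡ (trans (sym (D-at s (expo s) k)) (sym (*-identityʳ _))) ⟩
      (derivative (expo s) ⊛ expo t) k + D s (expo s) k * 1#
        ≈⟨ ⊛-last k (derivative (expo s)) (D s (expo s)) (expo t)
             (λ j j<k → derivative-expo s j (s≤s j<k)) ⟩
      (D s (expo s) ⊛ expo t) k + derivative (expo s) k * 1#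
        ≈⟨ +-congˡ (trans (*-identityʳ _) (derivative-expo-top s k ℕ.≤-refl)) ⟩
      (D s (expo s) ⊛ expo t) k + 0#
        ≈⟨ +-identityʳ _ ⟩
      (D s (expo s) ⊛ expo t) k
        ∎

  expo-0 : ∀ k → expo 0# (suc k) ≈ 0#
  expo-0 zero    = trans (*-congˡ (trans (*-congʳ (trans (+-identityˡ _) (zeroˡ _))) (zeroˡ _))) (zeroʳ _)
  expo-0 (suc k) = trans (*-congˡ (trans (*-congˡ (expo-0 k)) (zeroʳ _))) (zeroʳ _)

module _ {C : CommutativeRing a a} {D : CommutativeRing b b} (h : Hom C D) (p : ℕ)
         {i : TruncatedReciprocals p C} {i′ : TruncatedReciprocals p D}
         {w : CommutativeRing.Carrier C} {w′ : CommutativeRing.Carrier D} where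
  private
    module h = Hom h
    module i = TruncatedReciprocals i
    module i′ = TruncatedReciprocals i′
    open CommutativeRing D

  hom-expo : (∀ k → ⟦ h ⟧ (i.recip k) ≈ i′.recip k) → ⟦ h ⟧ w ≈ w′ →
             ∀ s k → ⟦ h ⟧ (Exponential.expo C p i w s k) ≈ Exponential.expo D p i′ w′ (⟦ h ⟧ s) k
  hom-expo ei ew s zero    = h.1#-homo
  hom-expo ei ew s (suc k) = trans (h.*-homo _ _) (*-cong (ei k) (trans (h.*-homo _ _) (*-cong
    (trans (h.+-homo _ _) (+-congˡ (trans (h.*-homo _ _) (*-cong (hom-nat h k) ew))))
    (hom-expo ei ew s k))))

-- The carry of Witt vector addition, up to the unit -(p-1)!.
module Carry (C : CommutativeRing a a) (p : ℕ) (1<p : 1 < p) (i : TruncatedReciprocals p C) where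
  open CommutativeRing C renaming (Carrier to Scalar)
  open TruncatedReciprocals i
  open PowerSeries C
  open Exponential C p i 0#
  open SetoidReasoning setoid
  open Exp commutativeSemiring
  private
    module Solver = NatCoefficients commutativeSemiring
  open Solver using (solve; _:=_; _:+_; _:*_)

  -- The truncation removes the pure powers, so this is the sum of sᵏ tᵖ⁻ᵏ / (k! (p-k)!) over 0 < k
  -- < p, that is ((s + t)ᵖ - sᵖ - tᵖ)/p! written without dividing by p.
  carry : Scalar → Scalar → Scalar
  carry s t = (expo s ⊛ expo t) p

  private
    expo-p : ∀ s → expo s p ≈ 0#
    expo-p s = at 1<p ℕ.≤-refl
      where
      at : ∀ {n} → 1 < n → p ≤ n → expo s n ≈ 0#
      at {suc n} _ p≤n = expo-top s n p≤n

    conv-p : ∀ f f′ g → (∀ k → k < p → f k ≈ f′ k) → f′ p ≈ 0# → g 0 ≈ 1# →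
             (f ⊛ g) p ≈ (f′ ⊛ g) p + f p
    conv-p f f′ g e z o = begin
      (f ⊛ g) p                  ≈⟨ +-identityʳ _ ⟨
      (f ⊛ g) p + 0#             ≈⟨ +-congˡ (trans (*-congʳ z) (zeroˡ _)) ⟨
      (f ⊛ g) p + f′ p * g 0     ≈⟨ ⊛-last p f f′ g e ⟩
      (f′ ⊛ g) p + f p * g 0     ≈⟨ +-congˡ (trans (*-congˡ o) (*-identityʳ _)) ⟩
      (f′ ⊛ g) p + f p           ∎

  carry-cong : ∀ {s s′ t t′} → s ≈ s′ → t ≈ t′ → carry s t ≈ carry s′ t′
  carry-cong e f = ⊛-cong (expo-cong e) (expo-cong f) p

  carry-comm : ∀ s t → carry s t ≈ carry t s
  carry-comm s t = ⊛-comm (expo s) (expo t) p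

  -- Associativity of the product of three exponential series, read off in degree p.
  carry-cocycle : ∀ s t u → carry s t + carry (s + t) u ≈ carry t u + carry s (t + u)
  carry-cocycle s t u = begin
    carry s t + carry (s + t) u
      ≈⟨ +-comm _ _ ⟩
    carry (s + t) u + carry s t
      ≈⟨ conv-p (expo s ⊛ expo t) (expo (s + t)) (expo u) (expo-+ s t) (expo-p (s + t)) refl ⟨
    ((expo s ⊛ expo t) ⊛ expo u) p
      ≈⟨ ⊛-assoc (expo s) (expo t) (expo u) p ⟩
    (expo s ⊛ (expo t ⊛ expo u)) p
      ≈⟨ ⊛-comm (expo s) (expo t ⊛ expo u) p ⟩
    ((expo t ⊛ expo u) ⊛ expo s) p
      ≈⟨ conv-p (expo t ⊛ expo u) (expo (t + u)) (expo s) (expo-+ t u) (expo-p (t + u)) refl ⟩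
    carry (t + u) s + carry t u
      ≈⟨ +-comm _ _ ⟩
    carry t u + carry (t + u) s
      ≈⟨ +-congˡ (carry-comm (t + u) s) ⟩
    carry t u + carry s (t + u)
      ∎

  carry-0 : ∀ t → carry 0# t ≈ 0#
  carry-0 t = trans (⊛-cong {g = expo t} expo-0-const (λ _ → refl) p) (trans (⊛-identityˡ (expo t) p) (expo-p t))
    where
    expo-0-const : expo 0# ≗ constˢ 1#
    expo-0-const zero    = refl
    expo-0-const (suc k) = expo-0 k

  private
    powers : Scalar → Seq → Seq
    powers s f k = s ^ k * f k

    powers-⊛ : ∀ s f g n → (powers s f ⊛ powers s g) n ≈ s ^ n * (f ⊛ g) n
    powers-⊛ s f g zero    = trans
      (solve 3 (λ o x y → (o :* x) :* (o :* y) := o :* (o :* (x :* y))) refl _ _ _) (*-identityˡ _)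
    powers-⊛ s f g (suc n) = begin
      1# * f 0 * (s * s ^ n * g (suc n)) + (tail (powers s f) ⊛ powers s g) n
        ≈⟨ +-cong (*-congʳ (*-identityˡ _))
             (⊛-cong {g = powers s g} (λ k → *-assoc s (s ^ k) (f (suc k))) (λ _ → refl) n) ⟩
      f 0 * (s * s ^ n * g (suc n)) + (scale s (powers s (tail f)) ⊛ powers s g) n
        ≈⟨ +-congˡ (trans (scale-⊛ s (powers s (tail f)) (powers s g) n)
                          (*-congˡ (powers-⊛ s (tail f) g n))) ⟩
      f 0 * (s * s ^ n * g (suc n)) + s * (s ^ n * (tail f ⊛ g) n)
        ≈⟨ solve 5 (λ x y s z u → x :* (s :* z :* y) :+ s :* (z :* u) := s :* z :* (x :* y :+ u))
             refl _ _ _ _ _ ⟩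
      s * s ^ n * (f 0 * g (suc n) + (tail f ⊛ g) n)
        ∎

    expo-scale : ∀ s t → expo (s * t) ≗ powers s (expo t)
    expo-scale s t zero    = sym (*-identityˡ _)
    expo-scale s t (suc k) = begin
      recip k * ((s * t + nat C k * 0#) * expo (s * t) k)
        ≈⟨ *-congˡ (*-cong (no-w (s * t)) (expo-scale s t k)) ⟩
      recip k * (s * t * (s ^ k * expo t k))
        ≈⟨ solve 5 (λ i s t z x → i :* (s :* t :* (z :* x)) := s :* z :* (i :* (t :* x))) refl _ _ _ _ _ ⟩
      s * s ^ k * (recip k * (t * expo t k))
        ≈⟨ *-congˡ (*-congˡ (*-congʳ (sym (no-w t)))) ⟩
      s * s ^ k * (recip k * ((t + nat C k * 0#) * expo t k))
        ∎
      where
      no-w : ∀ x → x + nat C k * 0# ≈ x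
      no-w x = trans (+-congˡ (zeroʳ _)) (+-identityʳ _)

  -- The series `expo (s * t)` is `expo t` with sT in place of T, so degree p acquires the factor
  -- sᵖ.
  carry-scale : ∀ s t u → carry (s * t) (s * u) ≈ s ^ p * carry t u
  carry-scale s t u =
    trans (⊛-cong (expo-scale s t) (expo-scale s u) p) (powers-⊛ s (expo t) (expo u) p)

  private
    fact : ℕ → Scalar
    fact zero    = 1#
    fact (suc k) = fact k * nat C (suc k)

    fact-expo : ∀ s k → k < p → fact k * expo s k ≈ s ^ k
    fact-expo s zero    _   = *-identityˡ _
    fact-expo s (suc k) k<p = begin
      fact k * nat C (suc k) * (recip k * ((s + nat C k * 0#) * expo s k))
        ≈⟨ *-congˡ (*-congˡ (*-congʳ (trans (+-congˡ (zeroʳ _)) (+-identityʳ _)))) ⟩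
      fact k * nat C (suc k) * (recip k * (s * expo s k))
        ≈⟨ solve 5 (λ m n i s x → m :* n :* (i :* (s :* x)) := n :* i :* (s :* (m :* x))) refl _ _ _ _ _ ⟩
      nat C (suc k) * recip k * (s * (fact k * expo s k))
        ≈⟨ *-cong (recip-inv k k<p) (*-congˡ (fact-expo s k (ℕ.<-trans (ℕ.n<1+n k) k<p))) ⟩
      1# * (s * s ^ k)
        ≈⟨ *-identityˡ _ ⟩
      s * s ^ k
        ∎

    fact-unit : ∀ k → k < p → IsUnit C (fact k)
    fact-unit zero    _   = 1# , *-identityˡ _
    fact-unit (suc k) k<p with m , e ← fact-unit k (ℕ.<-trans (ℕ.n<1+n k) k<p) =
      m * recip k , (begin
        fact k * nat C (suc k) * (m * recip k)
          ≈⟨ solve 4 (λ x y z u → x :* y :* (z :* u) := (x :* z) :* (y :* u)) refl _ _ _ _ ⟩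
        (fact k * m) * (nat C (suc k) * recip k)
          ≈⟨ *-cong e (recip-inv k k<p) ⟩
        1# * 1#
          ≈⟨ *-identityˡ _ ⟩
        1#
          ∎)

  -- This is (p-1)!, the factor between `carry` and the integral polynomial ((s + t)ᵖ - sᵖ - tᵖ)/p.
  ν : Scalar
  ν = fact (ℕ.pred p)

  ν-unit : IsUnit C ν
  ν-unit = fact-unit (ℕ.pred p) (below 1<p)
    where
    below : ∀ {n} → 1 < n → ℕ.pred n < n
    below {suc n} _ = ℕ.n<1+n n

  -- This is `expo-+-top` for w = 0, multiplied by (p-1)!: the coefficient of degree p - 1 of
  -- `expo s` becomes sᵖ⁻¹. The error term is explicit, which matters in rings where p is a zero
  -- divisor.
  freshman : ∀ s t → (s + t) ^ p ≈ s ^ p + t ^ p + nat C p * (ν * carry s t)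
  freshman s t = sym (at 1<p ≡.refl)
    where
    at : ∀ {n} → 1 < n → n ≡ p → s ^ n + t ^ n + nat C n * (fact (ℕ.pred n) * carry s t) ≈ (s + t) ^ n
    at {suc k} _ ≡.refl = begin
      s * s ^ k + t * t ^ k + nat C p * (m * carry s t)
        ≈⟨ +-congʳ (+-cong (*-congˡ (sym (fact-expo s k k<p))) (*-congˡ (sym (fact-expo t k k<p)))) ⟩
      s * (m * expo s k) + t * (m * expo t k) + nat C p * (m * carry s t)
        ≈⟨ solve 7 (λ m s t x y n c → s :* (m :* x) :+ t :* (m :* y) :+ n :* (m :* c) :=
                                       m :* (n :* c :+ (s :* x :+ t :* y))) refl _ _ _ _ _ _ _ ⟩
      m * (nat C p * carry s t + (s * expo s k + t * expo t k))
        ≈⟨ *-congˡ (+-congˡ (+-cong (*-congʳ (no-w s)) (*-congʳ (no-w t)))) ⟨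
      m * (nat C p * carry s t + ((s + nat C k * 0#) * expo s k + (t + nat C k * 0#) * expo t k))
        ≈⟨ *-congˡ (expo-+-top s t k ≡.refl) ⟩
      m * ((s + t + nat C k * 0#) * expo (s + t) k)
        ≈⟨ *-congˡ (*-congʳ (no-w (s + t))) ⟩
      m * ((s + t) * expo (s + t) k)
        ≈⟨ solve 3 (λ m s x → m :* (s :* x) := s :* (m :* x)) refl _ _ _ ⟩
      (s + t) * (m * expo (s + t) k)
        ≈⟨ *-congˡ (fact-expo (s + t) k k<p) ⟩
      (s + t) * (s + t) ^ k
        ∎
      where
      m = fact k
      k<p = ℕ.n<1+n k
      no-w : ∀ x → x + nat C k * 0# ≈ x
      no-w x = trans (+-congˡ (zeroʳ _)) (+-identityʳ _)

-- Witt vectors of length 2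

hom-^ : {R : CommutativeRing a a} {S : CommutativeRing b b} (h : Hom R S) → ∀ x n →
        CommutativeRing._≈_ S (⟦ h ⟧ (Exp._^_ (CommutativeRing.commutativeSemiring R) x n))
                              (Exp._^_ (CommutativeRing.commutativeSemiring S) (⟦ h ⟧ x) n)
hom-^ h x zero    = Hom.1#-homo h
hom-^ {S = S} h x (suc n) = trans (Hom.*-homo h _ _) (*-congˡ (hom-^ h x n))
  where open CommutativeRing S

cast-unit : {R : CommutativeRing a a} → let open CommutativeRing R in
            ∀ {r s} → r ≈ s → IsUnit R r → IsUnit R s
cast-unit {R = R} e (t , rt≈1) = t , trans (*-congʳ (sym e)) rt≈1
  where open CommutativeRing R

-- The Witt vectors of length 2 over a ring of characteristic p, with the second component rescaled.
module WittVectors₂ (p : ℕ) (1<p : 1 < p) (C : CommutativeRing a a)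
                    (p≈0 : CommutativeRing._≈_ C (nat C p) (CommutativeRing.0# C))
                    (i : TruncatedReciprocals p C) where
  open CommutativeRing C renaming (Carrier to Scalar)
  open Carry C p 1<p i
  open Exp commutativeSemiring
  open SetoidReasoning setoid
  private
    module Solver = NatCoefficients commutativeSemiring
  open Solver using (solve; _:=_; _:+_; _:*_)

  frobenius-+ : ∀ s t → (s + t) ^ p ≈ s ^ p + t ^ p
  frobenius-+ s t = trans (freshman s t)
    (trans (+-congˡ (trans (*-congʳ p≈0) (zeroˡ _))) (+-identityʳ _))

  private
    0^ : ∀ {n} → 1 < n → 0# ^ n ≈ 0#
    0^ {suc n} _ = zeroˡ _

    1^ : ∀ n → 1# ^ n ≈ 1#
    1^ zero    = refl
    1^ (suc n) = trans (*-identityˡ _) (1^ n)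

  Witt : Set a
  Witt = Scalar × Scalar

  infixl 6 _+ʷ_
  infixl 7 _*ʷ_
  -- The usual sum has - ν · carry in its second component. Dividing second components by - ν turns
  -- this into + carry and leaves the product formula unchanged; the usual term p s₁ t₁ is zero in
  -- characteristic p.
  _+ʷ_ _*ʷ_ : Witt → Witt → Witt
  (s₀ , s₁) +ʷ (t₀ , t₁) = s₀ + t₀ , s₁ + t₁ + carry s₀ t₀
  (s₀ , s₁) *ʷ (t₀ , t₁) = s₀ * t₀ , s₀ ^ p * t₁ + t₀ ^ p * s₁

  private
    infix 4 _≈ʷ_
    _≈ʷ_ : Witt → Witt → Set a
    (s₀ , s₁) ≈ʷ (t₀ , t₁) = s₀ ≈ t₀ × s₁ ≈ t₁

    negate : Witt → Witt
    negate (s₀ , s₁) = - s₀ , - (s₁ + carry (- s₀) s₀)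

    +ʷ-assoc : ∀ s t u → (s +ʷ t) +ʷ u ≈ʷ s +ʷ (t +ʷ u)
    +ʷ-assoc (s₀ , s₁) (t₀ , t₁) (u₀ , u₁) = +-assoc _ _ _ , (begin
      s₁ + t₁ + carry s₀ t₀ + u₁ + carry (s₀ + t₀) u₀
        ≈⟨ solve 5 (λ s t c u d → s :+ t :+ c :+ u :+ d := s :+ t :+ u :+ (c :+ d)) refl _ _ _ _ _ ⟩
      s₁ + t₁ + u₁ + (carry s₀ t₀ + carry (s₀ + t₀) u₀)
        ≈⟨ +-congˡ (carry-cocycle s₀ t₀ u₀) ⟩
      s₁ + t₁ + u₁ + (carry t₀ u₀ + carry s₀ (t₀ + u₀))
        ≈⟨ solve 5 (λ s t u c d → s :+ t :+ u :+ (c :+ d) := s :+ (t :+ u :+ c) :+ d) refl _ _ _ _ _ ⟩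
      s₁ + (t₁ + u₁ + carry t₀ u₀) + carry s₀ (t₀ + u₀)
        ∎)

    +ʷ-comm : ∀ s t → s +ʷ t ≈ʷ t +ʷ s
    +ʷ-comm (s₀ , s₁) (t₀ , t₁) = +-comm _ _ , +-cong (+-comm _ _) (carry-comm _ _)

    +ʷ-identityˡ : ∀ s → (0# , 0#) +ʷ s ≈ʷ s
    +ʷ-identityˡ (s₀ , s₁) =
      +-identityˡ _ , trans (+-cong (+-identityˡ _) (carry-0 _)) (+-identityʳ _)

    +ʷ-inverseˡ : ∀ s → negate s +ʷ s ≈ʷ (0# , 0#)
    +ʷ-inverseˡ (s₀ , s₁) = -‿inverseˡ _ , trans (+-assoc _ _ _) (-‿inverseˡ _)

    *ʷ-assoc : ∀ s t u → (s *ʷ t) *ʷ u ≈ʷ s *ʷ (t *ʷ u)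
    *ʷ-assoc (s₀ , s₁) (t₀ , t₁) (u₀ , u₁) = *-assoc _ _ _ , (begin
      (s₀ * t₀) ^ p * u₁ + u₀ ^ p * (s₀ ^ p * t₁ + t₀ ^ p * s₁)
        ≈⟨ +-congʳ (*-congʳ (^-distrib-* s₀ t₀ p)) ⟩
      s₀ ^ p * t₀ ^ p * u₁ + u₀ ^ p * (s₀ ^ p * t₁ + t₀ ^ p * s₁)
        ≈⟨ solve 6 (λ x y z s t u → x :* y :* u :+ z :* (x :* t :+ y :* s) :=
                                     x :* (y :* u :+ z :* t) :+ y :* z :* s) refl _ _ _ _ _ _ ⟩
      s₀ ^ p * (t₀ ^ p * u₁ + u₀ ^ p * t₁) + t₀ ^ p * u₀ ^ p * s₁
        ≈⟨ +-congˡ (*-congʳ (sym (^-distrib-* t₀ u₀ p))) ⟩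
      s₀ ^ p * (t₀ ^ p * u₁ + u₀ ^ p * t₁) + (t₀ * u₀) ^ p * s₁
        ∎)

    *ʷ-comm : ∀ s t → s *ʷ t ≈ʷ t *ʷ s
    *ʷ-comm s t = *-comm _ _ , +-comm _ _

    *ʷ-identityˡ : ∀ s → (1# , 0#) *ʷ s ≈ʷ s
    *ʷ-identityˡ (s₀ , s₁) = *-identityˡ _ ,
      trans (+-cong (trans (*-congʳ (1^ p)) (*-identityˡ _)) (zeroʳ _)) (+-identityʳ _)

    distribʷ : ∀ s t u → s *ʷ (t +ʷ u) ≈ʷ s *ʷ t +ʷ s *ʷ u
    distribʷ (s₀ , s₁) (t₀ , t₁) (u₀ , u₁) = distribˡ _ _ _ , (begin
      s₀ ^ p * (t₁ + u₁ + carry t₀ u₀) + (t₀ + u₀) ^ p * s₁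
        ≈⟨ +-congˡ (*-congʳ (frobenius-+ t₀ u₀)) ⟩
      s₀ ^ p * (t₁ + u₁ + carry t₀ u₀) + (t₀ ^ p + u₀ ^ p) * s₁
        ≈⟨ solve 7 (λ x y z s t u c → x :* (t :+ u :+ c) :+ (y :+ z) :* s :=
                                       (x :* t :+ y :* s) :+ (x :* u :+ z :* s) :+ x :* c)
             refl _ _ _ _ _ _ _ ⟩
      (s₀ ^ p * t₁ + t₀ ^ p * s₁) + (s₀ ^ p * u₁ + u₀ ^ p * s₁) + s₀ ^ p * carry t₀ u₀
        ≈⟨ +-congˡ (sym (carry-scale s₀ t₀ u₀)) ⟩
      (s₀ ^ p * t₁ + t₀ ^ p * s₁) + (s₀ ^ p * u₁ + u₀ ^ p * s₁) + carry (s₀ * t₀) (s₀ * u₀)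
        ∎)

    +ʷ-cong : ∀ {s s′ t t′} → s ≈ʷ s′ → t ≈ʷ t′ → s +ʷ t ≈ʷ s′ +ʷ t′
    +ʷ-cong (e₀ , e₁) (f₀ , f₁) = +-cong e₀ f₀ , +-cong (+-cong e₁ f₁) (carry-cong e₀ f₀)

    *ʷ-cong : ∀ {s s′ t t′} → s ≈ʷ s′ → t ≈ʷ t′ → s *ʷ t ≈ʷ s′ *ʷ t′
    *ʷ-cong (e₀ , e₁) (f₀ , f₁) =
      *-cong e₀ f₀ , +-cong (*-cong (^-congˡ p e₀) f₁) (*-cong (^-congˡ p f₀) e₁)

    transʷ : ∀ {s t u} → s ≈ʷ t → t ≈ʷ u → s ≈ʷ u
    transʷ (e₀ , e₁) (f₀ , f₁) = trans e₀ f₀ , trans e₁ f₁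

  witt : CommutativeRing a a
  witt .CommutativeRing.Carrier = Witt
  witt .CommutativeRing._≈_     = _≈ʷ_
  witt .CommutativeRing._+_     = _+ʷ_
  witt .CommutativeRing._*_     = _*ʷ_
  witt .CommutativeRing.-_      = negate
  witt .CommutativeRing.0#      = 0# , 0#
  witt .CommutativeRing.1#      = 1# , 0#
  witt .CommutativeRing.isCommutativeRing = record
    { isRing = record
      { +-isAbelianGroup = record
        { isGroup = record
          { isMonoid = record
            { isSemigroup = record
              { isMagma = record
                { isEquivalence = record
                  { refl = refl , refl ; sym = λ (e , f) → sym e , sym f ; trans = transʷ }
                ; ∙-cong = +ʷ-cong
                }
              ; assoc = +ʷ-assoc
              }
            ; identity = +ʷ-identityˡ , λ s → transʷ (+ʷ-comm s (0# , 0#)) (+ʷ-identityˡ s)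
            }
          ; inverse = +ʷ-inverseˡ , λ s → transʷ (+ʷ-comm s (negate s)) (+ʷ-inverseˡ s)
          ; ⁻¹-cong = λ (e , f) → -‿cong e , -‿cong (+-cong f (carry-cong (-‿cong e) e))
          }
        ; comm = +ʷ-comm
        }
      ; *-cong = *ʷ-cong
      ; *-assoc = *ʷ-assoc
      ; *-identity = *ʷ-identityˡ , λ s → transʷ (*ʷ-comm s (1# , 0#)) (*ʷ-identityˡ s)
      ; distrib = distribʷ , λ s t u → transʷ (*ʷ-comm (t +ʷ u) s)
          (transʷ (distribʷ s t u) (+ʷ-cong (*ʷ-comm s t) (*ʷ-comm s u)))
      }
    ; *-comm = *ʷ-comm
    }

  firstComponent : Hom witt C
  firstComponent = mkHom witt C proj₁ proj₁ (λ _ _ → refl) (λ _ _ → refl) refl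

  -- Both summands contain the p-th power of a first component, and p > 1. Hence `firstComponent` is
  -- an extension to which formal smoothness applies.
  kernel-square-zero : ∀ s t → proj₁ s ≈ 0# → proj₁ t ≈ 0# → s *ʷ t ≈ʷ (0# , 0#)
  kernel-square-zero s t s₀≈0 t₀≈0 = trans (*-congʳ s₀≈0) (zeroˡ _) ,
    trans (+-cong (vanish s₀≈0) (vanish t₀≈0)) (+-identityʳ _)
    where
    vanish : ∀ {x y} → x ≈ 0# → x ^ p * y ≈ 0#
    vanish e = trans (*-congʳ (trans (^-congˡ p e) (0^ 1<p))) (zeroˡ _)

module _ {C : CommutativeRing a a} {D : CommutativeRing b b} (h : Hom C D)
         (p : ℕ) (1<p : 1 < p) (i : TruncatedReciprocals p C) where
  private
    module C = CommutativeRing C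
    module D = CommutativeRing D

  hom-carry : ∀ s t → ⟦ h ⟧ (Carry.carry C p 1<p i s t) D.≈
                      Carry.carry D p 1<p (mapReciprocals h i) (⟦ h ⟧ s) (⟦ h ⟧ t)
  hom-carry s t = D.trans (hom-⊛ h (expo s) (expo t) p) (PowerSeries.⊛-cong D (natural s) (natural t) p)
    where
    open Exponential C p i C.0# using (expo)
    natural = hom-expo h p {i} {mapReciprocals h i} (λ _ → D.refl) (Hom.0#-homo h)

Cancellable : (R : CommutativeRing a a) → CommutativeRing.Carrier R → Set a
Cancellable R q = ∀ {r s} → q * r ≈ q * s → r ≈ s
  where open CommutativeRing R

module FrobeniusQuotient (p : ℕ) (1<p : 1 < p) {R : CommutativeRing ℓ ℓ}
                         (p-cancel : Cancellable R (nat R p))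
                         (i : TruncatedReciprocals p R) (Φ : FrobeniusLift p R) where
  open CommutativeRing R
  open FrobeniusLift Φ
  open Carry R p 1<p i
  open Exp commutativeSemiring
  open SetoidReasoning setoid
  open AbelianGroupProperties +-abelianGroup using (∙-cancelˡ)
  private
    module φ = Hom φ
    module Solver = NatCoefficients commutativeSemiring
    π = nat R p
  open Solver using (solve; _:=_; _:+_; _:*_)

  -- The p-derivation of the Frobenius lift, often written δ: φ r = rᵖ + p θ r. It is the witness of
  -- the congruence for φ, and is determined by it because p cancels in R.
  θ : Carrier → Carrier
  θ r = proj₁ (frobenius r)

  φ≈ : ∀ r → ⟦ φ ⟧ r ≈ r ^ p + π * θ r
  φ≈ r = proj₂ (frobenius r)

  θ-unique : ∀ {r t} → ⟦ φ ⟧ r ≈ r ^ p + π * t → θ r ≈ t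
  θ-unique {r} e = p-cancel (∙-cancelˡ (r ^ p) _ _ (trans (sym (φ≈ r)) e))

  θ-cong : ∀ {r s} → r ≈ s → θ r ≈ θ s
  θ-cong e = θ-unique (trans (φ.⟦⟧-cong e) (trans (φ≈ _) (+-congʳ (^-congˡ p (sym e)))))

  θ-+ : ∀ r s → θ (r + s) + ν * carry r s ≈ θ r + θ s
  θ-+ r s = p-cancel (∙-cancelˡ (r ^ p + s ^ p) _ _ (begin
    r ^ p + s ^ p + π * (θ (r + s) + ν * carry r s)
      ≈⟨ solve 4 (λ x n t c → x :+ n :* (t :+ c) := x :+ n :* c :+ n :* t) refl _ _ _ _ ⟩
    r ^ p + s ^ p + π * (ν * carry r s) + π * θ (r + s)
      ≈⟨ +-congʳ (sym (freshman r s)) ⟩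
    (r + s) ^ p + π * θ (r + s)
      ≈⟨ sym (φ≈ (r + s)) ⟩
    ⟦ φ ⟧ (r + s)
      ≈⟨ φ.+-homo r s ⟩
    ⟦ φ ⟧ r + ⟦ φ ⟧ s
      ≈⟨ +-cong (φ≈ r) (φ≈ s) ⟩
    (r ^ p + π * θ r) + (s ^ p + π * θ s)
      ≈⟨ solve 5 (λ x y n s t → (x :+ n :* s) :+ (y :+ n :* t) := x :+ y :+ n :* (s :+ t))
           refl _ _ _ _ _ ⟩
    r ^ p + s ^ p + π * (θ r + θ s)
      ∎))

  θ-* : ∀ r s → θ (r * s) ≈ r ^ p * θ s + s ^ p * θ r + π * (θ r * θ s)
  θ-* r s = θ-unique (begin
    ⟦ φ ⟧ (r * s)
      ≈⟨ φ.*-homo r s ⟩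
    ⟦ φ ⟧ r * ⟦ φ ⟧ s
      ≈⟨ *-cong (φ≈ r) (φ≈ s) ⟩
    (r ^ p + π * θ r) * (s ^ p + π * θ s)
      ≈⟨ solve 5 (λ x y n s t → (x :+ n :* s) :* (y :+ n :* t) :=
                                 x :* y :+ n :* (x :* t :+ y :* s :+ n :* (s :* t)))
           refl _ _ _ _ _ ⟩
    r ^ p * s ^ p + π * (r ^ p * θ s + s ^ p * θ r + π * (θ r * θ s))
      ≈⟨ +-congʳ (sym (^-distrib-* r s p)) ⟩
    (r * s) ^ p + π * (r ^ p * θ s + s ^ p * θ r + π * (θ r * θ s))
      ∎)

  private
    1^ : ∀ n → 1# ^ n ≈ 1#
    1^ zero    = refl
    1^ (suc n) = trans (*-identityˡ _) (1^ n)

  θ-1 : θ 1# ≈ 0#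
  θ-1 = θ-unique (trans φ.1#-homo (sym (trans (+-cong (1^ p) (zeroʳ _)) (+-identityʳ _))))

  -- Ring endomorphisms fix the integer p, so p = pᵖ + p θ(p). In particular θ(p) is 1 modulo p,
  -- which is why p survives in the Witt vectors.
  θ-p : θ π + π ^ ℕ.pred p ≈ 1#
  θ-p = p-cancel (begin
    π * (θ π + π ^ ℕ.pred p)            ≈⟨ distribˡ _ _ _ ⟩
    π * θ π + π * π ^ ℕ.pred p          ≈⟨ +-comm _ _ ⟩
    π * π ^ ℕ.pred p + π * θ π          ≈⟨ +-congʳ (reflexive (at 1<p)) ⟩
    π ^ p + π * θ π                     ≈⟨ φ≈ π ⟨
    ⟦ φ ⟧ π                             ≈⟨ hom-nat φ p ⟩
    π                                   ≈⟨ *-identityʳ _ ⟨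
    π * 1#                              ∎)
    where
    at : ∀ {n} → 1 < n → π * π ^ ℕ.pred n ≡ π ^ n
    at {suc n} _ = ≡.refl

module WittStructure (p : ℕ) (1<p : 1 < p) {R : CommutativeRing ℓ ℓ}
                     (p-cancel : Cancellable R (nat R p))
                     (i : TruncatedReciprocals p R) (Φ : FrobeniusLift p R)
                     {C : CommutativeRing ℓ ℓ} (κ : Hom R C)
                     (p≈0 : CommutativeRing._≈_ C (nat C p) (CommutativeRing.0# C)) where
  open CommutativeRing C
  open WittVectors₂ p 1<p C p≈0 (mapReciprocals κ i)
  open FrobeniusQuotient p 1<p p-cancel i Φ
  open Exp commutativeSemiring
  open SetoidReasoning setoid
  open RingProperties (CommutativeRing.ring C) using (-‿distribʳ-*; -‿+-comm; -0#≈0#)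
  private
    module R = CommutativeRing R
    module RE = Exp R.commutativeSemiring
    module κ = Hom κ
    module RC = Carry R p 1<p i
    module CC = Carry C p 1<p (mapReciprocals κ i)
    module RSolver = NatCoefficients R.commutativeSemiring

    π = nat R p
    μ = proj₁ RC.ν-unit

    κπ≈0 : ⟦ κ ⟧ π ≈ 0#
    κπ≈0 = trans (hom-nat κ p) p≈0

  -- A p-derivation yields the homomorphism r ↦ (r, θ r) to the usual Witt vectors; the factor - μ =
  -- - 1/ν is the rescaling of second components.
  second : R.Carrier → Carrier
  second r = - ⟦ κ ⟧ (μ R.* θ r)

  private
    second-+ : ∀ r s → second (r R.+ s) ≈ second r + second s + CC.carry (⟦ κ ⟧ r) (⟦ κ ⟧ s)
    second-+ r s = sym (begin
      second r + second s + CC.carry (⟦ κ ⟧ r) (⟦ κ ⟧ s)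
        ≈⟨ +-cong (-‿+-comm _ _) (sym (hom-carry κ p 1<p i r s)) ⟩
      - (⟦ κ ⟧ (μ R.* θ r) + ⟦ κ ⟧ (μ R.* θ s)) + ⟦ κ ⟧ c
        ≈⟨ +-congʳ (-‿cong (sym (κ.+-homo _ _))) ⟩
      - ⟦ κ ⟧ (μ R.* θ r R.+ μ R.* θ s) + ⟦ κ ⟧ c
        ≈⟨ +-congʳ (-‿cong (κ.⟦⟧-cong (R.trans (R.sym (R.distribˡ _ _ _))
             (R.trans (R.*-congˡ (R.sym (θ-+ r s))) distribute)))) ⟩
      - ⟦ κ ⟧ (μ R.* θ (r R.+ s) R.+ c) + ⟦ κ ⟧ c
        ≈⟨ +-congʳ (trans (-‿cong (κ.+-homo _ _)) (sym (-‿+-comm _ _))) ⟩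
      second (r R.+ s) + - ⟦ κ ⟧ c + ⟦ κ ⟧ c
        ≈⟨ trans (+-assoc _ _ _) (trans (+-congˡ (-‿inverseˡ _)) (+-identityʳ _)) ⟩
      second (r R.+ s)
        ∎)
      where
      c = RC.carry r s
      open RSolver using (solve; _:=_; _:+_; _:*_)
      distribute : μ R.* (θ (r R.+ s) R.+ RC.ν R.* c) R.≈ μ R.* θ (r R.+ s) R.+ c
      distribute = R.trans
        (solve 4 (λ m t n c → m :* (t :+ n :* c) := m :* t :+ n :* m :* c) R.refl _ _ _ _)
        (R.+-congˡ (R.trans (R.*-congʳ (proj₂ RC.ν-unit)) (R.*-identityˡ _)))

    second-* : ∀ r s → second (r R.* s) ≈ ⟦ κ ⟧ r ^ p * second s + ⟦ κ ⟧ s ^ p * second r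
    second-* r s = begin
      - ⟦ κ ⟧ (μ R.* θ (r R.* s))
        ≈⟨ -‿cong (κ.⟦⟧-cong (R.trans (R.*-congˡ (θ-* r s)) (rearrange _ _ _ _ _))) ⟩
      - ⟦ κ ⟧ (r RE.^ p R.* (μ R.* θ s) R.+ s RE.^ p R.* (μ R.* θ r) R.+ π R.* (μ R.* (θ r R.* θ s)))
        ≈⟨ -‿cong (κ.+-homo _ _) ⟩
      - (⟦ κ ⟧ (r RE.^ p R.* (μ R.* θ s) R.+ s RE.^ p R.* (μ R.* θ r)) + ⟦ κ ⟧ (π R.* (μ R.* (θ r R.* θ s))))
        ≈⟨ -‿cong (trans (+-congˡ (trans (κ.*-homo _ _) (trans (*-congʳ κπ≈0) (zeroˡ _)))) (+-identityʳ _)) ⟩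
      - ⟦ κ ⟧ (r RE.^ p R.* (μ R.* θ s) R.+ s RE.^ p R.* (μ R.* θ r))
        ≈⟨ trans (-‿cong (κ.+-homo _ _)) (sym (-‿+-comm _ _)) ⟩
      - ⟦ κ ⟧ (r RE.^ p R.* (μ R.* θ s)) + - ⟦ κ ⟧ (s RE.^ p R.* (μ R.* θ r))
        ≈⟨ +-cong (term r s) (term s r) ⟩
      ⟦ κ ⟧ r ^ p * second s + ⟦ κ ⟧ s ^ p * second r
        ∎
      where
      open RSolver using (solve; _:=_; _:+_; _:*_)
      rearrange : ∀ x y t u n →
        μ R.* (x R.* t R.+ y R.* u R.+ n R.* (u R.* t)) R.≈
        x R.* (μ R.* t) R.+ y R.* (μ R.* u) R.+ n R.* (μ R.* (u R.* t))
      rearrange x y t u n =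
        solve 6 (λ m x y t u n → m :* (x :* t :+ y :* u :+ n :* (u :* t)) :=
          x :* (m :* t) :+ y :* (m :* u) :+ n :* (m :* (u :* t))) R.refl μ x y t u n

      term : ∀ r s → - ⟦ κ ⟧ (r RE.^ p R.* (μ R.* θ s)) ≈ ⟦ κ ⟧ r ^ p * second s
      term r s = trans (-‿cong (trans (κ.*-homo _ _) (*-congʳ (hom-^ κ r p)))) (-‿distribʳ-* _ _)

  structure : Hom R witt
  structure = mkHom R witt (λ r → ⟦ κ ⟧ r , second r)
    (λ e → κ.⟦⟧-cong e , -‿cong (κ.⟦⟧-cong (R.*-congˡ (θ-cong e))))
    (λ r s → κ.+-homo r s , second-+ r s)
    (λ r s → κ.*-homo r s , second-* r s)
    (κ.1#-homo , trans (-‿cong (trans (κ.⟦⟧-cong (R.trans (R.*-congˡ θ-1) (R.zeroʳ _))) κ.0#-homo)) -0#≈0#)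

  -- p is sent to (0, -1/(p-1)!).
  structure-p≈0⇒trivial : CommutativeRing._≈_ witt (⟦ structure ⟧ π) (CommutativeRing.0# witt) → 1# ≈ 0#
  structure-p≈0⇒trivial (_ , e) = begin
    1#                              ≈⟨ κ.1#-homo ⟨
    ⟦ κ ⟧ R.1#                      ≈⟨ κ.⟦⟧-cong (proj₂ RC.ν-unit) ⟨
    ⟦ κ ⟧ (RC.ν R.* μ)              ≈⟨ κ.*-homo _ _ ⟩
    ⟦ κ ⟧ RC.ν * ⟦ κ ⟧ μ            ≈⟨ *-congˡ κμ≈0 ⟩
    ⟦ κ ⟧ RC.ν * 0#                 ≈⟨ zeroʳ _ ⟩
    0#                              ∎
    where
    open RingProperties (CommutativeRing.ring C) using (-‿involutive)

    κπ^ : ∀ {n} → 1 < n → ⟦ κ ⟧ (π RE.^ ℕ.pred n) ≈ 0#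
    κπ^ {suc (suc n)} _ = trans (κ.*-homo _ _) (trans (*-congʳ κπ≈0) (zeroˡ _))
    κπ^ {suc zero} (s≤s ())

    κθ≈1 : ⟦ κ ⟧ (θ π) ≈ 1#
    κθ≈1 = begin
      ⟦ κ ⟧ (θ π)                                 ≈⟨ +-identityʳ _ ⟨
      ⟦ κ ⟧ (θ π) + 0#                            ≈⟨ +-congˡ (sym (κπ^ 1<p)) ⟩
      ⟦ κ ⟧ (θ π) + ⟦ κ ⟧ (π RE.^ ℕ.pred p)       ≈⟨ κ.+-homo _ _ ⟨
      ⟦ κ ⟧ (θ π R.+ π RE.^ ℕ.pred p)             ≈⟨ κ.⟦⟧-cong θ-p ⟩
      ⟦ κ ⟧ R.1#                                  ≈⟨ κ.1#-homo ⟩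
      1#                                          ∎

    κμ≈0 : ⟦ κ ⟧ μ ≈ 0#
    κμ≈0 = begin
      ⟦ κ ⟧ μ                      ≈⟨ *-identityʳ _ ⟨
      ⟦ κ ⟧ μ * 1#                 ≈⟨ *-congˡ κθ≈1 ⟨
      ⟦ κ ⟧ μ * ⟦ κ ⟧ (θ π)        ≈⟨ κ.*-homo _ _ ⟨
      ⟦ κ ⟧ (μ R.* θ π)            ≈⟨ -‿involutive _ ⟨
      - second π                   ≈⟨ -‿cong e ⟩
      - 0#                         ≈⟨ -0#≈0# ⟩
      0#                           ∎

-- The prime p in a smooth algebra modulo p²

hom-unit : {R : CommutativeRing a a} {S : CommutativeRing b b} (h : Hom R S) →
           ∀ {r} → IsUnit R r → IsUnit S (⟦ h ⟧ r)
hom-unit {S = S} h (s , rs≈1) =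
  ⟦ h ⟧ s , trans (sym (h.*-homo _ _)) (trans (h.⟦⟧-cong rs≈1) h.1#-homo)
  where
  module h = Hom h
  open CommutativeRing S

nat-vanishes-via : {R : CommutativeRing a a} {S : CommutativeRing b b} (h : Hom R S) →
  let module R = CommutativeRing R
      module S = CommutativeRing S in
  ∀ n r → nat S n S.* nat S n S.≈ S.0# → nat R n R.≈ nat R n R.* nat R n R.* r → nat S n S.≈ S.0#
nat-vanishes-via {R = R} {S} h n r n²≈0 e = begin
  nat S n                                   ≈⟨ hom-nat h n ⟨
  ⟦ h ⟧ (nat R n)                           ≈⟨ h.⟦⟧-cong e ⟩
  ⟦ h ⟧ (nat R n R.* nat R n R.* r)         ≈⟨ h.*-homo _ _ ⟩
  ⟦ h ⟧ (nat R n R.* nat R n) * ⟦ h ⟧ r     ≈⟨ *-congʳ (h.*-homo _ _) ⟩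
  ⟦ h ⟧ (nat R n) * ⟦ h ⟧ (nat R n) * ⟦ h ⟧ r
    ≈⟨ *-congʳ (trans (*-cong (hom-nat h n) (hom-nat h n)) n²≈0) ⟩
  0# * ⟦ h ⟧ r                              ≈⟨ zeroˡ _ ⟩
  0#                                        ∎
  where
  module R = CommutativeRing R
  module h = Hom h
  open CommutativeRing S
  open SetoidReasoning setoid

module _ (A : CommutativeRing ℓ ℓ) (f : CommutativeRing.Carrier A) where
  private
    module A = CommutativeRing A
    module P = Presentation A ⊤ (InverseOf f A.1#)

  localization-unit : IsUnit (ring (localization A f)) (⟦ ι (localization A f) ⟧ f)
  localization-unit = var tt , P.rel inverse

  module _ {S : CommutativeRing ℓ ℓ} (h : Hom A S) (u : IsUnit S (⟦ h ⟧ f)) where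

    extendToLocalization : Hom (ring (localization A f)) S
    extendToLocalization = P.evalHom S h (λ _ → proj₁ u)
      (λ { inverse → CommutativeRing.trans S (proj₂ u) (CommutativeRing.sym S (Hom.1#-homo h)) })

module _ {R : CommutativeRing ℓ ℓ} {B C : Algebra R ℓ} (q : AlgHom B C) (ext : IsSquareZeroExtension q) where
  private
    module B = Algebra B
    module C = Algebra C
    module q = AlgHomOver q
    module Solver = NatCoefficients B.commutativeSemiring
  open IsSquareZeroExtension ext
  open RingProperties (CommutativeRing.ring (ring B)) using (-‿distribʳ-*; -0#≈0#)
  open SetoidReasoning B.setoid
  open Solver using (solve; _:=_; _:+_; _:*_)

  -- If s′ lifts the inverse, then x s′ = 1 + n with n² = 0, and 1 - n inverts 1 + n. It is applied
  -- to f, so that a lift of O(G) to the Witt vectors extends to O(G)[1/f].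
  lift-unit : ∀ x → IsUnit (ring C) (q $ₐ x) → IsUnit (ring B) x
  lift-unit x (s , qx·s≈1) with s′ , qs′≈s ← surjective s = s′ B.* (B.1# B.- n) , (begin
    x B.* (s′ B.* (B.1# B.- n))                     ≈⟨ B.*-assoc _ _ _ ⟨
    x B.* s′ B.* (B.1# B.- n)                       ≈⟨ B.*-congʳ z≈1+n ⟩
    (B.1# B.+ n) B.* (B.1# B.- n)                   ≈⟨ expand (B.1#) n (B.- n) ⟩
    B.1# B.* B.1# B.+ (B.1# B.* (n B.- n) B.+ n B.* (B.- n))
      ≈⟨ B.+-cong (B.*-identityˡ _) (B.+-cong (B.trans (B.*-identityˡ _) (B.-‿inverseʳ _)) nn≈0) ⟩
    B.1# B.+ (B.0# B.+ B.0#)                        ≈⟨ B.+-congˡ (B.+-identityˡ _) ⟩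
    B.1# B.+ B.0#                                   ≈⟨ B.+-identityʳ _ ⟩
    B.1#                                            ∎)
    where
    n = x B.* s′ B.- B.1#

    expand : ∀ o n m → (o B.+ n) B.* (o B.+ m) B.≈ o B.* o B.+ (o B.* (n B.+ m) B.+ n B.* m)
    expand o n m = solve 3 (λ o n m → (o :+ n) :* (o :+ m) := o :* o :+ (o :* (n :+ m) :+ n :* m))
      B.refl o n m

    z≈1+n : x B.* s′ B.≈ B.1# B.+ n
    z≈1+n = B.sym (B.trans (B.+-comm _ _)
      (B.trans (B.+-assoc _ _ _) (B.trans (B.+-congˡ (B.-‿inverseˡ _)) (B.+-identityʳ _))))

    qn≈0 : (q $ₐ n) C.≈ C.0#
    qn≈0 = C.trans (q.+-homo _ _) (C.trans (C.+-cong
      (C.trans (q.*-homo _ _) (C.trans (C.*-congˡ qs′≈s) qx·s≈1))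
      (C.trans (q.-‿homo _) (C.-‿cong q.1#-homo))) (C.-‿inverseʳ _))

    nn≈0 : n B.* (B.- n) B.≈ B.0#
    nn≈0 = B.trans (B.sym (-‿distribʳ-* _ _)) (B.trans (B.-‿cong (squareZero n n qn≈0 qn≈0)) -0#≈0#)

module _ (p : ℕ) (1<p : 1 < p) {R : CommutativeRing ℓ ℓ}
         (p-cancel : Cancellable R (nat R p))
         (i : TruncatedReciprocals p R) (Φ : FrobeniusLift p R)
         (A : Algebra R ℓ) (smooth : IsFormallySmooth A) (f : Algebra.Carrier A) where
  private
    module A = Algebra A
    B = away A f
    module B = Algebra B

  -- Formal smoothness lifts A → B/p to the Witt vectors of B/p, where p is non-zero but p² is zero.
  p∉p² : ¬ CommutativeRing._≈_ (ring B /[ p ]) B.1# B.0# →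
         ∀ b → ¬ nat (ring B) p B.≈ nat (ring B) p B.* nat (ring B) p B.* b
  p∉p² B/p≠0 b p≈p²b = B/p≠0 (structure-p≈0⇒trivial Wp≈0)
    where
    κ : Hom R (ring B /[ p ])
    κ = reduceMod (ring B) p ∘ₕ ι B

    open WittStructure p 1<p p-cancel i Φ κ (nat-vanishes (ring B) p)
    open WittVectors₂ p 1<p (ring B /[ p ]) (nat-vanishes (ring B) p) (mapReciprocals κ i)
    module C = CommutativeRing (ring B /[ p ])
    module W = CommutativeRing witt

    target source : Algebra R _
    target .ring = ring B /[ p ]
    target .ι    = κ
    source .ring = witt
    source .ι    = structure

    q : AlgHom source target
    q = record { hom = firstComponent ; ι-hom = λ _ → C.refl }

    ext : IsSquareZeroExtension q
    ext = record { surjective = λ s → (s , C.0#) , C.refl ; squareZero = kernel-square-zero }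

    h : AlgHom A target
    h = record { hom = reduceMod (ring B) p ∘ₕ ι (localization A.ring f) ; ι-hom = λ _ → C.refl }

    h̃ = smooth source target q ext h

    h̃f-unit : IsUnit witt (proj₁ h̃ $ₐ f)
    h̃f-unit = lift-unit q ext _ (cast-unit {R = ring B /[ p ]} (C.sym (proj₂ h̃ f))
      (hom-unit (reduceMod (ring B) p) (localization-unit A.ring f)))

    g : Hom (ring B) witt
    g = extendToLocalization A.ring f (AlgHomOver.hom (proj₁ h̃)) h̃f-unit

    p′ = nat witt p

    p′₀≈0 : proj₁ p′ C.≈ C.0#
    p′₀≈0 = C.trans (hom-nat firstComponent p) (nat-vanishes (ring B) p)

    Wp≈0 : ⟦ structure ⟧ (nat R p) W.≈ W.0#
    Wp≈0 = W.trans (hom-nat structure p)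
      (nat-vanishes-via g p b (kernel-square-zero p′ p′ p′₀≈0 p′₀≈0) p≈p²b)

-- Forms and dual numbers

trivialExtension : (S : CommutativeRing ℓ ℓ) → Module S ℓ ℓ → CommutativeRing ℓ ℓ
trivialExtension S M = record
  { isCommutativeRing = record
    { isRing = isRingᴺ
    ; *-comm = λ (r , m) (s , n) → *-comm r s ,
        M.≈ᴹ-trans (M.+ᴹ-cong (M.*ₗ-*ᵣ-coincident r n) (M.≈ᴹ-sym (M.*ₗ-*ᵣ-coincident s m)))
                   (M.+ᴹ-comm _ _)
    }
  }
  where
  module M = Module M
  open CommutativeRing S using (*-comm)
  open Idealization (CommutativeRing.ring S) M.bimodule using (isRingᴺ)

module _ (S : CommutativeRing ℓ ℓ) (M : Module S ℓ ℓ) where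
  private
    module S = CommutativeRing S
    module M = Module M

  toTrivialExtension : Hom S (trivialExtension S M)
  toTrivialExtension = mkHom S (trivialExtension S M) (λ s → s , M.0ᴹ)
    (λ e → e , M.≈ᴹ-refl)
    (λ _ _ → S.refl , M.≈ᴹ-sym (M.+ᴹ-identityˡ _))
    (λ r s → S.refl , M.≈ᴹ-sym (M.≈ᴹ-trans (M.+ᴹ-cong (M.*ₗ-zeroʳ r) (M.*ᵣ-zeroˡ s)) (M.+ᴹ-identityˡ _)))
    (S.refl , M.≈ᴹ-refl)

dual : CommutativeRing ℓ ℓ → CommutativeRing ℓ ℓ
dual S = trivialExtension S TensorUnit.⟨module⟩

module _ {K : CommutativeRing ℓ ℓ} (A : Algebra K ℓ) where
  private
    module A = Algebra A

  A⋉Ω : Algebra K ℓ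
  A⋉Ω .ring = trivialExtension A.ring (Ω A)
  A⋉Ω .ι    = toTrivialExtension A.ring (Ω A) ∘ₕ ι A

  alongZero : AlgHom A A⋉Ω
  alongZero = record { hom = toTrivialExtension A.ring (Ω A) ; ι-hom = λ _ → A.refl , Ω-refl }

  -- A derivation is a ring section of A ⋉ Ω → A. In this form the universal derivation is a point
  -- of G with values in A ⋉ Ω, and the group law can be applied to it.
  alongD : AlgHom A A⋉Ω
  alongD = record
    { hom = mkHom A.ring (trivialExtension A.ring (Ω A)) (λ r → r , d r)
        (λ e → e , d-cong e)
        (λ r s → A.refl , d-+ r s)
        (λ r s → A.refl , d-* r s)
        (A.refl , Ω-trans (d-cong (A.sym (Hom.1#-homo (ι A)))) (d-ι _))
    ; ι-hom = λ k → A.refl , d-ι k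
    }

restrictHom : {K : CommutativeRing ℓ ℓ} (S : Algebra K ℓ) {V W : Algebra (ring S) ℓ} →
              AlgHom V W → AlgHom (restrictScalars S V) (restrictScalars S W)
restrictHom S h = record
  { hom = AlgHomOver.hom h ; ι-hom = λ k → AlgHomOver.ι-hom h (⟦ ι S ⟧ k) }

pushΩ : {R S : CommutativeRing ℓ ℓ} {κ : CommutativeRing.Carrier R → CommutativeRing.Carrier S}
        {A : Algebra R ℓ} {B : Algebra S ℓ} → AlgHomOver {K = R} {K′ = S} κ A B →
        Hom (ring (A⋉Ω A)) (ring (A⋉Ω B))
pushΩ {A = A} {B} h = mkHom (ring (A⋉Ω A)) (ring (A⋉Ω B))
  (λ (r , ω) → (h $ₐ r) , pullback h ω)
  (λ (e , f) → h.⟦⟧-cong e , pullback-cong h f)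
  (λ (r , _) (s , _) → h.+-homo r s , Ω-refl)
  (λ (r , _) (s , _) → h.*-homo r s , Ω-refl)
  (h.1#-homo , Ω-refl)
  where module h = AlgHomOver h

-- Evaluation of forms against a tangent vector (π , ∂) : C → S[ε].
module Contraction (S : CommutativeRing b b) where
  open CommutativeRing S

  -- Defined on form expressions for an arbitrary function v, so that pulling back is mere
  -- composition; homomorphy of v enters only when the relations of Ω have to be respected.
  contract : {C : Set ℓ′} → (C → Carrier × Carrier) → Form C → Carrier
  contract v (d r)   = proj₂ (v r)
  contract v (ω ⊕ η) = contract v ω + contract v η
  contract v 0ᶠ      = 0#
  contract v (⊝ ω)   = - contract v ω
  contract v (r ⊙ ω) = proj₁ (v r) * contract v ω

  contract-mapForm : {C : Set ℓ′} {D : Set a} (v : D → Carrier × Carrier) (g : C → D) →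
                     ∀ ω → contract v (mapForm g ω) ≡ contract (v ∘ g) ω
  contract-mapForm v g (d r)   = ≡.refl
  contract-mapForm v g (ω ⊕ η) = ≡.cong₂ _+_ (contract-mapForm v g ω) (contract-mapForm v g η)
  contract-mapForm v g 0ᶠ      = ≡.refl
  contract-mapForm v g (⊝ ω)   = ≡.cong -_ (contract-mapForm v g ω)
  contract-mapForm v g (r ⊙ ω) = ≡.cong (proj₁ (v (g r)) *_) (contract-mapForm v g ω)

  contract-ext : {C : Set ℓ′} {v w : C → Carrier × Carrier} →
                 (∀ r → proj₁ (v r) ≈ proj₁ (w r) × proj₂ (v r) ≈ proj₂ (w r)) →
                 ∀ ω → contract v ω ≈ contract w ω
  contract-ext e (d r)   = proj₂ (e r)
  contract-ext e (ω ⊕ η) = +-cong (contract-ext e ω) (contract-ext e η)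
  contract-ext e 0ᶠ      = refl
  contract-ext e (⊝ ω)   = -‿cong (contract-ext e ω)
  contract-ext e (r ⊙ ω) = *-cong (proj₁ (e r)) (contract-ext e ω)


module _ {S : CommutativeRing ℓ ℓ} {K : CommutativeRing ℓ ℓ} {A : Algebra K ℓ}
         (v : Hom (ring A) (dual S))
         (v-ι : ∀ k → CommutativeRing._≈_ S (proj₂ (⟦ v ⟧ (⟦ ι A ⟧ k))) (CommutativeRing.0# S)) where
  open CommutativeRing S hiding (ring)
  open Contraction S
  private
    module v = Hom v

  contract-cong : ∀ {ω η} → FormEq A ω η → contract ⟦ v ⟧ ω ≈ contract ⟦ v ⟧ η
  contract-cong Ω-refl             = refl
  contract-cong (Ω-sym e)          = sym (contract-cong e)
  contract-cong (Ω-trans e f)      = trans (contract-cong e) (contract-cong f)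
  contract-cong (⊕-cong e f)       = +-cong (contract-cong e) (contract-cong f)
  contract-cong (⊝-cong e)         = -‿cong (contract-cong e)
  contract-cong (⊙-cong e f)       = *-cong (proj₁ (v.⟦⟧-cong e)) (contract-cong f)
  contract-cong (⊕-assoc _ _ _)    = +-assoc _ _ _
  contract-cong (⊕-comm _ _)       = +-comm _ _
  contract-cong (⊕-identityˡ _)    = +-identityˡ _
  contract-cong (⊕-inverseˡ _)     = -‿inverseˡ _
  contract-cong (⊙-distribˡ _ _ _) = distribˡ _ _ _
  contract-cong (⊙-distribʳ ω r s) = trans (*-congʳ (proj₁ (v.+-homo r s))) (distribʳ _ _ _)
  contract-cong (⊙-assoc r s ω)    = trans (*-congʳ (proj₁ (v.*-homo r s))) (*-assoc _ _ _)
  contract-cong (⊙-identity ω)     = trans (*-congʳ (proj₁ v.1#-homo)) (*-identityˡ _)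
  contract-cong (d-cong e)         = proj₂ (v.⟦⟧-cong e)
  contract-cong (d-+ r s)          = proj₂ (v.+-homo r s)
  contract-cong (d-* r s)          = trans (proj₂ (v.*-homo r s)) (+-congˡ (*-comm _ _))
  contract-cong (d-ι k)            = v-ι k

  contractHom : Hom (ring (A⋉Ω A)) (dual S)
  contractHom = mkHom (ring (A⋉Ω A)) (dual S)
    (λ (r , ω) → proj₁ (⟦ v ⟧ r) , contract ⟦ v ⟧ ω)
    (λ (e , f) → proj₁ (v.⟦⟧-cong e) , contract-cong f)
    (λ (r , _) (s , _) → proj₁ (v.+-homo r s) , refl)
    (λ (r , _) (s , _) → proj₁ (v.*-homo r s) , +-congˡ (*-comm _ _))
    (proj₁ v.1#-homo , refl)

-- Left invariant forms

module PointGroups {R : CommutativeRing ℓ ℓ} (G : AffineGroupScheme R) where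
  open AffineGroupScheme G

  pointGroup : Algebra R ℓ → Group ℓ ℓ
  pointGroup S = record { isGroup = isGroup S }

  module _ {S T : Algebra R ℓ} (h : AlgHom S T) where
    private
      module T = Group (pointGroup T)
      module S = Group (pointGroup S)
    open GroupProperties (pointGroup T) using (inverseˡ-unique; identityˡ-unique)
    private
      push : Point S → Point T
      push g = h ∘ₐ g

      push-cong : ∀ g g′ → g S.≈ g′ → push g T.≈ push g′
      push-cong g g′ e r = AlgHomOver.⟦⟧-cong h (e r)
      open SetoidReasoning T.setoid

    -- Naturality is given for the product alone; the image of ε is idempotent, hence the identity
    -- of G(T).
    ε-natural : (h ∘ₐ ε) T.≈ ε
    ε-natural = identityˡ-unique (push ε) (push ε) (begin
      push ε ∙ push ε  ≈⟨ ∙-natural h ε ε ⟨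
      push (ε ∙ ε)     ≈⟨ push-cong (ε ∙ ε) ε (S.identityˡ ε) ⟩
      push ε           ∎)

    ⁻¹-natural : ∀ g → (h ∘ₐ (g ⁻¹)) T.≈ (h ∘ₐ g) ⁻¹
    ⁻¹-natural g = inverseˡ-unique (push (g ⁻¹)) (push g) (begin
      push (g ⁻¹) ∙ push g  ≈⟨ ∙-natural h (g ⁻¹) g ⟨
      push (g ⁻¹ ∙ g)       ≈⟨ push-cong (g ⁻¹ ∙ g) ε (S.inverseˡ g) ⟩
      push ε                ≈⟨ ε-natural ⟩
      ε                     ∎)

    \\-natural : ∀ g g′ → (h ∘ₐ (g ⁻¹ ∙ g′)) T.≈ (h ∘ₐ g) ⁻¹ ∙ (h ∘ₐ g′)
    \\-natural g g′ = begin
      push (g ⁻¹ ∙ g′)      ≈⟨ ∙-natural h (g ⁻¹) g′ ⟩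
      push (g ⁻¹) ∙ push g′ ≈⟨ T.∙-congʳ {push g′} {push (g ⁻¹)} {push g ⁻¹} (⁻¹-natural g) ⟩
      push g ⁻¹ ∙ push g′   ∎

module _ {a b} (𝔾 : Group a b) where
  open Group 𝔾
  open GroupProperties 𝔾 using (⁻¹-anti-homo-∙)
  open SetoidReasoning setoid

  \\-cancelˡ : ∀ g x y → (g ∙ x) ⁻¹ ∙ (g ∙ y) ≈ x ⁻¹ ∙ y
  \\-cancelˡ g x y = begin
    (g ∙ x) ⁻¹ ∙ (g ∙ y)         ≈⟨ ∙-congʳ (⁻¹-anti-homo-∙ g x) ⟩
    x ⁻¹ ∙ g ⁻¹ ∙ (g ∙ y)        ≈⟨ assoc _ _ _ ⟩
    x ⁻¹ ∙ (g ⁻¹ ∙ (g ∙ y))      ≈⟨ ∙-congˡ (sym (assoc _ _ _)) ⟩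
    x ⁻¹ ∙ (g ⁻¹ ∙ g ∙ y)        ≈⟨ ∙-congˡ (∙-congʳ (inverseˡ g)) ⟩
    x ⁻¹ ∙ (ε ∙ y)               ≈⟨ ∙-congˡ (identityˡ y) ⟩
    x ⁻¹ ∙ y                     ∎

module LeftInvariantForms {R : CommutativeRing ℓ ℓ} (G : AffineGroupScheme R) where
  open AffineGroupScheme G
  open PointGroups G

  -- x ↦ the differential of h ↦ x(g⁻¹h) at h = g.
  difference : Point (A⋉Ω O)
  difference = alongZero O ⁻¹ ∙ alongD O

  -- The component at x of the Maurer-Cartan form g⁻¹ dg: the left invariant form that agrees with
  -- dx at the identity.
  maurerCartan : Algebra.Carrier O → Form (Algebra.Carrier O)
  maurerCartan x = proj₂ (difference $ₐ x)

  module _ {S : Algebra R ℓ} (V : Algebra (ring S) ℓ) where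
    private
      V⋉Ω = restrictScalars S (A⋉Ω V)
      module V⋉Ω = Group (pointGroup V⋉Ω)
      zeroV = restrictHom S (alongZero V)
      dV    = restrictHom S (alongD V)

    -- The zero section and the universal derivation are both natural, so pulling g⁻¹ dg back along
    -- q gives q⁻¹ dq, with d taken relative to S.
    maurerCartan-pullback : (q : Point (restrictScalars S V)) → ∀ x →
      FormEq V (mapForm (q $ₐ_) (maurerCartan x))
               (proj₂ (((zeroV ∘ₐ q) ⁻¹ ∙ (dV ∘ₐ q)) $ₐ x))
    maurerCartan-pullback q x = proj₂ (square x)
      where
      -- Regarding q as lying over R → S makes the pulled back differentials relative to S instead
      -- of R.
      qV : AlgHomOver {K = R} {K′ = ring S} ⟦ ι S ⟧ O V
      qV = record { hom = AlgHomOver.hom q ; ι-hom = AlgHomOver.ι-hom q }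

      Q : AlgHom (A⋉Ω O) V⋉Ω
      Q = record { hom = pushΩ qV ; ι-hom = λ k → AlgHomOver.ι-hom q k , Ω-refl }

      zero-square : (Q ∘ₐ alongZero O) V⋉Ω.≈ (zeroV ∘ₐ q)
      zero-square _ = Algebra.refl V , Ω-refl

      d-square : (Q ∘ₐ alongD O) V⋉Ω.≈ (dV ∘ₐ q)
      d-square _ = Algebra.refl V , Ω-refl

      open SetoidReasoning V⋉Ω.setoid

      square : (Q ∘ₐ difference) V⋉Ω.≈ (zeroV ∘ₐ q) ⁻¹ ∙ (dV ∘ₐ q)
      square = begin
        Q ∘ₐ difference
          ≈⟨ \\-natural Q (alongZero O) (alongD O) ⟩
        (Q ∘ₐ alongZero O) ⁻¹ ∙ (Q ∘ₐ alongD O)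
          ≈⟨ V⋉Ω.∙-cong {(Q ∘ₐ alongZero O) ⁻¹} {(zeroV ∘ₐ q) ⁻¹} {Q ∘ₐ alongD O} {dV ∘ₐ q}
               (V⋉Ω.⁻¹-cong {Q ∘ₐ alongZero O} {zeroV ∘ₐ q} zero-square) d-square ⟩
        (zeroV ∘ₐ q) ⁻¹ ∙ (dV ∘ₐ q)
          ∎

  -- In (l r)⁻¹ d(l r) the point l comes from the base S, so dl = 0 relative to S; l then cancels
  -- and leaves r⁻¹ dr.
  maurerCartan-invariant : ∀ x → IsLeftInvariant G (maurerCartan x)
  maurerCartan-invariant x S g = Ω-trans left (Ω-trans (proj₂ (invariance x)) (Ω-sym right))
    where
    V = S ⊗ O
    V⋉Ω = restrictScalars S (A⋉Ω V)
    module N = Group (pointGroup V⋉Ω)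
    zeroV = restrictHom S (alongZero V)
    dV    = restrictHom S (alongD V)

    l r : Point (restrictScalars S V)
    l = includeˡ S O ∘ₐ g
    r = includeʳ S O

    constant-l : (dV ∘ₐ l) N.≈ (zeroV ∘ₐ l)
    constant-l y = Algebra.refl V , d-ι (g $ₐ y)

    open SetoidReasoning N.setoid

    invariance : (zeroV ∘ₐ (l ∙ r)) ⁻¹ ∙ (dV ∘ₐ (l ∙ r)) N.≈ (zeroV ∘ₐ r) ⁻¹ ∙ (dV ∘ₐ r)
    invariance = begin
      (zeroV ∘ₐ (l ∙ r)) ⁻¹ ∙ (dV ∘ₐ (l ∙ r))
        ≈⟨ N.∙-cong {(zeroV ∘ₐ (l ∙ r)) ⁻¹} {((zeroV ∘ₐ l) ∙ (zeroV ∘ₐ r)) ⁻¹}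
             {dV ∘ₐ (l ∙ r)} {(dV ∘ₐ l) ∙ (dV ∘ₐ r)}
             (N.⁻¹-cong {zeroV ∘ₐ (l ∙ r)} {(zeroV ∘ₐ l) ∙ (zeroV ∘ₐ r)} (∙-natural zeroV l r))
             (∙-natural dV l r) ⟩
      ((zeroV ∘ₐ l) ∙ (zeroV ∘ₐ r)) ⁻¹ ∙ ((dV ∘ₐ l) ∙ (dV ∘ₐ r))
        ≈⟨ N.∙-congˡ {((zeroV ∘ₐ l) ∙ (zeroV ∘ₐ r)) ⁻¹} {(dV ∘ₐ l) ∙ (dV ∘ₐ r)} {(zeroV ∘ₐ l) ∙ (dV ∘ₐ r)}
             (N.∙-congʳ {dV ∘ₐ r} {dV ∘ₐ l} {zeroV ∘ₐ l} constant-l) ⟩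
      ((zeroV ∘ₐ l) ∙ (zeroV ∘ₐ r)) ⁻¹ ∙ ((zeroV ∘ₐ l) ∙ (dV ∘ₐ r))
        ≈⟨ \\-cancelˡ (pointGroup V⋉Ω) (zeroV ∘ₐ l) (zeroV ∘ₐ r) (dV ∘ₐ r) ⟩
      (zeroV ∘ₐ r) ⁻¹ ∙ (dV ∘ₐ r)
        ∎

    left : FormEq V (mapForm ((l ∙ r) $ₐ_) (maurerCartan x))
                    (proj₂ (((zeroV ∘ₐ (l ∙ r)) ⁻¹ ∙ (dV ∘ₐ (l ∙ r))) $ₐ x))
    left = maurerCartan-pullback {S = S} V (l ∙ r) x

    right : FormEq V (mapForm (r $ₐ_) (maurerCartan x)) (proj₂ (((zeroV ∘ₐ r) ⁻¹ ∙ (dV ∘ₐ r)) $ₐ x))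
    right = maurerCartan-pullback {S = S} V r x

module _ {K : CommutativeRing ℓ ℓ} where

  dualₐ : Algebra K ℓ → Algebra K ℓ
  dualₐ S .ring = dual (ring S)
  dualₐ S .ι    = toTrivialExtension (ring S) TensorUnit.⟨module⟩ ∘ₕ ι S

  toDual : (S : Algebra K ℓ) → AlgHom S (dualₐ S)
  toDual S = record
    { hom = toTrivialExtension (ring S) TensorUnit.⟨module⟩
    ; ι-hom = λ _ → Algebra.refl S , Algebra.refl S }

module TangentVectors {R : CommutativeRing ℓ ℓ} (G : AffineGroupScheme R) where
  open AffineGroupScheme G
  open PointGroups G
  open LeftInvariantForms G

  module _ {S : Algebra R ℓ} where
    private
      module S = Algebra S
      T = dualₐ S
      module T = Group (pointGroup T)
    open Contraction S.ring

    -- Contraction with v is a ring map from O ⋉ Ω to the dual numbers. It sends the zero section to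
    -- ε and the universal derivation to v, hence g⁻¹ dg to ε⁻¹ v = v.
    contract-maurerCartan : (v : Point T) → (∀ x → proj₁ (v $ₐ x) S.≈ (ε $ₐ x)) → ∀ x →
                            contract (v $ₐ_) (maurerCartan x) S.≈ proj₂ (v $ₐ x)
    contract-maurerCartan v v₀≈ε x = proj₂ (moved x)
      where
      Ψ : AlgHom (A⋉Ω O) T
      Ψ = record
        { hom = contractHom (AlgHomOver.hom v) (λ k → proj₂ (AlgHomOver.ι-hom v k))
        ; ι-hom = λ k → proj₁ (AlgHomOver.ι-hom v k) , S.refl
        }

      zero-ε : (Ψ ∘ₐ alongZero O) T.≈ ε
      zero-ε y = S.trans (v₀≈ε y) (proj₁ (ε-natural (toDual S) y)) , proj₂ (ε-natural (toDual S) y)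

      open SetoidReasoning T.setoid
      open GroupProperties (pointGroup T) using (ε⁻¹≈ε)

      moved : (Ψ ∘ₐ difference) T.≈ v
      moved = begin
        Ψ ∘ₐ difference
          ≈⟨ \\-natural Ψ (alongZero O) (alongD O) ⟩
        (Ψ ∘ₐ alongZero O) ⁻¹ ∙ (Ψ ∘ₐ alongD O)
          ≈⟨ T.∙-cong {(Ψ ∘ₐ alongZero O) ⁻¹} {ε ⁻¹} {Ψ ∘ₐ alongD O} {v}
               (T.⁻¹-cong {Ψ ∘ₐ alongZero O} {ε} zero-ε) (λ _ → S.refl , S.refl) ⟩
        ε ⁻¹ ∙ v
          ≈⟨ T.∙-congʳ {v} {ε ⁻¹} {ε} ε⁻¹≈ε ⟩
        ε ∙ v
          ≈⟨ T.identityˡ v ⟩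
        v
          ∎

    -- The vector h v at h is the left translate of v. The map κ out of S ⊗ O is constant on S and
    -- is v on O, so contracting with κ carries the defining identity of left invariance to this
    -- equation.
    contract-leftInvariant : ∀ {ω} → IsLeftInvariant G ω → (h : Point S) (v : Point T) →
      contract (((toDual S ∘ₐ h) ∙ v) $ₐ_) ω S.≈ contract (v $ₐ_) ω
    contract-leftInvariant {ω} invariant h v = begin
      contract (((toDual S ∘ₐ h) ∙ v) $ₐ_) ω
        ≈⟨ contract-ext translated ω ⟨
      contract ((κ $ₐ_) ∘ (leftTranslation G S h $ₐ_)) ω
        ≡⟨ contract-mapForm (κ $ₐ_) (leftTranslation G S h $ₐ_) ω ⟨
      contract (κ $ₐ_) (mapForm (leftTranslation G S h $ₐ_) ω)
        ≈⟨ contract-cong {A = S ⊗ O} evaluate (λ _ → S.refl) (invariant S h) ⟩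
      contract (κ $ₐ_) (mapForm (includeʳ S O $ₐ_) ω)
        ≡⟨ contract-mapForm (κ $ₐ_) (includeʳ S O $ₐ_) ω ⟩
      contract (v $ₐ_) ω
        ∎
      where
      module v = AlgHomOver v
      module D = CommutativeRing (dual S.ring)
      open SetoidReasoning S.setoid

      evaluate : Hom (ring (S ⊗ O)) (dual S.ring)
      evaluate = Presentation.evalHom S.ring (Algebra.Carrier O) (TensorRel S O) (dual S.ring)
        (AlgHomOver.hom (toDual S)) (v $ₐ_) respects
        where
        ev = Presentation.eval S.ring (Algebra.Carrier O) (TensorRel S O) (dual S.ring)
          (AlgHomOver.hom (toDual S)) (v $ₐ_)
        respects : ∀ {s t} → TensorRel S O s t → ev s D.≈ ev t
        respects (⊗-cong e) = v.⟦⟧-cong e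
        respects (⊗-+ r s)  = v.+-homo r s
        respects (⊗-* r s)  = v.*-homo r s
        respects (⊗-ι k)    = v.ι-hom k

      κ : AlgHom (restrictScalars S (S ⊗ O)) T
      κ = record { hom = evaluate ; ι-hom = λ _ → S.refl , S.refl }

      translated : (κ ∘ₐ leftTranslation G S h) T.≈ ((toDual S ∘ₐ h) ∙ v)
      translated = T.trans {κ ∘ₐ leftTranslation G S h}
        {(κ ∘ₐ (includeˡ S O ∘ₐ h)) ∙ (κ ∘ₐ includeʳ S O)} {(toDual S ∘ₐ h) ∙ v}
        (∙-natural κ (includeˡ S O ∘ₐ h) (includeʳ S O))
        (T.∙-cong {κ ∘ₐ (includeˡ S O ∘ₐ h)} {toDual S ∘ₐ h} {κ ∘ₐ includeʳ S O} {v}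
          (λ _ → S.refl , S.refl) (λ _ → S.refl , S.refl))

-- Matrices

module MatrixRing (C : CommutativeRing a a) (N : ℕ) where
  open CommutativeRing C renaming (Carrier to Scalar)
  open MatrixOps (CommutativeRing.rawRing C)
  open MatrixProperties C
  open SemiringSum semiring
  open CommutativeSemigroupProperties *-commutativeSemigroup using (x∙yz≈y∙xz)

  matrixRing : Ring a a
  matrixRing = record
    { Carrier = Matrix N
    ; _≈_ = _≈ₘ_
    ; _+_ = λ A B i j → A i j + B i j
    ; _*_ = _*ₘ_
    ; -_ = λ A i j → - A i j
    ; 0# = λ _ _ → 0#
    ; 1# = 1ₘ
    ; isRing = record
      { +-isAbelianGroup = record
        { isGroup = record
          { isMonoid = record
            { isSemigroup = record
              { isMagma = record
                { isEquivalence = record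
                  { refl = λ _ _ → refl
                  ; sym = λ e i j → sym (e i j)
                  ; trans = λ e f i j → trans (e i j) (f i j)
                  }
                ; ∙-cong = λ e f i j → +-cong (e i j) (f i j)
                }
              ; assoc = λ _ _ _ _ _ → +-assoc _ _ _
              }
            ; identity = (λ _ _ _ → +-identityˡ _) , (λ _ _ _ → +-identityʳ _)
            }
          ; inverse = (λ _ _ _ → -‿inverseˡ _) , (λ _ _ _ → -‿inverseʳ _)
          ; ⁻¹-cong = λ e i j → -‿cong (e i j)
          }
        ; comm = λ _ _ _ _ → +-comm _ _
        }
      ; *-cong = *ₘ-cong
      ; *-assoc = *ₘ-assoc
      ; *-identity = *ₘ-identityˡ , *ₘ-identityʳ
      ; distrib =
          (λ A B D i j → trans (sum-cong-≋ (λ k → distribˡ (A i k) (B k j) (D k j)))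
            (∑-distrib-+ (λ k → A i k * B k j) (λ k → A i k * D k j))) ,
          (λ A B D i j → trans (sum-cong-≋ (λ k → distribʳ (A k j) (B i k) (D i k)))
            (∑-distrib-+ (λ k → B i k * A k j) (λ k → D i k * A k j)))
      }
    }

  scalarMatrix : Scalar → Matrix N
  scalarMatrix r i j = r * 1ₘ i j

  scalarMatrix-*ₘ : ∀ r A → scalarMatrix r *ₘ A ≈ₘ (λ i j → r * A i j)
  scalarMatrix-*ₘ r A i j = trans (sum-cong-≋ (λ k → *-assoc r (1ₘ i k) (A k j)))
    (trans (sym (*-distribˡ-sum r (λ k → 1ₘ i k * A k j))) (*-congˡ (*ₘ-identityˡ A i j)))

  *ₘ-scalarMatrix : ∀ A r → A *ₘ scalarMatrix r ≈ₘ (λ i j → r * A i j)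
  *ₘ-scalarMatrix A r i j = trans
    (sum-cong-≋ (λ k → x∙yz≈y∙xz (A i k) r (1ₘ k j)))
    (trans (sym (*-distribˡ-sum r (λ k → A i k * 1ₘ k j))) (*-congˡ (*ₘ-identityʳ A i j)))

-- σ is the structure map of the C-algebra 𝓜.
module SeriesAtNilpotent (C : CommutativeRing a a) (𝓜 : Ring b b)
                         (σ : CommutativeRing.Carrier C → Ring.Carrier 𝓜)
                         (σ-cong : ∀ {r s} → CommutativeRing._≈_ C r s → Ring._≈_ 𝓜 (σ r) (σ s))
                         (σ-+ : ∀ r s → Ring._≈_ 𝓜 (σ (CommutativeRing._+_ C r s)) (Ring._+_ 𝓜 (σ r) (σ s)))
                         (σ-* : ∀ r s → Ring._≈_ 𝓜 (σ (CommutativeRing._*_ C r s)) (Ring._*_ 𝓜 (σ r) (σ s)))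
                         (σ-0 : Ring._≈_ 𝓜 (σ (CommutativeRing.0# C)) (Ring.0# 𝓜))
                         (σ-1 : Ring._≈_ 𝓜 (σ (CommutativeRing.1# C)) (Ring.1# 𝓜))
                         (σ-central : ∀ r x → Ring._≈_ 𝓜 (Ring._*_ 𝓜 x (σ r)) (Ring._*_ 𝓜 (σ r) x))
                         (m : Ring.Carrier 𝓜) where
  open PowerSeries C
  open Ring 𝓜
  open SetoidReasoning setoid
  open CommutativeSemigroupProperties +-commutativeSemigroup using (interchange)
  open SemiringExp semiring
  private
    module C = CommutativeRing C

  -- The sum of f k · mᵏ over k < n.
  at : ℕ → Seq → Carrier
  at zero    f = 0#
  at (suc n) f = σ (f 0) + m * at n (tail f)

  at-cong< : ∀ n {f g} → (∀ k → k < n → f k C.≈ g k) → at n f ≈ at n g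
  at-cong< zero    e = refl
  at-cong< (suc n) e = +-cong (σ-cong (e 0 (s≤s z≤n)))
    (*-congˡ (at-cong< n (λ k k<n → e (suc k) (s≤s k<n))))

  at-cong : ∀ n {f g} → f ≗ g → at n f ≈ at n g
  at-cong n e = at-cong< n (λ k _ → e k)

  at-0 : ∀ n f → (∀ k → f k C.≈ C.0#) → at n f ≈ 0#
  at-0 zero    f e = refl
  at-0 (suc n) f e = trans (+-cong (trans (σ-cong (e 0)) σ-0)
    (trans (*-congˡ (at-0 n (tail f) (e ∘ suc))) (zeroʳ _))) (+-identityˡ _)

  at-const : ∀ n c → at (suc n) (constˢ c) ≈ σ c
  at-const n c =
    trans (+-congˡ (trans (*-congˡ (at-0 n (tail (constˢ c)) (λ _ → C.refl))) (zeroʳ _))) (+-identityʳ _)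

  private
    at-+ : ∀ n f g → at n (f ⊹ g) ≈ at n f + at n g
    at-+ zero    f g = sym (+-identityˡ _)
    at-+ (suc n) f g = trans
      (+-cong (σ-+ _ _) (trans (*-congˡ (at-+ n (tail f) (tail g))) (distribˡ _ _ _)))
      (interchange _ _ _ _)

    σ-shift : ∀ c x → m * (σ c * x) ≈ σ c * (m * x)
    σ-shift c x = trans (sym (*-assoc _ _ _)) (trans (*-congʳ (σ-central c m)) (*-assoc _ _ _))

    at-scale : ∀ n c f → at n (scale c f) ≈ σ c * at n f
    at-scale zero    c f = sym (zeroʳ _)
    at-scale (suc n) c f = trans
      (+-cong (σ-* _ _) (trans (*-congˡ (at-scale n c (tail f))) (σ-shift c _)))
      (sym (distribˡ _ _ _))

    at-step : ∀ n f g → at (suc n) (f ⊛ g) ≈ σ (f 0) * at (suc n) g + m * at n (tail f ⊛ g)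
    at-step n f g = begin
      σ (f 0 C.* g 0) + m * at n (scale (f 0) (tail g) ⊹ (tail f ⊛ g))
        ≈⟨ +-cong (σ-* _ _) (*-congˡ (trans (at-+ n (scale (f 0) (tail g)) (tail f ⊛ g))
             (+-congʳ (at-scale n (f 0) (tail g))))) ⟩
      σ (f 0) * σ (g 0) + m * (σ (f 0) * at n (tail g) + at n (tail f ⊛ g))
        ≈⟨ +-congˡ (trans (distribˡ _ _ _) (+-congʳ (σ-shift (f 0) _))) ⟩
      σ (f 0) * σ (g 0) + (σ (f 0) * (m * at n (tail g)) + m * at n (tail f ⊛ g))
        ≈⟨ +-assoc _ _ _ ⟨
      σ (f 0) * σ (g 0) + σ (f 0) * (m * at n (tail g)) + m * at n (tail f ⊛ g)
        ≈⟨ +-congʳ (sym (distribˡ _ _ _)) ⟩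
      σ (f 0) * at (suc n) g + m * at n (tail f ⊛ g)
        ∎

    ^-suc : ∀ j x → m ^ j * (m * x) ≈ m ^ suc j * x
    ^-suc zero    x = trans (*-identityˡ _) (*-congʳ (sym (*-identityʳ m)))
    ^-suc (suc j) x = trans (*-assoc _ _ _) (trans (*-congˡ (^-suc j x)) (sym (*-assoc _ _ _)))

    ^-σ : ∀ j c x → m ^ j * (σ c * x) ≈ σ c * (m ^ j * x)
    ^-σ j c x = trans (sym (*-assoc _ _ _)) (trans (*-congʳ (σ-central c (m ^ j))) (*-assoc _ _ _))

  module _ (p : ℕ) (mᵖ≈0 : m ^ p ≈ 0#) where

    -- The terms of degree at least n contain mⁿ and are killed by mʲ, as j + n = p.
    at-stable : ∀ j n k f → j ℕ.+ n ≡ p → m ^ j * at (n ℕ.+ k) f ≈ m ^ j * at n f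
    at-stable j zero    k f e = trans (vanish (at k f)) (sym (zeroʳ _))
      where
      vanish : ∀ x → m ^ j * x ≈ 0#
      vanish x = trans (*-congʳ (trans (reflexive (≡.cong (m ^_) (≡.trans (≡.sym (ℕ.+-identityʳ j)) e))) mᵖ≈0))
                       (zeroˡ x)
    at-stable j (suc n) k f e = trans (distribˡ _ _ _)
      (trans (+-congˡ (trans (^-suc j _) (trans (at-stable (suc j) n k (tail f) (≡.trans (≡.sym (ℕ.+-suc j n)) e))
        (sym (^-suc j _))))) (sym (distribˡ _ _ _)))

    private
      -- The factor mʲ records the powers of m already split off. It pays for replacing the value of
      -- g cut off at n by the value cut off at p, as the induction on n demands.
      at-⊛-shifted : ∀ j n f g → j ℕ.+ n ≡ p → m ^ j * at n (f ⊛ g) ≈ m ^ j * (at n f * at p g)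
      at-⊛-shifted j zero    f g e = *-congˡ (sym (zeroˡ _))
      at-⊛-shifted j (suc n) f g e = begin
        m ^ j * at (suc n) (f ⊛ g)
          ≈⟨ *-congˡ (at-step n f g) ⟩
        m ^ j * (σ (f 0) * at (suc n) g + m * at n (tail f ⊛ g))
          ≈⟨ distribˡ _ _ _ ⟩
        m ^ j * (σ (f 0) * at (suc n) g) + m ^ j * (m * at n (tail f ⊛ g))
          ≈⟨ +-cong (^-σ j (f 0) _) (^-suc j _) ⟩
        σ (f 0) * (m ^ j * at (suc n) g) + m ^ suc j * at n (tail f ⊛ g)
          ≈⟨ +-cong (*-congˡ (trans (sym (at-stable j (suc n) j g e))
                      (*-congˡ (reflexive (≡.cong (λ l → at l g) (≡.trans (ℕ.+-comm (suc n) j) e))))))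
                    (at-⊛-shifted (suc j) n (tail f) g (≡.trans (≡.sym (ℕ.+-suc j n)) e)) ⟩
        σ (f 0) * (m ^ j * at p g) + m ^ suc j * (at n (tail f) * at p g)
          ≈⟨ +-cong (^-σ j (f 0) _) (^-suc j _) ⟨
        m ^ j * (σ (f 0) * at p g) + m ^ j * (m * (at n (tail f) * at p g))
          ≈⟨ distribˡ _ _ _ ⟨
        m ^ j * (σ (f 0) * at p g + m * (at n (tail f) * at p g))
          ≈⟨ *-congˡ (+-congˡ (sym (*-assoc _ _ _))) ⟩
        m ^ j * (σ (f 0) * at p g + m * at n (tail f) * at p g)
          ≈⟨ *-congˡ (sym (distribʳ _ _ _)) ⟩
        m ^ j * (at (suc n) f * at p g)
          ∎

    at-⊛ : ∀ f g → at p (f ⊛ g) ≈ at p f * at p g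
    at-⊛ f g = trans (sym (*-identityˡ _)) (trans (at-⊛-shifted 0 p f g ≡.refl) (*-identityˡ _))

    -- In front of m the cut-off p - 1 gives the same value as p, since m mᵖ⁻¹ = 0. With cut-off p
    -- evaluation is multiplicative, so the inverse series cancels u.
    m-at-unit : ∀ n u y → suc n ≡ p → u ⊛ y ≗ constˢ C.1# → m * at n u * at p y ≈ m
    m-at-unit n u y ≡.refl uy≈1 = begin
      m * at n u * at p y
        ≈⟨ *-congʳ (*-congʳ (*-identityʳ m)) ⟨
      m ^ 1 * at n u * at p y
        ≈⟨ *-congʳ (at-stable 1 n 1 u ≡.refl) ⟨
      m ^ 1 * at (n ℕ.+ 1) u * at p y
        ≈⟨ *-congʳ (*-cong (*-identityʳ m) (reflexive (≡.cong (λ k → at k u) (ℕ.+-comm n 1)))) ⟩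
      m * at p u * at p y
        ≈⟨ *-assoc _ _ _ ⟩
      m * (at p u * at p y)
        ≈⟨ *-congˡ (trans (sym (at-⊛ u y)) (trans (at-cong p uy≈1) (trans (at-const n C.1#) σ-1))) ⟩
      m * 1#
        ≈⟨ *-identityʳ m ⟩
      m
        ∎

module MatrixSeries (C : CommutativeRing a a) {N : ℕ}
                    (M : MatrixOps.Matrix (CommutativeRing.rawRing C) N) where
  open CommutativeRing C using (distribʳ; *-assoc; *-congʳ; zeroˡ; *-identityˡ; trans; sym)
  open MatrixRing C N public

  open SeriesAtNilpotent C matrixRing scalarMatrix (λ e i j → *-congʳ e)
    (λ r s i j → distribʳ _ r s)
    (λ r s i j → sym (trans (scalarMatrix-*ₘ r (scalarMatrix s) i j) (sym (*-assoc r s _))))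
    (λ i j → zeroˡ _) (λ i j → *-identityˡ _)
    (λ r x i j → trans (*ₘ-scalarMatrix x r i j) (sym (scalarMatrix-*ₘ r x i j)))
    M public

  ^ₘ≈^ : ∀ n → let open MatrixOps (CommutativeRing.rawRing C) in
         M ^ₘ n ≡ SemiringExp._^_ (Ring.semiring matrixRing) M n
  ^ₘ≈^ zero    = ≡.refl
  ^ₘ≈^ (suc n) = ≡.cong (M *ₘ_) (^ₘ≈^ n)
    where open MatrixOps (CommutativeRing.rawRing C)

module _ {C : CommutativeRing a a} {D : CommutativeRing b b} (h : Hom C D) {N : ℕ}
         {M : MatrixOps.Matrix (CommutativeRing.rawRing C) N}
         {M′ : MatrixOps.Matrix (CommutativeRing.rawRing D) N} where
  private
    module C = MatrixSeries C M
    module D = MatrixSeries D M′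
    module DR = CommutativeRing D
    module DM = MatrixProperties D

  hom-at : (∀ i j → ⟦ h ⟧ (M i j) DR.≈ M′ i j) → ∀ n {f g} → (∀ k → ⟦ h ⟧ (f k) DR.≈ g k) →
           ∀ i j → ⟦ h ⟧ (C.at n f i j) DR.≈ D.at n g i j
  hom-at eM zero    e i j = Hom.0#-homo h
  hom-at eM (suc n) {f} {g} e i j = DR.trans (Hom.+-homo h _ _) (DR.+-cong
    (DR.trans (Hom.*-homo h _ _) (DR.*-cong (e 0) (hom-1ₘ h i j)))
    (DR.trans (hom-*ₘ h M (C.at n (f ∘ suc)) i j)
      (DM.*ₘ-cong eM (hom-at eM n (e ∘ suc)) i j)))

module _ {C : CommutativeRing a a} {D : CommutativeRing b b} (h : Hom C D) {N : ℕ} where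
  private
    module D = CommutativeRing D
    module MC = MatrixOps (CommutativeRing.rawRing C)
    module MD = MatrixOps (CommutativeRing.rawRing D)

  hom-^ₘ : ∀ (A : MC.Matrix N) n i j →
           ⟦ h ⟧ ((A MC.^ₘ n) i j) D.≈ ((λ k l → ⟦ h ⟧ (A k l)) MD.^ₘ n) i j
  hom-^ₘ A zero    i j = hom-1ₘ h i j
  hom-^ₘ A (suc n) i j = D.trans (hom-*ₘ h A (A MC.^ₘ n) i j)
    (MatrixProperties.*ₘ-cong D {A = λ k l → ⟦ h ⟧ (A k l)} (λ _ _ → D.refl) (hom-^ₘ A n) i j)

module _ (R : CommutativeRing ℓ ℓ) (N : ℕ) {S : Algebra R ℓ} where
  private
    module S = Algebra S
    module M = MatrixOps S.rawRing
    open Ring (MatrixRing.matrixRing S.ring N) using (setoid)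
    open MatrixProperties S.ring
    open GeneralLinear R N
    open SetoidReasoning setoid

  GL-ext : (g h : AlgHom OGL S) → matrix g M.≈ₘ matrix h → g ≈ₐ h
  GL-ext g h e = point-ext g h e (begin
    Y              ≈⟨ *ₘ-identityʳ Y ⟨
    Y M.*ₘ M.1ₘ            ≈⟨ *ₘ-cong {A = Y} (λ _ _ → S.refl) (matrix-inverseʳ h) ⟨
    Y M.*ₘ (X′ M.*ₘ Y′)    ≈⟨ *ₘ-assoc Y X′ Y′ ⟨
    (Y M.*ₘ X′) M.*ₘ Y′    ≈⟨ *ₘ-cong {B = Y′} (*ₘ-cong {A = Y} (λ _ _ → S.refl) e) (λ _ _ → S.refl) ⟨
    (Y M.*ₘ X) M.*ₘ Y′     ≈⟨ *ₘ-cong {B = Y′} (matrix-inverseˡ g) (λ _ _ → S.refl) ⟩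
    M.1ₘ M.*ₘ Y′           ≈⟨ *ₘ-identityˡ Y′ ⟩
    Y′             ∎)
    where
    X = matrix g
    X′ = matrix h
    Y = inverseMatrix g
    Y′ = inverseMatrix h

-- The matrix (1 + qM)^(t/q) = exp (t log (1 + qM) / q), where q = -w.
module MatrixExponential (C : CommutativeRing a a) (p : ℕ) (1<p : 1 < p) (i : TruncatedReciprocals p C)
                         (w : CommutativeRing.Carrier C) {N : ℕ}
                         (M : MatrixOps.Matrix (CommutativeRing.rawRing C) N)
                         (Mᵖ≈0 : MatrixOps.IsZeroₘ (CommutativeRing.rawRing C)
                                   (MatrixOps._^ₘ_ (CommutativeRing.rawRing C) M p)) where
  open CommutativeRing C renaming (Carrier to Scalar)
  open TruncatedReciprocals i
  open Exponential C p i w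
  open PowerSeries C
  open MatrixOps (CommutativeRing.rawRing C)
  open MatrixProperties C
  private
    module S = MatrixSeries C M
    module MR = Ring S.matrixRing

  E : Scalar → Matrix N
  E t = S.at p (expo t)

  at-⊛ : ∀ f g → S.at p (f ⊛ g) ≈ₘ S.at p f *ₘ S.at p g
  at-⊛ = S.at-⊛ p (≡.subst (λ A → A ≈ₘ (λ _ _ → 0#)) (S.^ₘ≈^ p) Mᵖ≈0)

  E-cong : ∀ {s t} → s ≈ t → E s ≈ₘ E t
  E-cong e = S.at-cong p (expo-cong e)

  E-+ : ∀ s t → E s *ₘ E t ≈ₘ E (s + t)
  E-+ s t i j = trans (sym (at-⊛ (expo s) (expo t) i j))
    (S.at-cong< p {f = expo s ⊛ expo t} (expo-+ s t) i j)

  private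
    at-first : ∀ {n} → 0 < n → ∀ f → (∀ k → f (suc k) ≈ 0#) → S.at n f ≈ₘ S.scalarMatrix (f 0)
    at-first {suc n} _ f e = MR.trans {S.at (suc n) f} {S.at (suc n) (constˢ (f 0))}
      (S.at-cong (suc n) {f} {constˢ (f 0)} (λ { zero → refl ; (suc k) → e k })) (S.at-const n (f 0))

    0<p : 0 < p
    0<p = ℕ.<-trans (s≤s z≤n) 1<p

  E-0 : E 0# ≈ₘ 1ₘ
  E-0 i j = trans (at-first 0<p (expo 0#) expo-0 i j) (*-identityˡ _)

  E-inverse : ∀ t → E t *ₘ E (- t) ≈ₘ 1ₘ
  E-inverse t i j = trans (E-+ t (- t) i j) (trans (E-cong (-‿inverseʳ t) i j) (E-0 i j))

  E-inverse′ : ∀ t → E (- t) *ₘ E t ≈ₘ 1ₘ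
  E-inverse′ t i j = trans (E-+ (- t) t i j) (trans (E-cong (-‿inverseˡ t) i j) (E-0 i j))

  module _ {q : Scalar} (q+w≈0 : q + w ≈ 0#) where
    private
      recip₀ : recip 0 ≈ 1#
      recip₀ = trans (sym (*-identityˡ _)) (trans (*-congʳ (sym (+-identityʳ 1#))) (recip-inv 0 1<p))

      expo-q₁ : expo q 1 ≈ q
      expo-q₁ = trans (*-cong recip₀ (trans (*-identityʳ _) (trans (+-congˡ (zeroˡ _)) (+-identityʳ _))))
        (*-identityˡ _)

      expo-q₂ : ∀ k → expo q (suc (suc k)) ≈ 0#
      expo-q₂ zero    = trans (*-congˡ (trans (*-congʳ
        (trans (+-congˡ (trans (*-congʳ (+-identityʳ _)) (*-identityˡ _))) q+w≈0)) (zeroˡ _))) (zeroʳ _)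
      expo-q₂ (suc k) = trans (*-congˡ (trans (*-congˡ (expo-q₂ k)) (zeroʳ _))) (zeroʳ _)

    -- The coefficient of degree 2 of `expo q` contains q + w = 0, so the series stops at 1 + qT:
    -- the one-parameter group passes through the given unipotent matrix at t = q.
    E-q : ∀ i j → E q i j ≈ 1ₘ i j + q * M i j
    E-q = two 1<p
      where
      two : ∀ {n} → 1 < n → ∀ i j → S.at n (expo q) i j ≈ 1ₘ i j + q * M i j
      two {suc (suc n)} _ i j = +-cong (*-identityˡ _) (trans
        (*ₘ-cong {A = M} (λ _ _ → refl) (at-first {suc n} (s≤s z≤n) (tail (expo q)) expo-q₂) i j)
        (trans (S.*ₘ-scalarMatrix M (expo q 1) i j) (*-congʳ expo-q₁)))
      two {suc zero} (s≤s ())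

module OneParameterGroup {R : CommutativeRing ℓ ℓ} (p : ℕ) (1<p : 1 < p) (i : TruncatedReciprocals p R)
                         (w : CommutativeRing.Carrier R) {N : ℕ}
                         (M : MatrixOps.Matrix (CommutativeRing.rawRing R) N)
                         (Mᵖ≈0 : MatrixOps.IsZeroₘ (CommutativeRing.rawRing R)
                                   (MatrixOps._^ₘ_ (CommutativeRing.rawRing R) M p)) where
  open GeneralLinear R N using (OGL; fromMatrices)

  module At (S : Algebra R ℓ) where
    private
      module S = Algebra S
      module ι = Hom (ι S)
    open MatrixOps S.rawRing

    Mₛ : Matrix N
    Mₛ k l = ⟦ ι S ⟧ (M k l)

    open MatrixExponential S.ring p 1<p (mapReciprocals (ι S) i) (⟦ ι S ⟧ w) Mₛ
      (λ k l → S.trans (S.sym (hom-^ₘ (ι S) M p k l)) (S.trans (ι.⟦⟧-cong (Mᵖ≈0 k l)) ι.0#-homo))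
      public

    point : S.Carrier → AlgHom OGL S
    point t = fromMatrices (E t) (E (S.- t)) (E-inverse t) (E-inverse′ t)

  module _ {S T : Algebra R ℓ} (h : AlgHom S T) where
    private
      module T = Algebra T
      module h = AlgHomOver h

    E-natural : ∀ t k l → (h $ₐ At.E S t k l) T.≈ At.E T (h $ₐ t) k l
    E-natural t = hom-at h.hom {M = At.Mₛ S} {M′ = At.Mₛ T} (λ k l → h.ι-hom (M k l)) p
      (hom-expo h.hom p {mapReciprocals (ι S) i} {mapReciprocals (ι T) i}
        (λ k → h.ι-hom (TruncatedReciprocals.recip i k)) (h.ι-hom w) t)

-- Curves in G

-- Elements of the product of power series f and sequences v such that f is an asymptotic
-- expansion of v along the nodes; two of them are identified if their second components agree.
module Asymptotics (R : CommutativeRing a a) (nodes : ℕ → CommutativeRing.Carrier R) where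
  open CommutativeRing R renaming (Carrier to Scalar)
  open PowerSeries R
  open SetoidReasoning setoid
  open RingProperties (CommutativeRing.ring R) using (-‿distribʳ-*; -‿+-comm)
  private
    module Solver = NatCoefficients commutativeSemiring
  open Solver using (solve; _:=_; _:+_; _:*_)

  -- An expansion to order n with explicit remainders: v is f₀ + f₁ a + ... up to a multiple of aⁿ
  -- at each node a. Keeping the remainders as data allows sums and products to be expanded
  -- recursively.
  Expands : ℕ → Seq → (ℕ → Scalar) → Set a
  Expands zero    f v = Lift a ⊤
  Expands (suc n) f v =
    Σ[ v′ ∈ (ℕ → Scalar) ] (∀ j → v j ≈ f 0 + nodes j * v′ j) × Expands n (tail f) v′

  private
    shorten : ∀ n f v → Expands (suc n) f v → Expands n f v
    shorten zero    f v _              = lift tt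
    shorten (suc n) f v (v′ , e , exp) = v′ , e , shorten n (tail f) v′ exp

    expands-0 : ∀ n → Expands n (λ _ → 0#) (λ _ → 0#)
    expands-0 zero    = lift tt
    expands-0 (suc n) =
      (λ _ → 0#) , (λ j → sym (trans (+-identityˡ _) (zeroʳ _))) , expands-0 n

    expands-const : ∀ n c → Expands n (constˢ c) (λ _ → c)
    expands-const zero    c = lift tt
    expands-const (suc n) c =
      (λ _ → 0#) , (λ j → sym (trans (+-congˡ (zeroʳ _)) (+-identityʳ _))) , expands-0 n

    expands-X : ∀ n → Expands n X nodes
    expands-X zero          = lift tt
    expands-X (suc zero)    = (λ _ → 1#) , (λ j → sym (trans (+-identityˡ _) (*-identityʳ _))) , lift tt
    expands-X (suc (suc n)) = (λ _ → 1#) , (λ j → sym (trans (+-identityˡ _) (*-identityʳ _))) ,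
      (λ _ → 0#) , (λ j → sym (trans (+-congˡ (zeroʳ _)) (+-identityʳ _))) , expands-0 n

    expands-+ : ∀ n {f g v u} → Expands n f v → Expands n g u → Expands n (f ⊹ g) (λ j → v j + u j)
    expands-+ zero    _ _ = lift tt
    expands-+ (suc n) (v′ , e , exp) (u′ , e′ , exp′) = (λ j → v′ j + u′ j) ,
      (λ j → trans (+-cong (e j) (e′ j))
        (solve 5 (λ x y a v u → (x :+ a :* v) :+ (y :+ a :* u) := (x :+ y) :+ a :* (v :+ u)) refl _ _ _ _ _)) ,
      expands-+ n exp exp′

    expands-scale : ∀ n c {f v} → Expands n f v → Expands n (scale c f) (λ j → c * v j)
    expands-scale zero    c _ = lift tt
    expands-scale (suc n) c (v′ , e , exp) = (λ j → c * v′ j) ,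
      (λ j → trans (*-congˡ (e j))
        (solve 4 (λ c x a v → c :* (x :+ a :* v) := c :* x :+ a :* (c :* v)) refl _ _ _ _)) ,
      expands-scale n c exp

    expands-neg : ∀ n {f v} → Expands n f v → Expands n (λ k → - f k) (λ j → - v j)
    expands-neg zero    _ = lift tt
    expands-neg (suc n) (v′ , e , exp) = (λ j → - v′ j) ,
      (λ j → trans (-‿cong (e j)) (trans (sym (-‿+-comm _ _)) (+-congˡ (-‿distribʳ-* _ _)))) ,
      expands-neg n exp

    expands-⊛ : ∀ n {f g v u} → Expands n f v → Expands n g u → Expands n (f ⊛ g) (λ j → v j * u j)
    expands-⊛ zero    _ _ = lift tt
    expands-⊛ (suc n) {f} {g} {v} {u} (v′ , e , exp) exp-g@(u′ , e′ , exp′) =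
      (λ j → f 0 * u′ j + v′ j * u j) ,
      (λ j → begin
        v j * u j
          ≈⟨ *-congʳ (e j) ⟩
        (f 0 + nodes j * v′ j) * u j
          ≈⟨ distribʳ _ _ _ ⟩
        f 0 * u j + nodes j * v′ j * u j
          ≈⟨ +-congʳ (*-congˡ (e′ j)) ⟩
        f 0 * (g 0 + nodes j * u′ j) + nodes j * v′ j * u j
          ≈⟨ solve 6 (λ x y a u′ v′ u → x :* (y :+ a :* u′) :+ a :* v′ :* u :=
                                         x :* y :+ a :* (x :* u′ :+ v′ :* u)) refl _ _ _ _ _ _ ⟩
        f 0 * g 0 + nodes j * (f 0 * u′ j + v′ j * u j)
          ∎) ,
      expands-+ n (expands-scale n (f 0) exp′) (expands-⊛ n exp (shorten n g u exp-g))

  record Expansion : Set a where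
    constructor expansion
    field
      coefficients : Seq
      values       : ℕ → Scalar
      expands      : ∀ n → Expands n coefficients values
  open Expansion public

  -- Since equality only looks at values, an equation can be verified node by node, and
  -- `coefficientsHom` then transfers it to power series.
  expansionRing : CommutativeRing a a
  expansionRing .CommutativeRing.Carrier = Expansion
  expansionRing .CommutativeRing._≈_ x y = ∀ j → values x j ≈ values y j
  expansionRing .CommutativeRing._+_ x y =
    expansion _ (λ j → values x j + values y j) (λ n → expands-+ n (expands x n) (expands y n))
  expansionRing .CommutativeRing._*_ x y =
    expansion _ (λ j → values x j * values y j) (λ n → expands-⊛ n (expands x n) (expands y n))
  expansionRing .CommutativeRing.-_ x =
    expansion _ (λ j → - values x j) (λ n → expands-neg n (expands x n))
  expansionRing .CommutativeRing.0# = expansion _ (λ _ → 0#) expands-0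
  expansionRing .CommutativeRing.1# = expansion _ (λ _ → 1#) (λ n → expands-const n 1#)
  expansionRing .CommutativeRing.isCommutativeRing = record
    { isRing = record
      { +-isAbelianGroup = record
        { isGroup = record
          { isMonoid = record
            { isSemigroup = record
              { isMagma = record
                { isEquivalence = record
                  { refl = λ _ → refl ; sym = λ e j → sym (e j) ; trans = λ e f j → trans (e j) (f j) }
                ; ∙-cong = λ e f j → +-cong (e j) (f j)
                }
              ; assoc = λ _ _ _ _ → +-assoc _ _ _
              }
            ; identity = (λ _ _ → +-identityˡ _) , (λ _ _ → +-identityʳ _)
            }
          ; inverse = (λ _ _ → -‿inverseˡ _) , (λ _ _ → -‿inverseʳ _)
          ; ⁻¹-cong = λ e j → -‿cong (e j)
          }
        ; comm = λ _ _ _ → +-comm _ _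
        }
      ; *-cong = λ e f j → *-cong (e j) (f j)
      ; *-assoc = λ _ _ _ _ → *-assoc _ _ _
      ; *-identity = (λ _ _ → *-identityˡ _) , (λ _ _ → *-identityʳ _)
      ; distrib = (λ _ _ _ _ → distribˡ _ _ _) , (λ _ _ _ _ → distribʳ _ _ _)
      }
    ; *-comm = λ _ _ _ → *-comm _ _
    }

  constantExpansion : Hom R expansionRing
  constantExpansion = mkHom R expansionRing (λ c → expansion _ (λ _ → c) (λ n → expands-const n c))
    (λ e _ → e) (λ _ _ _ → refl) (λ _ _ _ → refl) (λ _ → refl)

  variableExpansion : Expansion
  variableExpansion = expansion X nodes expands-X

  valueAt : ℕ → Hom expansionRing R
  valueAt j = mkHom expansionRing R (λ x → values x j)
    (λ e → e j) (λ _ _ → refl) (λ _ _ → refl) refl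

  module _ (nodes-cancel : ∀ j x → nodes j * x ≈ 0# → x ≈ 0#)
           (nodes→0 : ∀ c → (∀ j → Σ[ x ∈ Scalar ] c ≈ nodes j * x) → c ≈ 0#) where

    private
      -- Uniqueness of expansions: f₀ is a multiple of every node, hence 0; cancelling the node
      -- leaves a remainder sequence that vanishes and expands to the tail.
      vanishing : ∀ n f v → Expands (suc n) f v → (∀ j → v j ≈ 0#) → f n ≈ 0#
      vanishing n f v (v′ , e , exp) v≈0 = continue n exp
        where
        f₀≈0 : f 0 ≈ 0#
        f₀≈0 = nodes→0 (f 0) (λ j → - v′ j , (begin
          f 0                                   ≈⟨ +-identityʳ _ ⟨
          f 0 + 0#                              ≈⟨ +-congˡ (-‿inverseʳ _) ⟨
          f 0 + (nodes j * v′ j - nodes j * v′ j) ≈⟨ +-assoc _ _ _ ⟨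
          f 0 + nodes j * v′ j - nodes j * v′ j ≈⟨ +-congʳ (trans (sym (e j)) (v≈0 j)) ⟩
          0# - nodes j * v′ j                   ≈⟨ +-identityˡ _ ⟩
          - (nodes j * v′ j)                    ≈⟨ -‿distribʳ-* _ _ ⟩
          nodes j * - v′ j                      ∎))

        v′≈0 : ∀ j → v′ j ≈ 0#
        v′≈0 j = nodes-cancel j (v′ j) (begin
          nodes j * v′ j        ≈⟨ +-identityˡ _ ⟨
          0# + nodes j * v′ j   ≈⟨ +-congʳ f₀≈0 ⟨
          f 0 + nodes j * v′ j  ≈⟨ e j ⟨
          v j                   ≈⟨ v≈0 j ⟩
          0#                    ∎)

        continue : ∀ n → Expands n (tail f) v′ → f n ≈ 0#
        continue zero    _   = f₀≈0
        continue (suc n) exp = vanishing n (tail f) v′ exp v′≈0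

    coefficientsHom : Hom expansionRing series
    coefficientsHom = mkHom expansionRing series coefficients
      (λ {x} {y} e n → difference-zero (coefficients x n) (coefficients y n)
        (vanishing n (coefficients (x -ₑ y)) (values (x -ₑ y)) (expands (x -ₑ y) (suc n))
          (λ j → trans (+-congʳ (e j)) (-‿inverseʳ _))))
      (λ _ _ _ → refl) (λ _ _ _ → refl) (λ _ → refl)
      where
      open CommutativeRing expansionRing using () renaming (_-_ to _-ₑ_)
      difference-zero : ∀ x y → x - y ≈ 0# → x ≈ y
      difference-zero x y e = begin
        x             ≈⟨ +-identityʳ x ⟨
        x + 0#        ≈⟨ +-congˡ (-‿inverseˡ y) ⟨
        x + (- y + y) ≈⟨ +-assoc _ _ _ ⟨
        x - y + y     ≈⟨ +-congʳ e ⟩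
        0# + y        ≈⟨ +-identityˡ y ⟩
        y             ∎

-- The substitution f(T) ↦ f(T + ε) = f + ε f′.
taylorHom : (C : CommutativeRing ℓ ℓ) → Hom (PowerSeries.series C) (dual (PowerSeries.series C))
taylorHom C = mkHom series (dual series) (λ f → f , derivative f)
  (λ e → e , λ n → *-congˡ (e (suc n)))
  (λ _ _ → (λ _ → refl) , λ n → distribˡ _ _ _)
  (λ f g → (λ _ → refl) , λ n → trans (derivative-⊛ f g n) (+-comm _ _))
  ((λ _ → refl) , derivative-constˢ 1#)
  where
  open CommutativeRing C
  open PowerSeries C

module _ {K : CommutativeRing ℓ ℓ} where

  seriesₐ : Algebra K ℓ → Algebra K ℓ
  seriesₐ S .ring = PowerSeries.series (ring S)
  seriesₐ S .ι    = PowerSeries.constant (ring S) ∘ₕ ι S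

  mapSeriesₐ : {S T : Algebra K ℓ} → AlgHom S T → AlgHom (seriesₐ S) (seriesₐ T)
  mapSeriesₐ {S} {T} h = record
    { hom   = mapSeries h.hom
    ; ι-hom = λ k n → T.trans (hom-constˢ h.hom (⟦ ι S ⟧ k) n)
        (Hom.⟦⟧-cong (PowerSeries.constant (ring T)) (h.ι-hom k) n)
    }
    where
    module h = AlgHomOver h
    module T = Algebra T

  mapDualₐ : {S T : Algebra K ℓ} → AlgHom S T → AlgHom (dualₐ S) (dualₐ T)
  mapDualₐ {S} {T} h = record
    { hom = mkHom (dual (ring S)) (dual (ring T)) (λ (r , s) → (h $ₐ r) , (h $ₐ s))
        (λ (e , f) → h.⟦⟧-cong e , h.⟦⟧-cong f)
        (λ _ _ → h.+-homo _ _ , h.+-homo _ _)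
        (λ _ _ → h.*-homo _ _ , T.trans (h.+-homo _ _) (T.+-cong (h.*-homo _ _) (h.*-homo _ _)))
        (h.1#-homo , h.0#-homo)
    ; ι-hom = λ k → h.ι-hom k , h.0#-homo
    }
    where
    module h = AlgHomOver h
    module T = Algebra T

  structureMap : (S : Algebra K ℓ) → AlgHom (self K) S
  structureMap S = record { hom = ι S ; ι-hom = λ _ → Algebra.refl S }

  taylor : (S : Algebra K ℓ) → AlgHom (seriesₐ S) (dualₐ (seriesₐ S))
  taylor S = record
    { hom = taylorHom (ring S)
    ; ι-hom = λ k → (λ _ → S.refl) , derivative-constˢ (⟦ ι S ⟧ k)
    }
    where
    module S = Algebra S
    open PowerSeries S.ring

  -- The substitution T = ε.
  firstOrder : (S : Algebra K ℓ) → AlgHom (seriesₐ S) (dualₐ S)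
  firstOrder S = record
    { hom = mkHom series (dual S.ring) (λ f → f 0 , f 1)
        (λ e → e 0 , e 1)
        (λ _ _ → S.refl , S.refl)
        (λ _ _ → S.refl , S.refl)
        (S.refl , S.refl)
    ; ι-hom = λ k → S.refl , S.refl
    }
    where
    module S = Algebra S
    open PowerSeries S.ring

  constantₐ : (S : Algebra K ℓ) → AlgHom S (seriesₐ S)
  constantₐ S = record { hom = PowerSeries.constant (ring S) ; ι-hom = λ _ _ → Algebra.refl S }

  leadingₐ : (S : Algebra K ℓ) → AlgHom (seriesₐ S) S
  leadingₐ S = record { hom = PowerSeries.leading (ring S) ; ι-hom = λ _ → Algebra.refl S }

  module _ {H A B : Algebra K ℓ} (q : AlgHom H A)
           (surjective : ∀ r → Σ[ s ∈ Algebra.Carrier H ] Algebra._≈_ A (q $ₐ s) r)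
           (g : AlgHom H B)
           (compatible : ∀ s t → Algebra._≈_ A (q $ₐ s) (q $ₐ t) → Algebra._≈_ B (g $ₐ s) (g $ₐ t))
           where
    private
      module A = Algebra A
      module B = Algebra B
      module H = Algebra H
      module q = AlgHomOver q
      module g = AlgHomOver g
      pre : A.Carrier → H.Carrier
      pre r = proj₁ (surjective r)
      q-pre : ∀ r → (q $ₐ pre r) A.≈ r
      q-pre r = proj₂ (surjective r)

    descend : AlgHom A B
    descend = record
      { hom = mkHom (ring A) (ring B) (λ r → g $ₐ pre r)
          (λ e → compatible _ _ (A.trans (q-pre _) (A.trans e (A.sym (q-pre _)))))
          (λ r s → B.trans (compatible _ (pre r H.+ pre s)
            (A.trans (q-pre _) (A.sym (A.trans (q.+-homo _ _) (A.+-cong (q-pre r) (q-pre s))))))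
            (g.+-homo _ _))
          (λ r s → B.trans (compatible _ (pre r H.* pre s)
            (A.trans (q-pre _) (A.sym (A.trans (q.*-homo _ _) (A.*-cong (q-pre r) (q-pre s))))))
            (g.*-homo _ _))
          (B.trans (compatible _ H.1# (A.trans (q-pre _) (A.sym q.1#-homo))) g.1#-homo)
      ; ι-hom = λ k → B.trans (compatible _ (⟦ ι H ⟧ k) (A.trans (q-pre _) (A.sym (q.ι-hom k)))) (g.ι-hom k)
      }

    descend-∘ : (descend ∘ₐ q) ≈ₐ g
    descend-∘ s = compatible _ s (q-pre _)

-- The one-parameter group inside G

module EmbeddedOneParameterGroup
  {R : CommutativeRing ℓ ℓ} (p : ℕ) (1<p : 1 < p) (i : TruncatedReciprocals p R)
  (q : CommutativeRing.Carrier R) {N : ℕ}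
  (M : MatrixOps.Matrix (CommutativeRing.rawRing R) N)
  (Mᵖ≈0 : MatrixOps.IsZeroₘ (CommutativeRing.rawRing R) (MatrixOps._^ₘ_ (CommutativeRing.rawRing R) M p))
  (G : AffineGroupScheme R) (e : ClosedEmbedding G (GeneralLinear.GL R N)) where

  private
    module R = CommutativeRing R
    module G = AffineGroupScheme G
    module e = ClosedEmbedding e
    module GL = AffineGroupScheme (GeneralLinear.GL R N)
    O = G.O
    module GLPoints = PointGroups (GeneralLinear.GL R N)
  open PointGroups G
  open GeneralLinear R N using (OGL; matrix)
  open OneParameterGroup p 1<p i (R.- q) M Mᵖ≈0

  onPoints-injective : {S : Algebra R ℓ} (g h : G.Point S) → e.onPoints g ≈ₐ e.onPoints h → g ≈ₐ h
  onPoints-injective {S} g h eq x with s , es≈x ← e.surjective x =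
    S.trans (S.sym (AlgHomOver.⟦⟧-cong g es≈x)) (S.trans (eq s) (AlgHomOver.⟦⟧-cong h es≈x))
    where module S = Algebra S

  onPoints-ε : (S : Algebra R ℓ) → e.onPoints (G.ε {S}) ≈ₐ GL.ε {S}
  onPoints-ε S = identityˡ-unique (e.onPoints G.ε) (e.onPoints G.ε) (begin
    e.onPoints G.ε GL.∙ e.onPoints G.ε  ≈⟨ e.homomorphic {S} G.ε G.ε ⟨
    e.onPoints (G.ε G.∙ G.ε)            ≈⟨ (λ x → GS.identityˡ G.ε (e.comorphism $ₐ x)) ⟩
    e.onPoints G.ε                      ∎)
    where
    module GS = Group (pointGroup S)
    module GLS = Group (GLPoints.pointGroup S)
    open GroupProperties (GLPoints.pointGroup S) using (identityˡ-unique)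
    open SetoidReasoning GLS.setoid

  -- The embedding sends g to E(t). By `exp-unique` an equation between such points of G reduces to
  -- an equation between their parameters, and products of points correspond to sums of parameters.
  IsExp : (S : Algebra R ℓ) → G.Point S → Algebra.Carrier S → Set ℓ
  IsExp S g t = ∀ k l → matrix {S} (e.onPoints g) k l S.≈ At.E S t k l
    where module S = Algebra S

  module _ (S : Algebra R ℓ) where
    private
      module S = Algebra S

    exp-unique : ∀ g h {s t} → IsExp S g s → IsExp S h t → s S.≈ t → g ≈ₐ h
    exp-unique g h eg eh s≈t = onPoints-injective g h
      (GL-ext R N {S} (e.onPoints g) (e.onPoints h)
        (λ k l → S.trans (eg k l) (S.trans (At.E-cong S s≈t k l) (S.sym (eh k l)))))

    exp-∙ : ∀ g h {s t} → IsExp S g s → IsExp S h t → IsExp S (g G.∙ h) (s S.+ t)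
    exp-∙ g h {s} {t} eg eh k l = S.trans (e.homomorphic g h (var (mat k l)))
      (S.trans (MatrixProperties.*ₘ-cong S.ring eg eh k l) (At.E-+ S s t k l))

    exp-cong : ∀ g {s t} → s S.≈ t → IsExp S g s → IsExp S g t
    exp-cong g s≈t eg k l = S.trans (eg k l) (At.E-cong S s≈t k l)

    exp-ε : IsExp S G.ε S.0#
    exp-ε k l = S.trans (onPoints-ε S (var (mat k l))) (S.sym (At.E-0 S k l))

    exp-natural : (T : Algebra R ℓ) (h : AlgHom S T) → ∀ g {t} → IsExp S g t → IsExp T (h ∘ₐ g) (h $ₐ t)
    exp-natural T h g {t} eg k l =
      T.trans (AlgHomOver.⟦⟧-cong h (eg k l)) (E-natural h t k l)
      where module T = Algebra T

  module _ (nodes-cancel : ∀ j x → nat R (p ℕ.^ j) R.* q R.* x R.≈ R.0# → x R.≈ R.0#)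
           (nodes→0 : ∀ c → (∀ j → Σ[ x ∈ R.Carrier ] c R.≈ nat R (p ℕ.^ j) R.* q R.* x) → c R.≈ R.0#)
           (u : G.Point (self R))
           (u-matrix : ∀ k l → pointMatrix G e u k l R.≈
                               MatrixOps.1ₘ (CommutativeRing.rawRing R) k l R.+ q R.* M k l) where

    private
      power : ℕ → G.Point (self R)
      power zero    = G.ε
      power (suc m) = u G.∙ power m

      exp-u : IsExp (self R) u q
      exp-u k l = R.trans (u-matrix k l) (R.sym (At.E-q (self R) (R.-‿inverseʳ q) k l))

      exp-power : ∀ m → IsExp (self R) (power m) (nat R m R.* q)
      exp-power zero    = exp-cong (self R) G.ε (R.sym (R.zeroˡ q)) (exp-ε (self R))
      exp-power (suc m) = exp-cong (self R) (u G.∙ power m)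
        (R.sym (R.trans (R.distribʳ _ _ _) (R.+-congʳ (R.*-identityˡ q))))
        (exp-∙ (self R) u (power m) exp-u (exp-power m))

    -- The node pʲ q is the parameter of the power of u with exponent pʲ, a point of G; these nodes
    -- tend to 0 p-adically.
    open Asymptotics R (λ j → nat R (p ℕ.^ j) R.* q)

    private
      𝓠 : Algebra R ℓ
      𝓠 .ring = expansionRing
      𝓠 .ι    = constantExpansion

      value : ℕ → AlgHom 𝓠 (self R)
      value j = record { hom = valueAt j ; ι-hom = λ _ → R.refl }

      coefficientsₐ : AlgHom 𝓠 (seriesₐ (self R))
      coefficientsₐ = record
        { hom = coefficientsHom nodes-cancel nodes→0 ; ι-hom = λ _ _ → R.refl }

      exp-𝓠 : AlgHom OGL 𝓠
      exp-𝓠 = At.point 𝓠 variableExpansion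

      at-node : ∀ j → (value j ∘ₐ exp-𝓠) ≈ₐ e.onPoints (power (p ℕ.^ j))
      at-node j = GL-ext R N {self R} (value j ∘ₐ exp-𝓠) (e.onPoints (power (p ℕ.^ j)))
        (λ k l → R.trans (E-natural (value j) variableExpansion k l) (R.sym (exp-power (p ℕ.^ j) k l)))

      -- The equations of G vanish at the powers u ^ (p ^ j), hence identically along the curve.
      compatible : ∀ s t → Algebra._≈_ O (e.comorphism $ₐ s) (e.comorphism $ₐ t) →
                   Algebra._≈_ 𝓠 (exp-𝓠 $ₐ s) (exp-𝓠 $ₐ t)
      compatible s t eq j = R.trans (at-node j s)
        (R.trans (AlgHomOver.⟦⟧-cong (power (p ℕ.^ j)) eq) (R.sym (at-node j t)))

      curve-𝓠 : G.Point 𝓠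
      curve-𝓠 = descend {A = O} {B = 𝓠} e.comorphism e.surjective exp-𝓠 compatible

    curve : G.Point (seriesₐ (self R))
    curve = coefficientsₐ ∘ₐ curve-𝓠

    exp-curve : IsExp (seriesₐ (self R)) curve (PowerSeries.X R)
    exp-curve = exp-natural 𝓠 (seriesₐ (self R)) coefficientsₐ curve-𝓠
      (λ k l → descend-∘ {A = O} {B = 𝓠} e.comorphism e.surjective exp-𝓠 compatible (var (mat k l)))

    tangent : G.Point (dualₐ (self R))
    tangent = firstOrder (self R) ∘ₐ curve

    exp-tangent : IsExp (dualₐ (self R)) tangent (R.0# , R.1#)
    exp-tangent = exp-natural (seriesₐ (self R)) (dualₐ (self R)) (firstOrder (self R)) curve exp-curve

    private
      leading-curve : (leadingₐ (self R) ∘ₐ curve) ≈ₐ G.ε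
      leading-curve = exp-unique (self R) (leadingₐ (self R) ∘ₐ curve) G.ε
        (exp-natural (seriesₐ (self R)) (self R) (leadingₐ (self R)) curve exp-curve)
        (exp-ε (self R)) R.refl

    tangent-at-ε : ∀ x → proj₁ (tangent $ₐ x) R.≈ (G.ε $ₐ x)
    tangent-at-ε = leading-curve

    module _ (S : Algebra R ℓ) where
      private
        module S = Algebra S
        V = seriesₐ S
        module V = Algebra V
        open PowerSeries S.ring

        fromBase : AlgHom (self R) V
        fromBase = constantₐ S ∘ₐ structureMap S

      curveOver : G.Point V
      curveOver = mapSeriesₐ (structureMap S) ∘ₐ curve

      tangentOver : G.Point (dualₐ V)
      tangentOver = mapDualₐ fromBase ∘ₐ tangent

      private
        exp-curveOver : IsExp V curveOver X
        exp-curveOver = exp-cong V curveOver mapped-X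
          (exp-natural (seriesₐ (self R)) V (mapSeriesₐ (structureMap S)) curve exp-curve)
          where
          mapped-X : ∀ n → ⟦ ι S ⟧ (PowerSeries.X R n) S.≈ X n
          mapped-X zero          = Hom.0#-homo (ι S)
          mapped-X (suc zero)    = Hom.1#-homo (ι S)
          mapped-X (suc (suc n)) = Hom.0#-homo (ι S)

        derivative-X : derivative X ≗ constˢ S.1#
        derivative-X zero    = S.trans (S.*-identityʳ _) (S.+-identityʳ _)
        derivative-X (suc n) = S.zeroʳ _

      curveOver-constant : ∀ x → (curveOver $ₐ x) 0 S.≈ ⟦ ι S ⟧ (G.ε $ₐ x)
      curveOver-constant x = Hom.⟦⟧-cong (ι S) (leading-curve x)

      -- curve (t + ε) = curve t · curve ε
      taylor-curve : (taylor S ∘ₐ curveOver) ≈ₐ ((toDual V ∘ₐ curveOver) G.∙ tangentOver)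
      taylor-curve = exp-unique (dualₐ V) (taylor S ∘ₐ curveOver) ((toDual V ∘ₐ curveOver) G.∙ tangentOver)
        (exp-natural V (dualₐ V) (taylor S) curveOver exp-curveOver)
        (exp-∙ (dualₐ V) (toDual V ∘ₐ curveOver) tangentOver
          (exp-natural V (dualₐ V) (toDual V) curveOver exp-curveOver)
          (exp-natural (dualₐ (self R)) (dualₐ V) (mapDualₐ fromBase) tangent exp-tangent))
        -- Both points have the parameter T + ε: on the left by Taylor expansion of T, on the right
        -- as the sum of T and ε.
        ((λ n → S.sym (S.trans (S.+-congˡ (V.trans constant-ι0 const-0 n)) (S.+-identityʳ _))) ,
         (λ n → S.sym (S.trans (S.+-identityˡ _) (S.trans (constant-ι1 n) (S.sym (derivative-X n))))))
        where
        constant-ι0 : (fromBase $ₐ R.0#) V.≈ constˢ S.0#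
        constant-ι0 = Hom.⟦⟧-cong constant (Hom.0#-homo (ι S))

        const-0 : constˢ S.0# V.≈ V.0#
        const-0 = Hom.0#-homo constant

        constant-ι1 : (fromBase $ₐ R.1#) V.≈ constˢ S.1#
        constant-ι1 = Hom.⟦⟧-cong constant (Hom.1#-homo (ι S))

module DualNumbers (R : CommutativeRing ℓ ℓ) where
  open CommutativeRing R hiding (zero; ring)
  private
    module D = CommutativeRing (dual R)

  η : Carrier → D.Carrier
  η x = 0# , x

  η-+ : ∀ x y → η (x + y) D.≈ η x D.+ η y
  η-+ x y = sym (+-identityˡ _) , refl

  *-η : ∀ z x → z D.* η x D.≈ η (proj₁ z * x)
  *-η (z₀ , z₁) x = zeroʳ _ , trans (+-congˡ (zeroʳ _)) (+-identityʳ _)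

  η-sum : ∀ {n} (x : Fin n → Carrier) →
          SemiringSum.sum D.semiring (η ∘ x) D.≈ η (SemiringSum.sum semiring x)
  η-sum {zero}  x = refl , refl
  η-sum {suc n} x = D.trans (D.+-congˡ {η (x zero)} (η-sum (x ∘ suc)))
                            (D.sym {η (x zero + SemiringSum.sum semiring (x ∘ suc))} (η-+ _ _))

  proj₁-nat : ∀ n → proj₁ (nat (dual R) n) ≈ nat R n
  proj₁-nat zero    = refl
  proj₁-nat (suc n) = +-congˡ (proj₁-nat n)

module _ {R : CommutativeRing ℓ ℓ} (p : ℕ) (1<p : 1 < p) (i : TruncatedReciprocals p R)
         (w : CommutativeRing.Carrier R) {N : ℕ}
         (M : MatrixOps.Matrix (CommutativeRing.rawRing R) N)
         (Mᵖ≈0 : MatrixOps.IsZeroₘ (CommutativeRing.rawRing R)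
                   (MatrixOps._^ₘ_ (CommutativeRing.rawRing R) M p)) where
  open CommutativeRing R hiding (zero; ring)
  open DualNumbers R
  open TruncatedReciprocals i
  open OneParameterGroup p 1<p i w M Mᵖ≈0
  private
    T = dualₐ (self R)
    module D = CommutativeRing (dual R)
    module MR = MatrixOps (CommutativeRing.rawRing R)
    module A = MatrixSeries R M
    module B = MatrixSeries (dual R) (At.Mₛ T)
    module ED = Exponential (dual R) p (mapReciprocals (ι T) i) (⟦ ι T ⟧ w)
    ε : D.Carrier
    ε = 0# , 1#

    -- expo ε = 1 + ε T u
    u : ℕ → Carrier
    u zero    = recip 0
    u (suc k) = recip (suc k) * (nat R (suc k) * w * u k)

    expo-ε : ∀ k → ED.expo ε (suc k) D.≈ η (u k)
    expo-ε zero = D.trans (D.*-congˡ {recip 0 , 0#} one) (D.trans (*-η (recip 0 , 0#) 1#)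
      (refl , *-identityʳ _))
      where
      one : (ε D.+ nat (dual R) 0 D.* ⟦ ι T ⟧ w) D.* D.1# D.≈ η 1#
      one = D.trans (D.*-identityʳ (ε D.+ nat (dual R) 0 D.* ⟦ ι T ⟧ w))
        (trans (+-congˡ (zeroˡ _)) (+-identityʳ _) ,
         trans (+-congˡ (trans (+-cong (zeroˡ _) (zeroˡ _)) (+-identityʳ _))) (+-identityʳ _))
    expo-ε (suc k) = D.trans (D.*-congˡ {recip (suc k) , 0#}
        (D.trans (D.*-congˡ {ε D.+ nat (dual R) (suc k) D.* ⟦ ι T ⟧ w} (expo-ε k))
                 (*-η (ε D.+ nat (dual R) (suc k) D.* ⟦ ι T ⟧ w) (u k))))
      (D.trans (*-η (recip (suc k) , 0#) _)
        (refl , *-congˡ (*-congʳ (trans (+-identityˡ _) (*-congʳ (proj₁-nat (suc k)))))))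

    at-η : ∀ n (f : ℕ → Carrier) k l → B.at n (η ∘ f) k l D.≈ η (A.at n f k l)
    at-η zero    f k l = refl , refl
    at-η (suc n) f k l = D.trans (D.+-cong first rest) (D.sym {η (A.at (suc n) f k l)} (η-+ _ _))
      where
      first : η (f 0) D.* MatrixOps.1ₘ D.rawRing k l D.≈ η (f 0 * MR.1ₘ k l)
      first = D.trans (D.*-comm (η (f 0)) (MatrixOps.1ₘ D.rawRing k l))
        (D.trans (*-η (MatrixOps.1ₘ D.rawRing k l) (f 0))
          (refl , trans (*-congʳ (proj₁ (D.sym (hom-1ₘ (ι T) k l)))) (*-comm _ _)))

      rest : MatrixOps._*ₘ_ D.rawRing (At.Mₛ T) (B.at n (η ∘ f ∘ suc)) k l D.≈
             η ((M MR.*ₘ A.at n (f ∘ suc)) k l)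
      rest = D.trans (SemiringSum.sum-cong-≋ D.semiring (λ j →
          D.trans (D.*-congˡ {At.Mₛ T k j} (at-η n (f ∘ suc) j l)) (*-η (At.Mₛ T k j) _)))
        (η-sum (λ j → M k j * A.at n (f ∘ suc) j l))

    tangent-E : ∀ n → suc n ≡ p → ∀ k l → proj₂ (At.E T ε k l) ≈ (M MR.*ₘ A.at n u) k l
    tangent-E n ≡.refl k l = trans
      (+-cong (proj₂ (D.trans (D.*-identityˡ (MatrixOps.1ₘ D.rawRing k l)) (D.sym (hom-1ₘ (ι T) k l))))
        (proj₂ (D.trans
          (MatrixProperties.*ₘ-cong (dual R) {A = At.Mₛ T} (λ _ _ → D.refl)
            (λ j l → D.trans (B.at-cong n {ED.expo ε ∘ suc} {η ∘ u} expo-ε j l) (at-η n u j l)) k l)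
          (D.trans (SemiringSum.sum-cong-≋ D.semiring (λ j → *-η (At.Mₛ T k j) (A.at n u j l)))
            (η-sum (λ j → M k j * A.at n u j l))))))
      (+-identityˡ _)

    u-unit : IsUnit (PowerSeries.series R) u
    u-unit = PowerSeries.leading-unit⇒unit R u (nat R 1 , trans (*-comm _ _) (recip-inv 0 1<p))

  -- The velocity is M u(M), the truncation of - log(1 - wM)/w. As u has an invertible constant
  -- term, M is recovered by the inverse series, so a velocity divisible by p would force M to be
  -- divisible by p.
  M-from-tangent : Σ[ Y ∈ MR.Matrix N ] M MR.≈ₘ ((λ k l → proj₂ (At.E T ε k l)) MR.*ₘ Y)
  M-from-tangent = A.at p y , below 1<p ≡.refl
    where
    y = proj₁ u-unit
    below : ∀ {m} → 1 < m → m ≡ p → M MR.≈ₘ ((λ k l → proj₂ (At.E T ε k l)) MR.*ₘ A.at p y)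
    below {suc n} _ e k l = trans
      (sym (A.m-at-unit p (≡.subst (λ X → X MR.≈ₘ (λ _ _ → 0#)) (A.^ₘ≈^ p) Mᵖ≈0) n u y e (proj₂ u-unit) k l))
      (MatrixProperties.*ₘ-cong R {B = A.at p y} (λ k l → sym (tangent-E n e k l)) (λ _ _ → refl) k l)

-- Lie invariance along a curve

module FrobeniusPullback (C : CommutativeRing ℓ ℓ) (p : ℕ) (1<p : 1 < p) (i : TruncatedReciprocals p C)
  (p²≈0 : CommutativeRing._≈_ C (CommutativeRing._*_ C (nat C p) (nat C p)) (CommutativeRing.0# C)) where
  open CommutativeRing C renaming (Carrier to Scalar) hiding (zero)
  open PowerSeries C
  open SetoidReasoning setoid
  open Exp commutativeSemiring
  private
    V = series
    module V = CommutativeRing V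
    module VE = Exp V.commutativeSemiring
    module CC = Carry C p 1<p i
    module VC = Carry V p 1<p (mapReciprocals constant i)
    module Solver = NatCoefficients commutativeSemiring
    π = nat C p
  open Solver using (solve; _:=_; _:+_; _:*_)
  open RingProperties (CommutativeRing.ring C) using (-‿distribʳ-*)
  open AbelianGroupProperties +-abelianGroup using (inverseˡ-unique)

  private
    0<p : 0 < p
    0<p = ℕ.<-trans (s≤s z≤n) 1<p

    0^ : ∀ {m} → 0 < m → 0# ^ m ≈ 0#
    0^ {suc m} _ = zeroˡ _

    πx*πy≈0 : ∀ x y → (π * x) * (π * y) ≈ 0#
    πx*πy≈0 x y = trans (solve 3 (λ n x y → (n :* x) :* (n :* y) := (n :* n) :* (x :* y)) refl _ _ _)
      (trans (*-congʳ p²≈0) (zeroˡ _))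

    π*[x+πy] : ∀ x y → π * (x + π * y) ≈ π * x
    π*[x+πy] x y = trans (solve 3 (λ n x y → n :* (x :+ n :* y) := n :* x :+ (n :* n) :* y) refl _ _ _)
      (trans (+-congˡ (trans (*-congʳ p²≈0) (zeroˡ _))) (+-identityʳ _))

    π-freshman : ∀ x y → π * (x + y) ^ p ≈ π * x ^ p + π * y ^ p
    π-freshman x y = trans (*-congˡ (CC.freshman x y)) (trans (π*[x+πy] _ _) (distribˡ _ _ _))

    Divisible : Scalar → Set _
    Divisible x = Σ[ y ∈ Scalar ] x ≈ π * y

    divisible-+ : ∀ {x y} → Divisible x → Divisible y → Divisible (x + y)
    divisible-+ (u , e) (v , f) = u + v , trans (+-cong e f) (sym (distribˡ _ _ _))

    divisible-* : ∀ x {y} → Divisible y → Divisible (x * y)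
    divisible-* x (v , f) = x * v ,
      trans (*-congˡ f) (solve 3 (λ x n v → x :* (n :* v) := n :* (x :* v)) refl _ _ _)

    divisible-⊛ : ∀ k f g → (∀ j → j ≤ k → Divisible (g j)) → Divisible ((f ⊛ g) k)
    divisible-⊛ zero    f g dg = divisible-* (f 0) (dg 0 z≤n)
    divisible-⊛ (suc k) f g dg = divisible-+ (divisible-* (f 0) (dg (suc k) ℕ.≤-refl))
      (divisible-⊛ k (tail f) g (λ j j≤k → dg j (ℕ.m≤n⇒m≤1+n j≤k)))

    divisible-⊛≈0 : ∀ k f g → (∀ j → j ≤ k → Divisible (f j)) → (∀ j → j ≤ k → Divisible (g j)) →
                    (f ⊛ g) k ≈ 0#
    divisible-⊛≈0 zero    f g df dg = trans (*-cong (proj₂ (df 0 z≤n)) (proj₂ (dg 0 z≤n))) (πx*πy≈0 _ _)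
    divisible-⊛≈0 (suc k) f g df dg = trans (+-cong
      (trans (*-cong (proj₂ (df 0 z≤n)) (proj₂ (dg (suc k) ℕ.≤-refl))) (πx*πy≈0 _ _))
      (divisible-⊛≈0 k (tail f) g (λ j j≤k → df (suc j) (s≤s j≤k)) (λ j j≤k → dg j (ℕ.m≤n⇒m≤1+n j≤k))))
      (+-identityˡ _)

    natV-⊛ : ∀ f k → (nat V p ⊛ f) k ≈ π * f k
    natV-⊛ f k = trans (⊛-cong {g = f} (V.sym {constˢ π} {nat V p} (hom-nat constant p)) (λ _ → refl) k)
      (constˢ-⊛ π f k)

    X^-below : ∀ m f k → k < m → ((X VE.^ m) ⊛ f) k ≈ 0#
    X^-below (suc m) f k k<m = trans (⊛-assoc X (X VE.^ m) f k) (shifted k k<m)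
      where
      shifted : ∀ k → k < suc m → (X ⊛ ((X VE.^ m) ⊛ f)) k ≈ 0#
      shifted zero    _         = X⊛-zero ((X VE.^ m) ⊛ f)
      shifted (suc k) (s≤s k<m) = trans (X⊛-suc ((X VE.^ m) ⊛ f) k) (X^-below m f k k<m)

    X^-at : ∀ m f → ((X VE.^ m) ⊛ f) m ≈ f 0
    X^-at zero    f = ⊛-identityˡ f 0
    X^-at (suc m) f = trans (⊛-assoc X (X VE.^ m) f (suc m))
      (trans (X⊛-suc ((X VE.^ m) ⊛ f) m) (X^-at m f))

    -- xᵖ ≡ x₀ᵖ + (x₁ + x₂ t + ...)ᵖ tᵖ modulo p.
    ^p-expansion : ∀ x → Σ[ z ∈ Seq ] (x VE.^ p) ≗
      (constˢ (x 0 ^ p) ⊹ ((X VE.^ p) ⊛ (tail x VE.^ p))) ⊹ scale π z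
    ^p-expansion x = z , λ k → trans (VE.^-congˡ p (expand x) k)
      (trans (VC.freshman (constˢ (x 0)) (X ⊛ tail x) k)
        (+-cong (+-cong (sym (hom-^ constant (x 0) p k)) (VE.^-distrib-* X (tail x) p k)) (natV-⊛ z k)))
      where z = VC.ν ⊛ VC.carry (constˢ (x 0)) (X ⊛ tail x)

  module _ {x y : Seq} (frob : Σ[ z ∈ Seq ] y ≗ (x VE.^ p) ⊹ (nat V p ⊛ z)) where
    private
      z = proj₁ frob
      z′ = proj₁ (^p-expansion x)

      y-at : ∀ k → y k ≈ (constˢ (x 0 ^ p) k + ((X VE.^ p) ⊛ (tail x VE.^ p)) k) + π * (z′ k + z k)
      y-at k = trans (proj₂ frob k) (trans (+-cong (proj₂ (^p-expansion x) k) (natV-⊛ z k))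
        (trans (+-assoc _ _ _) (+-congˡ (sym (distribˡ _ _ _)))))

    -- Modulo p the series y is xᵖ, which only involves powers of Tᵖ. Hence among the degrees 0 to p
    -- only 0 and p survive, with coefficients x₀ᵖ and x₁ᵖ; this and the next two lemmas record the
    -- three cases.
    frobenius-low : Σ[ z₀ ∈ Scalar ] y 0 ≈ x 0 ^ p + π * z₀
    frobenius-low = z′ 0 + z 0 ,
      trans (y-at 0) (+-congʳ (trans (+-congˡ (X^-below p (tail x VE.^ p) 0 0<p)) (+-identityʳ _)))

    frobenius-middle : ∀ k → suc k < p → Divisible (y (suc k))
    frobenius-middle k k<p = z′ (suc k) + z (suc k) , trans (y-at (suc k))
      (trans (+-congʳ (trans (+-identityˡ _) (X^-below p (tail x VE.^ p) (suc k) k<p))) (+-identityˡ _))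

    frobenius-top : Σ[ zₚ ∈ Scalar ] y p ≈ x 1 ^ p + π * zₚ
    frobenius-top = z′ p + z p , trans (y-at p) (+-congʳ (trans (+-congʳ (constˢ-0 0<p)) (trans (+-identityˡ _)
      (trans (X^-at p (tail x VE.^ p)) (hom-^ leading (tail x) p)))))
      where
      constˢ-0 : ∀ {m c} → 0 < m → constˢ c m ≈ 0#
      constˢ-0 {suc m} _ = refl

  module _ {A : Set a} (F h : A → Seq)
           (frob : ∀ r → Σ[ z ∈ Seq ] F r ≗ (h r VE.^ p) ⊹ (nat V p ⊛ z)) where
    open Contraction V
    private
      jet : (A → Seq) → A → Seq × Seq
      jet g r = g r , derivative (g r)

      -- Pullback by a Frobenius lift is divisible by p. For d r in degree p - 1 the factor p comes
      -- from differentiating Tᵖ; in lower degrees it comes from the coefficients themselves.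
      divisible : ∀ ω k → k < p → Divisible (contract (jet F) ω k)
      divisible (d r) k k<p with ℕ.m≤n⇒m<n∨m≡n k<p
      ... | inj₁ k+1<p  = divisible-* _ (frobenius-middle (frob r) k k+1<p)
      ... | inj₂ ≡.refl = F r p , refl
      divisible (ω ⊕ η) k k<p = divisible-+ (divisible ω k k<p) (divisible η k k<p)
      divisible 0ᶠ      k k<p = 0# , sym (zeroʳ _)
      divisible (⊝ ω)   k k<p with y , e ← divisible ω k k<p =
        - y , trans (-‿cong e) (-‿distribʳ-* _ _)
      divisible (r ⊙ ω) k k<p = divisible-⊛ k (F r) (contract (jet F) ω)
        (λ j j≤k → divisible ω j (ℕ.≤-<-trans j≤k k<p))

    -- This is the Cartier operator applied to F*ω / p, written without dividing by p.
    top-coefficient : ∀ n → suc (suc n) ≡ p → ∀ ω → contract (jet F) ω (suc n) ≈ π * contract (jet h) ω 0 ^ p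
    top-coefficient n n+2≡p (d r) with zₚ , e ← frobenius-top (frob r) = begin
      nat C (2 ℕ.+ n) * F r (2 ℕ.+ n) ≡⟨ ≡.cong (λ m → nat C m * F r m) n+2≡p ⟩
      π * F r p                     ≈⟨ *-congˡ e ⟩
      π * (h r 1 ^ p + π * zₚ)      ≈⟨ π*[x+πy] _ _ ⟩
      π * h r 1 ^ p                 ≈⟨ *-congˡ (^-congˡ p (trans (*-congʳ (+-identityʳ 1#)) (*-identityˡ _))) ⟨
      π * (nat C 1 * h r 1) ^ p     ∎
    top-coefficient n n+2≡p (ω ⊕ η) =
      trans (+-cong (top-coefficient n n+2≡p ω) (top-coefficient n n+2≡p η)) (sym (π-freshman _ _))
    top-coefficient n n+2≡p 0ᶠ      = sym (trans (*-congˡ (0^ 0<p)) (zeroʳ _))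
    -- Additivity of the p-th power after multiplication by p gives p (-y)ᵖ = - p yᵖ for all p at
    -- once, p = 2 included.
    top-coefficient n n+2≡p (⊝ ω)   = trans (-‿cong (top-coefficient n n+2≡p ω)) (sym (inverseˡ-unique _ _ (begin
      π * (- y) ^ p + π * y ^ p     ≈⟨ π-freshman (- y) y ⟨
      π * (- y + y) ^ p             ≈⟨ *-congˡ (^-congˡ p (-‿inverseˡ y)) ⟩
      π * 0# ^ p                    ≈⟨ *-congˡ (0^ 0<p) ⟩
      π * 0#                        ≈⟨ zeroʳ π ⟩
      0#                            ∎)))
      where y = contract (jet h) ω 0
    -- Only the constant coefficient of `F r` contributes: in every other term of the convolution
    -- both factors are multiples of p.
    top-coefficient n n+2≡p (r ⊙ ω) with z₀ , e ← frobenius-low (frob r) = begin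
      F r 0 * x (suc n) + (tail (F r) ⊛ x) n
        ≈⟨ +-cong (*-cong e (top-coefficient n n+2≡p ω)) (divisible-⊛≈0 n (tail (F r)) x
             (λ j j≤n → frobenius-middle (frob r) j (ℕ.≤-trans (s≤s (s≤s j≤n)) (ℕ.≤-reflexive n+2≡p)))
             (λ j j≤n → divisible ω j (ℕ.≤-trans (ℕ.m≤n⇒m≤1+n (s≤s j≤n)) (ℕ.≤-reflexive n+2≡p)))) ⟩
      (h r 0 ^ p + π * z₀) * (π * y ^ p) + 0#
        ≈⟨ +-identityʳ _ ⟩
      (h r 0 ^ p + π * z₀) * (π * y ^ p)
        ≈⟨ distribʳ _ _ _ ⟩
      h r 0 ^ p * (π * y ^ p) + π * z₀ * (π * y ^ p)
        ≈⟨ +-cong (solve 3 (λ u n v → u :* (n :* v) := n :* (u :* v)) refl _ _ _) (πx*πy≈0 _ _) ⟩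
      π * (h r 0 ^ p * y ^ p) + 0#
        ≈⟨ +-identityʳ _ ⟩
      π * (h r 0 ^ p * y ^ p)
        ≈⟨ *-congˡ (^-distrib-* (h r 0) y p) ⟨
      π * (h r 0 * y) ^ p
        ∎
      where
      x = contract (jet F) ω
      y = contract (jet h) ω 0

module _ (C : CommutativeRing a a) where
  open CommutativeRing C hiding (zero; ring)
  open Exp commutativeSemiring
  open SetoidReasoning setoid
  private
    module Solver = NatCoefficients commutativeSemiring
  open Solver using (solve; _:=_; _:+_; _:*_)

  -- As (cs)ⁿ is 1 modulo π and π² = 0, multiplying π by (cs)ⁿ changes nothing. Thus a period that
  -- is a unit modulo p would turn p ⟨ω, D⟩ᵖ = 0 into p = 0.
  cancel-unit-power : ∀ {π c s z} → π * π ≈ 0# → c * s ≈ 1# + π * z → ∀ n → π * c ^ n ≈ 0# → π ≈ 0#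
  cancel-unit-power {π} {c} {s} {z} π²≈0 cs≈1 n πcⁿ≈0 = begin
    π                      ≈⟨ absorb n ⟨
    π * (c * s) ^ n        ≈⟨ *-congˡ (^-distrib-* c s n) ⟩
    π * (c ^ n * s ^ n)    ≈⟨ *-assoc _ _ _ ⟨
    π * c ^ n * s ^ n      ≈⟨ *-congʳ πcⁿ≈0 ⟩
    0# * s ^ n             ≈⟨ zeroˡ _ ⟩
    0#                     ∎
    where
    absorb : ∀ n → π * (c * s) ^ n ≈ π
    absorb zero    = *-identityʳ π
    absorb (suc n) = begin
      π * (c * s * (c * s) ^ n)          ≈⟨ *-congˡ (*-congʳ cs≈1) ⟩
      π * ((1# + π * z) * (c * s) ^ n)
        ≈⟨ solve 4 (λ π o z x → π :* ((o :+ π :* z) :* x) := o :* (π :* x) :+ (π :* π) :* (z :* x)) refl _ _ _ _ ⟩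
      1# * (π * (c * s) ^ n) + π * π * (z * (c * s) ^ n)
        ≈⟨ +-cong (*-identityˡ _) (trans (*-congʳ π²≈0) (zeroˡ _)) ⟩
      π * (c * s) ^ n + 0#               ≈⟨ +-identityʳ _ ⟩
      π * (c * s) ^ n                    ≈⟨ absorb n ⟩
      π                                  ∎

module _ {S T : CommutativeRing ℓ ℓ} (h : Hom S T) where
  private
    module S = CommutativeRing S
    module T = CommutativeRing T
    module h = Hom h

  hom-contract : {C : Set ℓ′} (v : C → S.Carrier × S.Carrier) → ∀ ω →
    Contraction.contract T (λ r → ⟦ h ⟧ (proj₁ (v r)) , ⟦ h ⟧ (proj₂ (v r))) ω T.≈
    ⟦ h ⟧ (Contraction.contract S v ω)
  hom-contract v (d r)   = T.refl
  hom-contract v (ω ⊕ η) = T.trans (T.+-cong (hom-contract v ω) (hom-contract v η)) (T.sym (h.+-homo _ _))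
  hom-contract v 0ᶠ      = T.sym h.0#-homo
  hom-contract v (⊝ ω)   = T.trans (T.-‿cong (hom-contract v ω)) (T.sym (h.-‿homo _))
  hom-contract v (r ⊙ ω) = T.trans (T.*-congˡ (hom-contract v ω)) (T.sym (h.*-homo _ _))

-- A curve through the identity of G that moves along itself with the constant velocity tangent.
record InvariantCurve {R : CommutativeRing ℓ ℓ} (G : AffineGroupScheme R) : Set (lsuc ℓ) where
  open AffineGroupScheme G
  field
    tangent      : Point (dualₐ (self R))
    tangent-at-ε : ∀ x → CommutativeRing._≈_ R (proj₁ (tangent $ₐ x)) (ε {self R} $ₐ x)
    curve        : (S : Algebra R ℓ) → Point (seriesₐ S)
    curve-start  : ∀ S x → Algebra._≈_ S (⟦ PowerSeries.leading (ring S) ⟧ (curve S $ₐ x)) (ε {S} $ₐ x)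
    taylor-curve : ∀ S → _≈ₐ_ {A = O} {B = dualₐ (seriesₐ S)} (taylor S ∘ₐ curve S)
                         ((toDual (seriesₐ S) ∘ₐ curve S) ∙
                          (mapDualₐ (constantₐ S ∘ₐ structureMap S) ∘ₐ tangent))

module TranslatedCurve {R : CommutativeRing ℓ ℓ} (G : AffineGroupScheme R) (γ : InvariantCurve G)
                       {S : Algebra R ℓ} (g : AffineGroupScheme.Point G S) where
  open AffineGroupScheme G
  open PointGroups G
  open InvariantCurve γ
  private
    module S = Algebra S
    V = seriesₐ S
    module V = Algebra V
    velocity : Point (dualₐ V)
    velocity = mapDualₐ (constantₐ S ∘ₐ structureMap S) ∘ₐ tangent

  translate : Point V
  translate = (constantₐ S ∘ₐ g) ∙ curve S

  translate-start : ∀ x → ⟦ PowerSeries.leading S.ring ⟧ (translate $ₐ x) S.≈ (g $ₐ x)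
  translate-start = begin
    leadingₐ S ∘ₐ translate
      ≈⟨ ∙-natural (leadingₐ S) (constantₐ S ∘ₐ g) (curve S) ⟩
    (leadingₐ S ∘ₐ (constantₐ S ∘ₐ g)) ∙ (leadingₐ S ∘ₐ curve S)
      ≈⟨ P.∙-cong {leadingₐ S ∘ₐ (constantₐ S ∘ₐ g)} {g} {leadingₐ S ∘ₐ curve S} {ε}
           (λ _ → S.refl) (curve-start S) ⟩
    g ∙ ε
      ≈⟨ P.identityʳ g ⟩
    g ∎
    where
    module P = Group (pointGroup S)
    open SetoidReasoning P.setoid

  private
    taylor-translate : (taylor S ∘ₐ translate) ≈ₐ ((toDual V ∘ₐ translate) ∙ velocity)
    taylor-translate = begin
      taylor S ∘ₐ translate
        ≈⟨ ∙-natural (taylor S) g₀ (curve S) ⟩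
      (taylor S ∘ₐ g₀) ∙ (taylor S ∘ₐ curve S)
        ≈⟨ P.∙-cong {taylor S ∘ₐ g₀} {toDual V ∘ₐ g₀} {taylor S ∘ₐ curve S} {(toDual V ∘ₐ curve S) ∙ velocity}
             (λ x → V.refl , PowerSeries.derivative-constˢ S.ring (g $ₐ x)) (taylor-curve S) ⟩
      (toDual V ∘ₐ g₀) ∙ ((toDual V ∘ₐ curve S) ∙ velocity)
        ≈⟨ P.assoc (toDual V ∘ₐ g₀) (toDual V ∘ₐ curve S) velocity ⟨
      (toDual V ∘ₐ g₀) ∙ (toDual V ∘ₐ curve S) ∙ velocity
        ≈⟨ P.∙-congʳ {velocity} {toDual V ∘ₐ translate} {(toDual V ∘ₐ g₀) ∙ (toDual V ∘ₐ curve S)}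
             (∙-natural (toDual V) g₀ (curve S)) ⟨
      (toDual V ∘ₐ translate) ∙ velocity
        ∎
      where
      g₀ : Point V
      g₀ = constantₐ S ∘ₐ g
      module P = Group (pointGroup (dualₐ V))
      open SetoidReasoning P.setoid

  -- The velocity of the translated curve at each time is the left translate of the fixed vector
  -- `tangent`, and a left invariant form does not see the translation.
  contract-translate : ∀ {ω} → IsLeftInvariant G ω →
    Contraction.contract V.ring (λ x → (translate $ₐ x) , PowerSeries.derivative S.ring (translate $ₐ x)) ω V.≈
    PowerSeries.constˢ S.ring (⟦ ι S ⟧ (Contraction.contract R (tangent $ₐ_) ω))
  contract-translate {ω} invariant = begin
    contract ((taylor S ∘ₐ translate) $ₐ_) ω
      ≈⟨ contract-ext taylor-translate ω ⟩
    contract (((toDual V ∘ₐ translate) ∙ velocity) $ₐ_) ω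
      ≈⟨ TangentVectors.contract-leftInvariant G {V} {ω} invariant translate velocity ⟩
    contract (velocity $ₐ_) ω
      ≈⟨ hom-contract (AlgHomOver.hom (constantₐ S ∘ₐ structureMap S)) (tangent $ₐ_) ω ⟩
    PowerSeries.constˢ S.ring (⟦ ι S ⟧ (Contraction.contract R (tangent $ₐ_) ω))
      ∎
    where
    open Contraction V.ring
    open SetoidReasoning V.setoid

nat-square : (C : CommutativeRing a a) → ∀ p → let open CommutativeRing C in
             nat C (p ℕ.^ 2) ≈ nat C p * nat C p
nat-square C p = trans (reflexive (≡.cong (λ m → nat C (p ℕ.* m)) (ℕ.*-identityʳ p)))
                       (SemiringMult.×1-homo-* semiring p p)
  where open CommutativeRing C

FrobeniusModulo : (C : CommutativeRing a a) → ℕ → (x y : CommutativeRing.Carrier C) → Set a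
FrobeniusModulo C p x y = Σ[ z ∈ Carrier ] y ≈ x ^ p + nat C p * z
  where
  open CommutativeRing C
  open Exp commutativeSemiring

hom-FrobeniusModulo : {S : CommutativeRing a a} {T : CommutativeRing b b} (h : Hom S T) →
                      ∀ p {x y} → FrobeniusModulo S p x y → FrobeniusModulo T p (⟦ h ⟧ x) (⟦ h ⟧ y)
hom-FrobeniusModulo {T = T} h p {x} (z , e) = ⟦ h ⟧ z , trans (h.⟦⟧-cong e)
  (trans (h.+-homo _ _) (+-cong (hom-^ h x p) (trans (h.*-homo _ _) (*-congʳ (hom-nat h p)))))
  where
  open CommutativeRing T
  module h = Hom h

combination-closed : {R : CommutativeRing ℓ ℓ} (M : Module R a b) → let open Module M in
  (P : Carrierᴹ → Set ℓ′) → P 0ᴹ → (∀ m n → P m → P n → P (m +ᴹ n)) → (∀ r m → P m → P (r *ₗ m)) →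
  ∀ {D} (r : Fin D → CommutativeRing.Carrier R) m → (∀ j → P (m j)) → P (ModuleOps.combination M r m)
combination-closed M P P-0 P-+ P-* {zero}  r m Pm = P-0
combination-closed M P P-0 P-+ P-* {suc D} r m Pm = P-+ _ _ (P-* (r zero) (m zero) (Pm zero))
  (combination-closed M P P-0 P-+ P-* (r ∘ suc) (m ∘ suc) (Pm ∘ suc))

contract-along : {S K : CommutativeRing ℓ ℓ} {A : Algebra K ℓ} {ω η : Form (Algebra.Carrier A)} →
  FormEq A ω η → (v : Hom (ring A) (dual S)) →
  (∀ k → let open CommutativeRing S in proj₂ (⟦ v ⟧ (⟦ ι A ⟧ k)) ≈ 0#) →
  CommutativeRing._≈_ S (Contraction.contract S ⟦ v ⟧ ω) (Contraction.contract S ⟦ v ⟧ η)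
contract-along {A = A} e v v-ι = contract-cong {A = A} v v-ι e

-- S plays the role of the sections over D(f) modulo p²: it is universal among the rings with
-- p² = 0 under O in which f is invertible.
module LocalComputation
  (p : ℕ) (1<p : 1 < p) {R : CommutativeRing ℓ ℓ} (i : TruncatedReciprocals p R)
  (G : AffineGroupScheme R) (γ : InvariantCurve G)
  (f : Algebra.Carrier (AffineGroupScheme.O G))
  (S : Algebra R ℓ) (toS : AlgHom (AffineGroupScheme.O G) S) (f-unit : IsUnit (ring S) (toS $ₐ f))
  (p²≈0 : CommutativeRing._≈_ (ring S) (nat (ring S) (p ℕ.^ 2)) (CommutativeRing.0# (ring S)))
  (extend : {T : CommutativeRing ℓ ℓ} (k : Hom (ring (AffineGroupScheme.O G)) T) → IsUnit T (⟦ k ⟧ f) →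
            CommutativeRing._≈_ T (nat T (p ℕ.^ 2)) (CommutativeRing.0# T) → Hom (ring S) T)
  (extend-toS : {T : CommutativeRing ℓ ℓ} (k : Hom (ring (AffineGroupScheme.O G)) T) (u : IsUnit T (⟦ k ⟧ f))
                (z : CommutativeRing._≈_ T (nat T (p ℕ.^ 2)) (CommutativeRing.0# T)) →
                ∀ r → CommutativeRing._≈_ T (⟦ extend k u z ⟧ (toS $ₐ r)) (⟦ k ⟧ r))
  (φ₂ : Hom (ring S) (ring S))
  (φ₂-frobenius : ∀ r → FrobeniusModulo (ring S) p r (⟦ φ₂ ⟧ r)) where

  open AffineGroupScheme G using (O)
  open InvariantCurve γ
  private
    module O = Algebra O
    module S = Algebra S

  V : Algebra R ℓ
  V = seriesₐ S

  private
    module V = Algebra V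
    open PowerSeries S.ring

    π = nat S.ring p

    π²≈0 : π S.* π S.≈ S.0#
    π²≈0 = S.trans (S.sym (nat-square S.ring p)) p²≈0

    open TranslatedCurve G γ {S} toS

    -- The curve starts at the tautological point, where f is invertible, and a power series with
    -- invertible constant term is a unit.
    translate-unit : IsUnit V.ring (translate $ₐ f)
    translate-unit = leading-unit⇒unit (translate $ₐ f)
      (cast-unit {R = S.ring} (S.sym (translate-start f)) f-unit)

    p²≈0-in-V : nat V.ring (p ℕ.^ 2) V.≈ V.0#
    p²≈0-in-V = V.trans {_} {constˢ (nat S.ring (p ℕ.^ 2))}
      (V.sym {constˢ (nat S.ring (p ℕ.^ 2))} (hom-nat constant (p ℕ.^ 2)))
      (V.trans {_} {constˢ S.0#} (Hom.⟦⟧-cong constant p²≈0) (Hom.0#-homo constant))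

    h : Hom S.ring V.ring
    h = extend (AlgHomOver.hom translate) translate-unit p²≈0-in-V

    h-toS : ∀ x → ⟦ h ⟧ (toS $ₐ x) V.≈ (translate $ₐ x)
    h-toS = extend-toS (AlgHomOver.hom translate) translate-unit p²≈0-in-V

    h-ι : ∀ k → ⟦ h ⟧ (⟦ ι S ⟧ k) V.≈ constˢ (⟦ ι S ⟧ k)
    h-ι k = V.trans {_} {⟦ h ⟧ (toS $ₐ ⟦ ι O ⟧ k)}
      (Hom.⟦⟧-cong h (S.sym (AlgHomOver.ι-hom toS k)))
      (V.trans {_} {translate $ₐ ⟦ ι O ⟧ k} (h-toS (⟦ ι O ⟧ k)) (AlgHomOver.ι-hom translate k))

  -- The translated curve, as a tangent vector of S with values in the power series over S.
  velocity : Hom S.ring (dual V.ring)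
  velocity = taylorHom S.ring ∘ₕ h

  velocity-ι : ∀ k → proj₂ (⟦ velocity ⟧ (⟦ ι S ⟧ k)) V.≈ V.0#
  velocity-ι k = V.trans {_} {derivative (constˢ (⟦ ι S ⟧ k))}
    (λ n → S.*-congˡ (h-ι k (suc n))) (derivative-constˢ (⟦ ι S ⟧ k))

  open Contraction V.ring

  evaluate : Form S.Carrier → Seq
  evaluate = contract ⟦ velocity ⟧

  private
    F : O.Carrier → Seq
    F r = ⟦ h ⟧ (⟦ φ₂ ⟧ (toS $ₐ r))

    F-frobenius : ∀ r → FrobeniusModulo V.ring p (⟦ h ⟧ (toS $ₐ r)) (F r)
    F-frobenius r = hom-FrobeniusModulo h p {toS $ₐ r} {⟦ φ₂ ⟧ (toS $ₐ r)} (φ₂-frobenius (toS $ₐ r))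

    evaluate-invariant : ∀ {ω} → IsLeftInvariant G ω →
      evaluate (mapForm (toS $ₐ_) ω) V.≈ constˢ (⟦ ι S ⟧ (Contraction.contract R (tangent $ₐ_) ω))
    evaluate-invariant {ω} invariant = V.trans {_} {contract (⟦ velocity ⟧ ∘ (toS $ₐ_)) ω}
      (V.reflexive (contract-mapForm ⟦ velocity ⟧ (toS $ₐ_) ω))
      (V.trans {_} {contract (λ x → (translate $ₐ x) , derivative (translate $ₐ x)) ω}
        (contract-ext (λ r → h-toS r , λ n → S.*-congˡ (h-toS r (suc n))) ω)
        (contract-translate invariant))

    evaluate-pullback : ∀ ω → evaluate (mapForm ⟦ φ₂ ⟧ (mapForm (toS $ₐ_) ω)) V.≈
                              contract (λ x → F x , derivative (F x)) ω
    evaluate-pullback ω = V.reflexive (≡.trans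
      (contract-mapForm ⟦ velocity ⟧ ⟦ φ₂ ⟧ (mapForm (toS $ₐ_) ω))
      (contract-mapForm (⟦ velocity ⟧ ∘ ⟦ φ₂ ⟧) (toS $ₐ_) ω))

    evaluate-scale : ∀ r ω k → evaluate (⟦ ι S ⟧ r ⊙ ω) k S.≈ ⟦ ι S ⟧ r S.* evaluate ω k
    evaluate-scale r ω k =
      S.trans (⊛-cong {g = evaluate ω} (h-ι r) (λ _ → S.refl) k) (constˢ-⊛ (⟦ ι S ⟧ r) (evaluate ω) k)

  Vanishes : ℕ → Form S.Carrier → Set ℓ
  Vanishes k ω = evaluate ω k S.≈ S.0#

  vanishes-0 : ∀ k → Vanishes k 0ᶠ
  vanishes-0 k = S.refl

  vanishes-⊕ : ∀ k ω η → Vanishes k ω → Vanishes k η → Vanishes k (ω ⊕ η)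
  vanishes-⊕ k ω η e e′ = S.trans (S.+-cong e e′) (S.+-identityʳ S.0#)

  vanishes-⊙ : ∀ k r ω → Vanishes k ω → Vanishes k (⟦ ι S ⟧ r ⊙ ω)
  vanishes-⊙ k r ω e = S.trans (evaluate-scale r ω k) (S.trans (S.*-congˡ e) (S.zeroʳ _))

  invariant-vanishes : ∀ k {ω} → IsLeftInvariant G ω → Vanishes (suc k) (mapForm (toS $ₐ_) ω)
  invariant-vanishes k invariant = evaluate-invariant invariant (suc k)

  -- The coefficient of t^(p-1) is that of (φ*/p) ω = ψ on one side, and of an invariant form on the other.
  lie-invariant-vanishes : ∀ n → suc (suc n) ≡ p → ∀ {ω} → IsLeftInvariant G ω → ∀ ψ η θ →
    evaluate (⟦ ι S ⟧ (nat R p) ⊙ ψ) V.≈ evaluate (mapForm ⟦ φ₂ ⟧ (mapForm (toS $ₐ_) ω)) →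
    evaluate ψ V.≈ evaluate (η ⊕ (⟦ ι S ⟧ (nat R p) ⊙ θ)) → Vanishes (suc n) η →
    π S.* Exp._^_ S.commutativeSemiring (⟦ ι S ⟧ (Contraction.contract R (tangent $ₐ_) ω)) p S.≈ S.0#
  lie-invariant-vanishes n n+2≡p {ω} invariant ψ η θ divided congruent η≈0 = begin
    π S.* ⟦ ι S ⟧ ω₀ ^ p
      ≈⟨ S.*-congˡ (^-congˡ p (S.trans (S.sym (evaluate-invariant invariant 0))
           (V.reflexive (contract-mapForm ⟦ velocity ⟧ (toS $ₐ_) ω) 0))) ⟩
    π S.* contract (λ x → ⟦ h ⟧ (toS $ₐ x) , derivative (⟦ h ⟧ (toS $ₐ x))) ω 0 ^ p
      ≈⟨ top-coefficient F (λ x → ⟦ h ⟧ (toS $ₐ x)) F-frobenius n n+2≡p ω ⟨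
    contract (λ x → F x , derivative (F x)) ω (suc n)
      ≈⟨ evaluate-pullback ω (suc n) ⟨
    evaluate (mapForm ⟦ φ₂ ⟧ (mapForm (toS $ₐ_) ω)) (suc n)
      ≈⟨ divided (suc n) ⟨
    evaluate (⟦ ι S ⟧ (nat R p) ⊙ ψ) (suc n)
      ≈⟨ S.trans (evaluate-scale (nat R p) ψ (suc n)) (S.*-cong ιp≈π (congruent (suc n))) ⟩
    π S.* (evaluate η (suc n) S.+ evaluate (⟦ ι S ⟧ (nat R p) ⊙ θ) (suc n))
      ≈⟨ S.*-congˡ (S.trans (S.+-cong η≈0 (evaluate-scale (nat R p) θ (suc n)))
           (S.trans (S.+-identityˡ _) (S.*-congʳ ιp≈π))) ⟩
    π S.* (π S.* evaluate θ (suc n))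
      ≈⟨ S.trans (S.sym (S.*-assoc _ _ _)) (S.trans (S.*-congʳ π²≈0) (S.zeroˡ _)) ⟩
    S.0#
      ∎
    where
    open SetoidReasoning S.setoid
    open Exp S.commutativeSemiring
    open FrobeniusPullback S.ring p 1<p (mapReciprocals (ι S) i) π²≈0
    ω₀ = Contraction.contract R (tangent $ₐ_) ω
    ιp≈π : ⟦ ι S ⟧ (nat R p) S.≈ π
    ιp≈π = hom-nat (ι S) p

module LieInvariance
  (p : ℕ) (1<p : 1 < p) {R : CommutativeRing ℓ ℓ} (i : TruncatedReciprocals p R) (φR : FrobeniusLift p R)
  (G : AffineGroupScheme R) (γ : InvariantCurve G)
  (U : OpenSubset (AffineGroupScheme.coordinateRing G))
  (Φ : FrobeniusLiftOn p φR (AffineGroupScheme.O G) U)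
  (lie : IsLieInvariantModp G p φR U Φ)
  (f : Algebra.Carrier (AffineGroupScheme.O G)) (f∈ : OpenSubset.D⊂ U f) where

  open AffineGroupScheme G using (O)
  open InvariantCurve γ
  open IsLieInvariantModp lie
  private
    module R = CommutativeRing R
    module O = Algebra O
    B = away O f
    p² = p ℕ.^ 2
    B₂ = ring B /[ p² ]
    module B₂ = CommutativeRing B₂

    φ₂ : Hom B₂ B₂
    φ₂ = AlgHomOver.hom (atLevel p B B (proj₁ Φ f f∈) 2)

    φ₂-frobenius : ∀ y → FrobeniusModulo B₂ p y (⟦ φ₂ ⟧ y)
    φ₂-frobenius y = hom-FrobeniusModulo (project p (ring B) 2) p {⟦ toCompletion p (ring B) ⟧ y}
      {proj₁ Φ f f∈ $ₐ ⟦ toCompletion p (ring B) ⟧ y}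
      (proj₁ (proj₂ Φ) f f∈ (⟦ toCompletion p (ring B) ⟧ y))

    sections : Algebra R ℓ
    sections .ring = B₂
    sections .ι    = reduceMod (ring B) p² ∘ₕ ι B

    toSections : AlgHom O sections
    toSections = record
      { hom = reduceMod (ring B) p² ∘ₕ ι (localization O.ring f) ; ι-hom = λ _ → B₂.refl }

    extend : {T : CommutativeRing ℓ ℓ} (k : Hom O.ring T) → IsUnit T (⟦ k ⟧ f) →
             CommutativeRing._≈_ T (nat T p²) (CommutativeRing.0# T) → Hom B₂ T
    extend k u p²≈0 = factor (extendToLocalization O.ring f k u) p² p²≈0

    open LocalComputation p 1<p i G γ f sections toSections
      (hom-unit (reduceMod (ring B) p²) (localization-unit O.ring f)) (nat-vanishes (ring B) p²)
      extend (λ {T} _ _ _ _ → CommutativeRing.refl T) φ₂ φ₂-frobenius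

    module M = Module (Ω̂-on p φR O U)
    open ModuleOps (Ω̂-on p φR O U)
    open GeneratesLeftInvariantForms generating using (invariant)

    module V = Algebra V

    -- The component over D(f) at level 2 of the inverse limit, that is modulo p².
    local : M.Carrierᴹ → Form B₂.Carrier
    local ω = proj₁ (proj₁ ω (f , f∈)) 2

    -- The velocity is rebuilt on the underlying sets because Ω̂-on presents the sections over D(f)
    -- by an algebra that is only definitionally equal to B.
    evaluate-cong : ∀ ω η → ω M.≈ᴹ η → evaluate (local ω) V.≈ evaluate (local η)
    evaluate-cong ω η e = contract-along {S = ring V} (e (f , f∈) 2)
      (mkHom _ _ ⟦ velocity ⟧ (λ e → v.⟦⟧-cong e) v.+-homo v.*-homo v.1#-homo) velocity-ι
      where module v = Hom velocity

    vanishes-combination : ∀ k {D} (r : Fin D → R.Carrier) (ω : Fin D → M.Carrierᴹ) →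
      (∀ j → Vanishes k (local (ω j))) → Vanishes k (local (combination r ω))
    vanishes-combination k = combination-closed (Ω̂-on p φR O U) (λ ω → Vanishes k (local ω))
      (vanishes-0 k) (λ ω η → vanishes-⊕ k (local ω) (local η)) (λ r ω → vanishes-⊙ k r (local ω))

  -- The period is ⟨ωⱼ, D⟩. Writing p as n + 2 exhibits the degree p - 1 as positive, where the
  -- constant series attached to left invariant forms have coefficient 0.
  p*periodᵖ≈0 : ∀ j → nat B₂ p B₂.* Exp._^_ B₂.commutativeSemiring
    (⟦ reduceMod (ring B) p² ⟧ (⟦ ι B ⟧ (Contraction.contract R (tangent $ₐ_) (ω j)))) p B₂.≈ B₂.0#
  p*periodᵖ≈0 j = at 1<p ≡.refl
    where
    ω̂ = restrictToCompletion p φR O U ∘ ω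
    η = combination (λ-matrix j) ω̂
    θ = proj₁ (congruence j)

    at : ∀ {m} → 1 < m → m ≡ p → nat B₂ p B₂.* Exp._^_ B₂.commutativeSemiring
      (⟦ reduceMod (ring B) p² ⟧ (⟦ ι B ⟧ (Contraction.contract R (tangent $ₐ_) (ω j)))) p B₂.≈ B₂.0#
    at {suc (suc n)} _ n+2≡p = lie-invariant-vanishes n n+2≡p (invariant j) (local (ψ j)) (local η) (local θ)
      (evaluate-cong (nat R p M.*ₗ ψ j) (φ* p φR O U Φ (ω̂ j)) (ψ-divided j))
      (evaluate-cong (ψ j) (η M.+ᴹ nat R p M.*ₗ θ) (proj₂ (congruence j)))
      (vanishes-combination (suc n) (λ-matrix j) ω̂ (λ k → invariant-vanishes n (invariant k)))
    at {suc zero} (s≤s ())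

-- The discrete valuation ring R

module DVR (p : ℕ) (p-prime : Prime p) (R : CommutativeRing ℓ ℓ)
           (dvr : IsDVRWithUniformizer R (nat R p)) where
  open CommutativeRing R hiding (zero; ring)
  open IsDVRWithUniformizer dvr
  open Exp commutativeSemiring
  open SetoidReasoning setoid
  open RingProperties (CommutativeRing.ring R) using (-‿distribʳ-*)
  private
    module Solver = NatCoefficients commutativeSemiring
  open Solver using (solve; _:=_; _:+_; _:*_)

  π : Carrier
  π = nat R p

  1<p : 1 < p
  1<p = ℕ.nonTrivial⇒n>1 p {{prime⇒nonTrivial p-prime}}

  cancel-zero : ∀ {r x} → ¬ r ≈ 0# → r * x ≈ 0# → x ≈ 0#
  cancel-zero {r} {x} r≉0 rx≈0 with noZeroDivisors r x rx≈0
  ... | inj₁ r≈0 = ⊥-elim (r≉0 r≈0)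
  ... | inj₂ x≈0 = x≈0

  π-cancel : ∀ {r s} → π * r ≈ π * s → r ≈ s
  π-cancel {r} {s} e = begin
    r              ≈⟨ +-identityʳ r ⟨
    r + 0#         ≈⟨ +-congˡ (-‿inverseˡ s) ⟨
    r + (- s + s)  ≈⟨ +-assoc _ _ _ ⟨
    r - s + s      ≈⟨ +-congʳ (cancel-zero π≉0 (begin
      π * (r - s)          ≈⟨ distribˡ _ _ _ ⟩
      π * r + π * - s      ≈⟨ +-cong e (sym (-‿distribʳ-* π s)) ⟩
      π * s - π * s        ≈⟨ -‿inverseʳ _ ⟩
      0#                   ∎)) ⟩
    0# + s         ≈⟨ +-identityˡ s ⟩
    s              ∎

  π^-nonzero : ∀ n → ¬ π ^ n ≈ 0#
  π^-nonzero zero    1≈0 = π-nonunit (0# , trans (zeroʳ π) (sym 1≈0))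
  π^-nonzero (suc n) e   = π^-nonzero n (cancel-zero π≉0 e)

  nat-^ : ∀ n → nat R (p ℕ.^ n) ≈ π ^ n
  nat-^ zero    = +-identityʳ 1#
  nat-^ (suc n) = trans (SemiringMult.×1-homo-* semiring p (p ℕ.^ n)) (*-congˡ (nat-^ n))

  -- A unit times a positive power of π cannot be invertible modulo π, so the factorization of r has
  -- exponent 0.
  unit-mod-π : ∀ r s z → r * s ≈ 1# + π * z → IsUnit R r
  unit-mod-π r s z rs≈1+πz = unit (factorization r r≉0)
    where
    π∤1 : ∀ y → ¬ 1# ≈ π * y
    π∤1 y e = π-nonunit (y , sym e)

    multiple : ∀ {y} → r ≈ π * y → ⊥
    multiple {y} r≈πy = π∤1 (y * s - z) (begin
      1#                             ≈⟨ +-identityʳ _ ⟨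
      1# + 0#                        ≈⟨ +-congˡ (-‿inverseʳ _) ⟨
      1# + (π * z - π * z)           ≈⟨ +-assoc _ _ _ ⟨
      1# + π * z - π * z             ≈⟨ +-congʳ (trans (sym rs≈1+πz) (trans (*-congʳ r≈πy) (*-assoc _ _ _))) ⟩
      π * (y * s) - π * z            ≈⟨ +-congˡ (-‿distribʳ-* π z) ⟩
      π * (y * s) + π * - z          ≈⟨ distribˡ _ _ _ ⟨
      π * (y * s - z)                ∎)

    r≉0 : ¬ r ≈ 0#
    r≉0 r≈0 = multiple (trans r≈0 (sym (zeroʳ π)))

    unit : Σ[ u ∈ Carrier ] Σ[ n ∈ ℕ ] IsUnit R u × r ≈ u * π ^ n → IsUnit R r
    unit (u , zero  , u-unit , e) = cast-unit {R = R} (sym (trans e (*-identityʳ u))) u-unit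
    unit (u , suc n , u-unit , e) = ⊥-elim (multiple (trans e
      (solve 3 (λ u π x → u :* (π :* x) := π :* (u :* x)) refl u π (π ^ n))))

  -- Bézout's identity for k + 1 and p inverts k + 1 modulo p; its two sign patterns give the two
  -- cases.
  nat-unit : ∀ k → suc k < p → IsUnit R (nat R (suc k))
  nat-unit k k<p = bezout (coprime-Bézout (prime⇒coprime p-prime k<p))
    where
    nat-* : ∀ m n → nat R (m ℕ.* n) ≈ nat R m * nat R n
    nat-* = SemiringMult.×1-homo-* semiring

    bezout : Bézout.Identity 1 p (suc k) → IsUnit R (nat R (suc k))
    bezout (Bézout.+- x y 1+yk≡xp) = unit-mod-π _ (- nat R y) (- nat R x) (begin
      nat R (suc k) * - nat R y
        ≈⟨ -‿distribʳ-* _ _ ⟨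
      - (nat R (suc k) * nat R y)
        ≈⟨ +-identityʳ _ ⟨
      - (nat R (suc k) * nat R y) + 0#
        ≈⟨ +-congˡ (sym (-‿inverseʳ (nat R (x ℕ.* p)))) ⟩
      - (nat R (suc k) * nat R y) + (nat R (x ℕ.* p) - nat R (x ℕ.* p))
        ≈⟨ +-congˡ (+-cong (trans (reflexive (≡.cong (nat R) (≡.sym 1+yk≡xp)))
             (+-congˡ (trans (nat-* y (suc k)) (*-comm _ _))))
             (trans (-‿cong (trans (nat-* x p) (*-comm _ _))) (-‿distribʳ-* π (nat R x)))) ⟩
      - (nat R (suc k) * nat R y) + (1# + nat R (suc k) * nat R y + π * - nat R x)
        ≈⟨ solve 4 (λ m o t z → m :+ (o :+ t :+ z) := (m :+ t) :+ (o :+ z)) refl _ _ _ _ ⟩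
      (- (nat R (suc k) * nat R y) + nat R (suc k) * nat R y) + (1# + π * - nat R x)
        ≈⟨ trans (+-congʳ (-‿inverseˡ _)) (+-identityˡ _) ⟩
      1# + π * - nat R x
        ∎)
    bezout (Bézout.-+ x y 1+xp≡yk) = unit-mod-π _ (nat R y) (nat R x) (begin
      nat R (suc k) * nat R y       ≈⟨ trans (*-comm _ _) (sym (nat-* y (suc k))) ⟩
      nat R (y ℕ.* suc k)           ≡⟨ ≡.cong (nat R) 1+xp≡yk ⟨
      1# + nat R (x ℕ.* p)          ≈⟨ +-congˡ (trans (nat-* x p) (*-comm _ _)) ⟩
      1# + π * nat R x              ∎)

  reciprocals : TruncatedReciprocals p R
  reciprocals = record
    { recip     = λ k → recip (suc k ℕ.<? p)
    ; recip-inv = λ k k<p → left-inverse (suc k ℕ.<? p) k<p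
    ; recip-top = λ k p≤k → top (suc k ℕ.<? p) p≤k
    }
    where
    recip : ∀ {k} → Dec (suc k < p) → Carrier
    recip (yes k<p) = proj₁ (nat-unit _ k<p)
    recip (no  _)   = 0#

    left-inverse : ∀ {k} (d : Dec (suc k < p)) → suc k < p → nat R (suc k) * recip d ≈ 1#
    left-inverse (yes k<p) _   = proj₂ (nat-unit _ k<p)
    left-inverse (no  k≮p) k<p = ⊥-elim (k≮p k<p)

    top : ∀ {k} (d : Dec (suc k < p)) → p ≤ suc k → recip d ≈ 0#
    top (yes k<p) p≤k = ⊥-elim (ℕ.<⇒≱ k<p p≤k)
    top (no  _)   _   = refl

  -- Such a c has the same image as 0 in the completion, and completeness includes injectivity of
  -- the map to it.
  separated : IsComplete p R → ∀ c → (∀ j → Σ[ x ∈ Carrier ] c ≈ π ^ j * x) → c ≈ 0#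
  separated complete c divisible = IsRingIsomorphism.injective complete
    (λ j → proj₁ (divisible j) ,
      trans (proj₂ (divisible j)) (trans (*-congʳ (sym (nat-^ j))) (sym (+-identityˡ _))))

  -- The content of a non-zero vector. The unit quotient certifies that the exponent is maximal, and
  -- it is what finally contradicts divisibility of M by p.
  record CommonFactor {m : ℕ} (r : Fin m → Carrier) : Set ℓ where
    field
      exponent  : ℕ
      quotients : Fin m → Carrier
      factors   : ∀ j → r j ≈ π ^ exponent * quotients j
      index     : Fin m
      unit      : IsUnit R (quotients index)

  module _ {m : ℕ} (r : Fin (suc m) → Carrier) where

    private
      extend-zero : r zero ≈ 0# → CommonFactor (r ∘ suc) → CommonFactor r
      extend-zero r₀≈0 cf = record
        { exponent  = exponent
        ; quotients = λ { zero → 0# ; (suc j) → quotients j }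
        ; factors   = λ { zero → trans r₀≈0 (sym (zeroʳ _)) ; (suc j) → factors j }
        ; index     = suc index
        ; unit      = unit
        }
        where open CommonFactor cf

      extend-nonzero : ∀ {u n} → IsUnit R u → r zero ≈ u * π ^ n → (∀ j → r (suc j) ≈ 0#) → CommonFactor r
      extend-nonzero {u} {n} u-unit e tail≈0 = record
        { exponent  = n
        ; quotients = λ { zero → u ; (suc j) → 0# }
        ; factors   = λ { zero → trans e (*-comm _ _) ; (suc j) → trans (tail≈0 j) (sym (zeroʳ _)) }
        ; index     = zero
        ; unit      = u-unit
        }

      extend : ∀ {u n} → IsUnit R u → r zero ≈ u * π ^ n → CommonFactor (r ∘ suc) → CommonFactor r
      extend {u} {n} u-unit e cf with ℕ.≤-total (CommonFactor.exponent cf) n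
      ... | inj₁ k≤n = record
        { exponent  = exponent
        ; quotients = λ { zero → u * π ^ (n ℕ.∸ exponent) ; (suc j) → quotients j }
        ; factors   = λ { zero → trans e (trans (*-congˡ (trans
                                   (^-congʳ π (≡.sym (ℕ.m+[n∸m]≡n k≤n))) (^-homo-* π exponent (n ℕ.∸ exponent))))
                                   (solve 3 (λ u x y → u :* (x :* y) := x :* (u :* y)) refl _ _ _))
                        ; (suc j) → factors j }
        ; index     = suc index
        ; unit      = unit
        }
        where open CommonFactor cf
      ... | inj₂ n≤k = record
        { exponent  = n
        ; quotients = λ { zero → u ; (suc j) → π ^ (exponent ℕ.∸ n) * quotients j }
        ; factors   = λ { zero → trans e (*-comm _ _)
                        ; (suc j) → trans (factors j) (trans (*-congʳ (trans
                            (^-congʳ π (≡.sym (ℕ.m+[n∸m]≡n n≤k))) (^-homo-* π n (exponent ℕ.∸ n)))) (*-assoc _ _ _)) }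
        ; index     = zero
        ; unit      = u-unit
        }
        where open CommonFactor cf

    common-factor-step : Dec (r zero ≈ 0#) → (∀ j → r (suc j) ≈ 0#) ⊎ CommonFactor (r ∘ suc) →
                         (∀ j → r j ≈ 0#) ⊎ CommonFactor r
    common-factor-step (yes r₀≈0) (inj₁ tail≈0) = inj₁ (λ { zero → r₀≈0 ; (suc j) → tail≈0 j })
    common-factor-step (yes r₀≈0) (inj₂ cf)     = inj₂ (extend-zero r₀≈0 cf)
    common-factor-step (no  r₀≉0) (inj₁ tail≈0) with u , n , u-unit , e ← factorization (r zero) r₀≉0 =
      inj₂ (extend-nonzero {u} {n} u-unit e tail≈0)
    common-factor-step (no  r₀≉0) (inj₂ cf) with u , n , u-unit , e ← factorization (r zero) r₀≉0 =
      inj₂ (extend {u} {n} u-unit e cf)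

  -- Each entry is tested for being 0, which is possible up to double negation; non-zero entries
  -- have a factorization, and the smaller exponent is kept at each step.
  common-factor : ∀ {m} (r : Fin m → Carrier) → ¬ ¬ ((∀ j → r j ≈ 0#) ⊎ CommonFactor r)
  common-factor {zero}  r k = k (inj₁ λ ())
  common-factor {suc m} r k = common-factor (r ∘ suc) λ tail →
    ¬¬-excluded-middle λ head → k (common-factor-step r head tail)

  open MatrixOps (CommutativeRing.rawRing R)
  open MatrixProperties R
  open SemiringSum semiring using (sum-cong-≋; *-distribˡ-sum)

  power-vanishes : ∀ {N} (A : Matrix N) {m n} → m ≤ n → IsZeroₘ (A ^ₘ m) → IsZeroₘ (A ^ₘ n)
  power-vanishes {N} A {m} m≤n Aᵐ≈0 = go (ℕ.≤⇒≤′ m≤n)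
    where
    go : ∀ {n} → m ℕ.≤′ n → IsZeroₘ (A ^ₘ n)
    go ℕ.≤′-refl = Aᵐ≈0
    go {suc n} (ℕ.≤′-step m≤n) i j =
      -- The vanishing summands are written as 0 · 0, so that the sum collapses by pulling out the
      -- factor 0.
      trans (sum-cong-≋ {N} {λ k → A i k * (A ^ₘ n) k j} {λ _ → 0# * 0#}
              (λ k → trans (*-congˡ (go m≤n k j)) (trans (zeroʳ _) (sym (zeroˡ _)))))
        (trans (sym (*-distribˡ-sum {N} 0# (λ _ → 0#))) (zeroˡ _))

  scale-^ₘ : ∀ {N} q (A B : Matrix N) → (∀ i j → A i j ≈ q * B i j) →
             ∀ n i j → (A ^ₘ n) i j ≈ q ^ n * (B ^ₘ n) i j
  scale-^ₘ q A B e zero    i j = sym (*-identityˡ _)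
  scale-^ₘ q A B e (suc n) i j = trans
    (sum-cong-≋ (λ k → trans (*-cong (e i k) (scale-^ₘ q A B e n k j))
      (solve 4 (λ q x y z → (q :* x) :* (y :* z) := (q :* y) :* (x :* z)) refl _ _ _ _)))
    (sym (*-distribˡ-sum (q * q ^ n) (λ k → B i k * (B ^ₘ n) k j)))

-- Unipotent elements of index at most p

module _ (p : ℕ) (p-prime : Prime p) (R : CommutativeRing ℓ ℓ)
         (dvr : IsDVRWithUniformizer R (nat R p)) (complete : IsComplete p R)
         (closed : IsAlgebraicallyClosedField (R /[ p ])) (φ : FrobeniusLift p R)
         (G : AffineGroupScheme R) (smooth : IsSmooth (AffineGroupScheme.O G))
         (U : OpenSubset (AffineGroupScheme.coordinateRing G))
         (nonempty : HasNonemptyCompletion (AffineGroupScheme.O G) p U)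
         (Φ : FrobeniusLiftOn p φ (AffineGroupScheme.O G) U)
         (lie : IsLieInvariantModp G p φ U Φ) where
  open CommutativeRing R hiding (zero; ring)
  open DVR p p-prime R dvr
  open AffineGroupScheme G using (O; Point; ε)
  open SetoidReasoning setoid
  private
    module Solver = NatCoefficients commutativeSemiring
  open Solver using (solve; _:=_; _:*_)

  Divisible : Carrier → Set ℓ
  Divisible x = Σ[ y ∈ Carrier ] x ≈ π * y

  private
    divisible-0 : Divisible 0#
    divisible-0 = 0# , sym (zeroʳ π)

    divisible-+ : ∀ x y → Divisible x → Divisible y → Divisible (x + y)
    divisible-+ x y (u , e) (v , e′) = u + v , trans (+-cong e e′) (sym (distribˡ _ _ _))

    divisible-* : ∀ x y → Divisible y → Divisible (x * y)
    divisible-* x y (v , e) = x * v ,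
      trans (*-congˡ e) (solve 3 (λ x π v → x :* (π :* v) := π :* (x :* v)) refl x π v)

    divisible-resp : ∀ {x y} → x ≈ y → Divisible x → Divisible y
    divisible-resp e (u , e′) = u , trans (sym e) e′

    unit-not-divisible : ∀ {x} → IsUnit R x → ¬ Divisible x
    unit-not-divisible (s , xs≈1) (y , x≈πy) = IsDVRWithUniformizer.π-nonunit dvr
      (y * s , trans (sym (*-assoc _ _ _)) (trans (*-congʳ (sym x≈πy)) xs≈1))

    f = proj₁ nonempty
    f∈ = proj₁ (proj₂ nonempty)
    B = ring (away O f)
    B₂ = B /[ p ℕ.^ 2 ]
    module B = CommutativeRing B
    module B₂ = CommutativeRing B₂

    p≉0-mod-p² : ¬ nat B₂ p B₂.≈ B₂.0#
    p≉0-mod-p² p≈0 with t , e ← B₂.trans (hom-nat (reduceMod B (p ℕ.^ 2)) p) p≈0 =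
      p∉p² p 1<p π-cancel reciprocals φ O (IsSmooth.formallySmooth smooth) f (proj₂ (proj₂ nonempty)) t
        (B.trans e (B.trans (B.+-identityˡ _) (B.*-congʳ (nat-square B p))))

  module _ (γ : InvariantCurve G) where
    open InvariantCurve γ
    open IsLieInvariantModp lie using (ω; generating)
    open GeneratesLeftInvariantForms generating using (generates)
    open Contraction R
    open TangentVectors G
    open LeftInvariantForms G

    private
      toB₂ : Hom R B₂
      toB₂ = reduceMod B (p ℕ.^ 2) ∘ₕ ι (away O f)

      -- R/p is a field, so a period is divisible by p or a unit modulo p. The second case would
      -- give p = 0 in O(G)[1/f]/p².
      period-divisible : ∀ j → Divisible (contract (tangent $ₐ_) (ω j))
      period-divisible j with IsAlgebraicallyClosedField.zero⊎unit closed (contract (tangent $ₐ_) (ω j))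
      ... | inj₁ (y , e) = y , trans e (+-identityˡ _)
      ... | inj₂ (s , z , e) = ⊥-elim (p≉0-mod-p² (cancel-unit-power B₂
        {nat B₂ p} {⟦ toB₂ ⟧ (contract (tangent $ₐ_) (ω j))} {⟦ toB₂ ⟧ s} {⟦ toB₂ ⟧ z}
        (B₂.trans (B₂.sym (nat-square B₂ p)) (nat-vanishes B (p ℕ.^ 2)))
        (image (contract (tangent $ₐ_) (ω j)) s z e) p
        (LieInvariance.p*periodᵖ≈0 p 1<p reciprocals φ G γ U Φ lie f f∈ j)))
        where
        image : ∀ x s z → x * s ≈ 1# + π * z →
                ⟦ toB₂ ⟧ x B₂.* ⟦ toB₂ ⟧ s B₂.≈ B₂.1# B₂.+ nat B₂ p B₂.* ⟦ toB₂ ⟧ z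
        image x s z e = B₂.trans (B₂.sym (h.*-homo x s)) (B₂.trans (h.⟦⟧-cong e)
          (B₂.trans (h.+-homo 1# (π * z)) (B₂.+-cong h.1#-homo
            (B₂.trans (h.*-homo π z) (B₂.*-congʳ (hom-nat toB₂ p))))))
          where module h = Hom toB₂

    -- The Maurer-Cartan forms are combinations of the generators and take the values of the tangent vector.
    tangent-divisible : ∀ x → Divisible (proj₂ (tangent $ₐ x))
    tangent-divisible x with r , e ← generates (maurerCartan x) (maurerCartan-invariant x) =
      divisible-resp (trans
          (sym (contract-cong {S = R} {A = O} (AlgHomOver.hom tangent) (λ k → proj₂ (AlgHomOver.ι-hom tangent k)) e))
          (contract-maurerCartan {self R} tangent tangent-at-ε x))
        (combination-closed (restrictModule R (ι O) (Ω O)) (λ η → Divisible (contract (tangent $ₐ_) η))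
          divisible-0 (λ _ _ → divisible-+ _ _) (λ _ _ → divisible-* _ _) r ω period-divisible)

  module _ {N : ℕ} (e : ClosedEmbedding G (GeneralLinear.GL R N)) (u : Point (self R)) where
    open MatrixOps (CommutativeRing.rawRing R)
    open MatrixProperties R
    private
      X : Matrix N
      X = pointMatrix G e u

      from-difference : ∀ {x y z} → x - y ≈ z → x ≈ y + z
      from-difference {x} {y} {z} e = begin
        x             ≈⟨ +-identityʳ x ⟨
        x + 0#        ≈⟨ +-congˡ (-‿inverseˡ y) ⟨
        x + (- y + y) ≈⟨ +-assoc _ _ _ ⟨
        x - y + y     ≈⟨ +-comm _ _ ⟩
        y + (x - y)   ≈⟨ +-congˡ e ⟩
        y + z         ∎

    -- The matrix X - 1 flattened to a vector, from which `common-factor` can extract a power of p.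
    entry : Fin (N ℕ.* N) → Carrier
    entry x = (X -ₘ 1ₘ) (proj₁ (remQuot {N} N x)) (proj₂ (remQuot {N} N x))

    entry-combine : ∀ k l → entry (combine k l) ≡ (X -ₘ 1ₘ) k l
    entry-combine k l = ≡.cong (λ (k , l) → (X -ₘ 1ₘ) k l) (remQuot-combine {N} {N} k l)

    trivial : IsZeroₘ (X -ₘ 1ₘ) → u ≈ₐ ε
    trivial X-1≈0 = onPoints-injective u ε λ x →
      trans (GL-ext R N {self R} (ClosedEmbedding.onPoints e u) (GLε {self R})
               (λ k l → trans (from-difference (X-1≈0 k l)) (+-identityʳ _)) x)
            (sym (onPoints-ε (self R) x))
      where
      open AffineGroupScheme (GeneralLinear.GL R N) using () renaming (ε to GLε)
      -- A placeholder for M: the module is opened here for the injectivity of the embedding on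
      -- points and its compatibility with ε.
      zeroMatrix : Matrix N
      zeroMatrix _ _ = 0#
      open EmbeddedOneParameterGroup p 1<p reciprocals 1# zeroMatrix
        (power-vanishes zeroMatrix (ℕ.<⇒≤ 1<p) (λ i j → *ₘ-identityʳ zeroMatrix i j)) G e

    module _ (cf : CommonFactor entry) (annihilated : IsZeroₘ ((X -ₘ 1ₘ) ^ₘ p)) where
      open CommonFactor cf
      private
        open Exp commutativeSemiring

        q = π ^ exponent

        M : Matrix N
        M k l = quotients (combine k l)

        X-1≈qM : ∀ k l → (X -ₘ 1ₘ) k l ≈ q * M k l
        X-1≈qM k l = trans (reflexive (≡.sym (entry-combine k l))) (factors (combine k l))

        q^-nonzero : ∀ n → ¬ q ^ n ≈ 0#
        q^-nonzero zero    = π^-nonzero 0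
        q^-nonzero (suc n) z = q^-nonzero n (cancel-zero (π^-nonzero exponent) z)

        -- The p-th power of X - 1 is qᵖ Mᵖ, and qᵖ is a non-zero element of a domain.
        Mᵖ≈0 : IsZeroₘ (M ^ₘ p)
        Mᵖ≈0 k l = cancel-zero (q^-nonzero p)
          (trans (sym (scale-^ₘ q (X -ₘ 1ₘ) M X-1≈qM p k l)) (annihilated k l))

        module E = EmbeddedOneParameterGroup p 1<p reciprocals q M Mᵖ≈0 G e

        nodes-cancel : ∀ j x → nat R (p ℕ.^ j) * q * x ≈ 0# → x ≈ 0#
        nodes-cancel j x z = cancel-zero (π^-nonzero exponent) (cancel-zero (π^-nonzero j)
          (trans (sym (*-assoc _ _ _)) (trans (*-congʳ (*-congʳ (sym (nat-^ j)))) z)))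

        nodes→0 : ∀ c → (∀ j → Σ[ x ∈ Carrier ] c ≈ nat R (p ℕ.^ j) * q * x) → c ≈ 0#
        nodes→0 c h = separated complete c (λ j → q * proj₁ (h j) ,
          trans (proj₂ (h j)) (trans (*-assoc _ _ _) (*-congʳ (nat-^ j))))

        u-matrix : ∀ k l → X k l ≈ 1ₘ k l + q * M k l
        u-matrix k l = from-difference (X-1≈qM k l)

        curve : InvariantCurve G
        curve = record
          { tangent      = E.tangent nodes-cancel nodes→0 u u-matrix
          ; tangent-at-ε = E.tangent-at-ε nodes-cancel nodes→0 u u-matrix
          ; curve        = E.curveOver nodes-cancel nodes→0 u u-matrix
          ; curve-start  = λ S x → Algebra.trans S
              (E.curveOver-constant nodes-cancel nodes→0 u u-matrix S x)
              (PointGroups.ε-natural G (structureMap S) x)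
          ; taylor-curve = E.taylor-curve nodes-cancel nodes→0 u u-matrix
          }

        open OneParameterGroup p 1<p reciprocals (- q) M Mᵖ≈0 using (module At)

        E-divisible : ∀ k l → Divisible (proj₂ (At.E (dualₐ (self R)) (0# , 1#) k l))
        E-divisible k l = divisible-resp
          (proj₂ (E.exp-tangent nodes-cancel nodes→0 u u-matrix k l))
          (tangent-divisible curve (ClosedEmbedding.comorphism e $ₐ var (mat k l)))

        divisible-sum : ∀ {n} (t : Fin n → Carrier) → (∀ k → Divisible (t k)) →
                        Divisible (SemiringSum.sum semiring t)
        divisible-sum {zero}  t h = divisible-0
        divisible-sum {suc n} t h = divisible-+ _ _ (h zero) (divisible-sum (t ∘ suc) (h ∘ suc))

        M-divisible : ∀ k l → Divisible (M k l)
        M-divisible k l = divisible-resp (sym (proj₂ tangent-equation k l)) (divisible-sum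
          (λ j → proj₂ (At.E (dualₐ (self R)) (0# , 1#) k j) * Y j l)
          (λ j → divisible-resp (*-comm (Y j l) (proj₂ (At.E (dualₐ (self R)) (0# , 1#) k j)))
                   (divisible-* (Y j l) (proj₂ (At.E (dualₐ (self R)) (0# , 1#) k j)) (E-divisible k j))))
          where
          tangent-equation = M-from-tangent p 1<p reciprocals (- q) M Mᵖ≈0
          Y = proj₁ tangent-equation

        index-entry : quotients index ≡ M (proj₁ (remQuot {N} N index)) (proj₂ (remQuot {N} N index))
        index-entry = ≡.cong quotients (≡.sym (combine-remQuot {N} N index))

      -- All entries of M are divisible by p, yet the one at `index` is a unit because q was the
      -- largest common power of p.
      contradictory : ⊥
      contradictory = unit-not-divisible unit (divisible-resp (reflexive (≡.sym index-entry))
        (M-divisible (proj₁ (remQuot {N} N index)) (proj₂ (remQuot {N} N index))))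

  open MatrixOps (CommutativeRing.rawRing R) using (_-ₘ_; 1ₘ)

  no-unipotent : ∀ u → ¬ (u ≈ₐ ε) → ∀ n → n ≤ p → ¬ Annihilates G n u
  no-unipotent u u≉ε n n≤p (N , e , annihilated) = common-factor (entry e u) λ
    { (inj₁ entries≈0) → u≉ε (trivial e u (λ k l → trans (reflexive (≡.sym (entry-combine e u k l))) (entries≈0 (combine k l))))
    ; (inj₂ cf)        → contradictory e u cf (power-vanishes (pointMatrix G e u -ₘ 1ₘ) n≤p annihilated)
    }

theorem3p2 : {ℓ : Level} (p : ℕ) → Prime p →
    (R : CommutativeRing ℓ ℓ) →
    IsDVRWithUniformizer R (nat R p) →
    IsComplete p R →
    IsAlgebraicallyClosedField (R /[ p ]) →
    (φ : FrobeniusLift p R) →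
    (G : AffineGroupScheme R) →
    IsSmooth (AffineGroupScheme.O G) →
    (G⁰ : OpenSubset (AffineGroupScheme.coordinateRing G)) →
    HasNonemptyCompletion (AffineGroupScheme.O G) p G⁰ →
    (Φ : FrobeniusLiftOn p φ (AffineGroupScheme.O G) G⁰) →
    IsLieInvariantModp G p φ G⁰ Φ →
    ¬ (Σ[ u ∈ AffineGroupScheme.Point G (self R) ]
    IsUnipotent G u ×
    ¬ (u ≈ₐ AffineGroupScheme.ε G) ×
    Σ[ n ∈ ℕ ] (IsIndexOf G u n × n ≤ p))
theorem3p2 p p-prime R dvr complete closed φ G smooth G⁰ nonempty Φ lie (u , _ , u≉ε , n , index , n≤p) =
  no-unipotent p p-prime R dvr complete closed φ G smooth G⁰ nonempty Φ lie u u≉ε n n≤p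
    (IsIndexOf.annihilates index)
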